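{- For $\lambda\in\overline{K}_c$ with $|\lambda|<1$ let $$u(t,\lambda)=\sum_{n=0}^\infty\left\{\prod_{j=0}^{n-1}(\lambda-[j])\right\}f_n(t),\qquad t\in O,$$ that is, $u(\cdot,\lambda)$ is the solution, with coefficient $c_0=1$ in its expansion $\sum_{i\ge 0} c_if_i(t)$, of the equation $u(xt)-xu(t)=\lambda u(t)$, $t\in O$. Then: (i) The function $t\mapsto u(t,\lambda)$ is continuous on $O$. (ii) The function $t\mapsto u(t,\lambda)$ is analytic on $O$ if and only if $\lambda=[j]$ for some integer $j\ge 0$; in this case $u(t,\lambda)=u(t,[j])=t^{q^j}$. (iii) If $\lambda\ne[j]$ for every integer $j\ge 0$, then $t\mapsto u(t,\lambda)$ is locally analytic on $O$ if and only if $\lambda=-x$, and in that case $u(t,-x)=0$ for all $t\in O$ with $|t|\le q^{ -1}$. (iv) The relation $$u(t^{q^m},\lambda)=u(t,\lambda^{q^m}+[m]),\qquad t\in O,$$ holds for all $\lambda\in\overline{K}_c$ with $|\lambda|<1$ and all $m=0,1,2,\ldots$.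
   Context: Let $q$ be a power of a prime $p$, and let $K=\mathbf F_q((x))$ be the field of formal Laurent series $t=\sum_{j\ge N}\xi_jx^j$, $\xi_j\in\mathbf F_q$, with absolute value $|t|=q^{ -N}$ if $\xi_N\neq 0$, $|0|=0$. Let $O=\{t\in K:|t|\le 1\}=\mathbf F_q[[x]]$. Let $\overline{K}_c$ be the completion of an algebraic closure of $K$, with the uniquely extended absolute value. For an integer $j\ge 0$ put $[j]=x^{q^j}-x$ (so $[0]=0$). Carlitz polynomials: $f_i(t)=D_i^{ -1}e_i(t)$, where $D_0=1$, $D_i=[i][i-1]^q\cdots[1]^{q^{i-1}}$, $e_0(t)=t$, and $e_i(t)=\prod_{\omega\in\mathbf F_q[x],\,\deg\omega<i}(t-\omega)$ for $i\ge 1$ (the product includes $\omega=0$). Every continuous $\mathbf F_q$-linear function $u:O\to\overline{K}_c$ has a unique expansion $u=\sum_{i\ge 0}c_if_i$ with $c_i\in\overline{K}_c$, $c_i\to 0$, and conversely each such series converges uniformly on $O$ to a continuous $\mathbf F_q$-linear function. An empty product equals $1$. A function $O\to\overline{K}_c$ is analytic on a ball if on that ball it equals the sum of a power series with coefficients in $\overline{K}_c$ (centered at a point of the ball) convergent on the whole ball ($O$ itself being a ball); it is locally analytic on $O$ if each point of $O$ has a ball neighbourhood in $O$ on which the function is analytic. -}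

module Defs where

open import Algebra.Bundles using (CommutativeRing; RawRing)
import Algebra.Definitions.RawSemiring as RawSemiringDefs
open import Algebra.Morphism.Structures using (module RingMorphisms)
open import Data.Fin.Base using (Fin; toℕ)
open import Data.Integer.Base as ℤ using (ℤ; +_; -[1+_])
open import Data.List.Base as List using (List; []; _∷_)
open import Data.List.Relation.Unary.Any using (Any)
open import Data.Nat.Base as ℕ using (ℕ; zero; suc; _∸_)
open import Data.Nat.Primality using (Prime)
open import Data.Product.Base using (Σ-syntax; ∃-syntax; _×_; _,_)
open import Data.Rational.Base as ℚ using (ℚ)
open import Data.Vec.Base as Vec using (Vec; []; _∷_)
open import Function.Base using (_∘_)
open import Function.Bundles using (Inverse)
open import Level using (Level; 0ℓ; _⊔_) renaming (suc to lsuc)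
open import Relation.Binary.Core using (Rel)
open import Relation.Binary.PropositionalEquality as ≡ using (_≡_)
open import Relation.Nullary.Negation.Core using (¬_)
open import Relation.Unary using (Pred; U)

private
  variable
    c ℓ : Level

-- The value of 0# ⁻¹ is unconstrained.
record Field c ℓ : Set (lsuc (c ⊔ ℓ)) where
  infix 9 _⁻¹
  field
    commutativeRing : CommutativeRing c ℓ
  open CommutativeRing commutativeRing public
  open RawSemiringDefs (RawRing.rawSemiring rawRing) public
    using (_^_; sum; product)
  field
    _⁻¹      : Carrier → Carrier
    ⁻¹-cong  : ∀ {a b} → a ≈ b → a ⁻¹ ≈ b ⁻¹
    inverseʳ : ∀ {a} → a ≉ 0# → a * a ⁻¹ ≈ 1#
    1≉0      : 1# ≉ 0#

  -- ∑[ n ] a = a 0 + … + a (n - 1), and similarly ∏[ n ] a.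
  ∑[_] ∏[_] : ℕ → (ℕ → Carrier) → Carrier
  ∑[ n ] a = sum {n} (a ∘ toℕ)
  ∏[ n ] a = product {n} (a ∘ toℕ)

  -- A polynomial is the list of its coefficients, constant term first.
  eval : List Carrier → Carrier → Carrier
  eval as s = List.foldr (λ a r → a + s * r) 0# as

record FiniteField c ℓ : Set (lsuc (c ⊔ ℓ)) where
  field
    field′   : Field c ℓ
    p ν      : ℕ
    p-prime  : Prime p
    ν-nonZero : ℕ.NonZero ν
  q : ℕ
  q = p ℕ.^ ν
  open Field field′ public
  field
    enumeration : Inverse setoid (≡.setoid (Fin q))

  elements : List Carrier
  elements = List.map (Inverse.from enumeration) (List.allFin q)

  -- All polynomials of degree < i, as vectors of coefficients with the
  -- constant term first.
  polynomials : ∀ i → List (Vec Carrier i)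
  polynomials zero    = [] ∷ []
  polynomials (suc i) = List.cartesianProductWith _∷_ elements (polynomials i)

module Series (F : FiniteField c ℓ) where
  private module F = FiniteField F

  PowerSeries : Set c
  PowerSeries = ℕ → F.Carrier

  powerSeries : RawRing c ℓ
  powerSeries = record
    { Carrier = PowerSeries
    ; _≈_     = λ a b → ∀ n → a n F.≈ b n
    ; _+_     = λ a b n → a n F.+ b n
    ; _*_     = λ a b n → F.∑[ suc n ] (λ i → a i F.* b (n ∸ i))
    ; -_      = λ a n → F.- a n
    ; 0#      = λ _ → F.0#
    ; 1#      = λ { zero → F.1# ; (suc _) → F.0# }
    }

  indeterminate : PowerSeries
  indeterminate zero          = F.0#
  indeterminate (suc zero)    = F.1#
  indeterminate (suc (suc _)) = F.0#

  fromPolynomial : ∀ {i} → Vec F.Carrier i → PowerSeries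
  fromPolynomial []       _       = F.0#
  fromPolynomial (a ∷ _)  zero    = a
  fromPolynomial (_ ∷ as) (suc n) = fromPolynomial as n

  -- x^- N · a stands for the Laurent series ∑ₖ aₖ xᵏ⁻ᴺ. Leading zeros are
  -- allowed, so series are compared through their coefficients.
  record Laurent : Set c where
    constructor x^-_·_
    field
      pole : ℕ
      body : PowerSeries
  open Laurent

  coefficient : Laurent → ℤ → F.Carrier
  coefficient (x^- N · a) j with j ℤ.+ + N
  ... | + n      = a n
  ... | -[1+ _ ] = F.0#

  fromSeries : PowerSeries → Laurent
  fromSeries a = x^- 0 · a

  laurent : RawRing c ℓ
  laurent = record
    { Carrier = Laurent
    ; _≈_     = λ s t → ∀ j → coefficient s j F.≈ coefficient t j
    ; _+_     = λ s t → let N = pole s ℕ.+ pole t in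
                  x^- N · λ k → coefficient s (+ k ℤ.- + N) F.+ coefficient t (+ k ℤ.- + N)
    ; _*_     = λ s t → x^- (pole s ℕ.+ pole t) · RawRing._*_ powerSeries (body s) (body t)
    ; -_      = λ s → x^- pole s · RawRing.-_ powerSeries (body s)
    ; 0#      = fromSeries (RawRing.0# powerSeries)
    ; 1#      = fromSeries (RawRing.1# powerSeries)
    }

  -- t = ∑_{j ≥ N} ξⱼ xʲ with ξ_N ≠ 0
  HasOrder : Laurent → ℤ → Set ℓ
  HasOrder t N = (∀ j → j ℤ.< N → coefficient t j F.≈ F.0#) × coefficient t N F.≉ F.0#

-- 𝐪^ r stands for the real number q^r (the base q > 1 is left implicit).
-- The absolute value of the completed algebraic closure of 𝐅_q((x)) takes
-- its values in {0} ∪ q^ℚ.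
data Magnitude : Set where
  0ᵐ  : Magnitude
  𝐪^_ : ℚ → Magnitude

1ᵐ : Magnitude
1ᵐ = 𝐪^ ℚ.0ℚ

infixl 7 _*ᵐ_
_*ᵐ_ : Magnitude → Magnitude → Magnitude
0ᵐ     *ᵐ _      = 0ᵐ
(𝐪^ _) *ᵐ 0ᵐ     = 0ᵐ
(𝐪^ r) *ᵐ (𝐪^ s) = 𝐪^ (r ℚ.+ s)

infix 4 _≤ᵐ_ _<ᵐ_
data _≤ᵐ_ : Rel Magnitude 0ℓ where
  0≤_ : ∀ m → 0ᵐ ≤ᵐ m
  𝐪^≤ : ∀ {r s} → r ℚ.≤ s → 𝐪^ r ≤ᵐ 𝐪^ s

data _<ᵐ_ : Rel Magnitude 0ℓ where
  0<𝐪^ : ∀ {s} → 0ᵐ <ᵐ 𝐪^ s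
  𝐪^<  : ∀ {r s} → r ℚ.< s → 𝐪^ r <ᵐ 𝐪^ s

record AbsoluteValue (L : Field c ℓ) : Set (c ⊔ ℓ) where
  open Field L
  field
    ∣_∣         : Carrier → Magnitude
    ∣∣-cong     : ∀ {s t} → s ≈ t → ∣ s ∣ ≡ ∣ t ∣
    ∣0∣         : ∣ 0# ∣ ≡ 0ᵐ
    ∣∣-definite : ∀ {s} → ∣ s ∣ ≡ 0ᵐ → s ≈ 0#
    ∣∣-*        : ∀ s t → ∣ s * t ∣ ≡ ∣ s ∣ *ᵐ ∣ t ∣
    ultrametric : ∀ s t {m} → ∣ s ∣ ≤ᵐ m → ∣ t ∣ ≤ᵐ m → ∣ s + t ∣ ≤ᵐ m

  infix 4 _⟶_
  _⟶_ : (ℕ → Carrier) → Carrier → Set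
  s ⟶ l = ∀ r → ∃[ N ] ∀ n → N ℕ.≤ n → ∣ s n - l ∣ ≤ᵐ 𝐪^ r

  Cauchy : (ℕ → Carrier) → Set
  Cauchy s = ∀ r → ∃[ N ] ∀ m n → N ℕ.≤ m → N ℕ.≤ n → ∣ s m - s n ∣ ≤ᵐ 𝐪^ r

  Complete : Set c
  Complete = ∀ s → Cauchy s → ∃[ l ] s ⟶ l

  HasSum : (ℕ → Carrier) → Carrier → Set
  HasSum a = (λ n → ∑[ n ] a) ⟶_

record IsAlgebraicClosure (K : RawRing c ℓ) (K̄ : Field c ℓ)
                          (i : RawRing.Carrier K → Field.Carrier K̄) : Set (c ⊔ ℓ) where
  private module K = RawRing K
  open Field K̄
  field
    isRingHomomorphism : RingMorphisms.IsRingHomomorphism K rawRing i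
    algebraic : ∀ s → Σ[ as ∈ List K.Carrier ]
                  Any (K._≉ K.0#) as × eval (List.map i as) s ≈ 0#
    closed    : ∀ a as → Any (_≉ 0#) as → ∃[ s ] eval (a ∷ as) s ≈ 0#

record CompletedClosure (F : FiniteField c ℓ) : Set (lsuc (c ⊔ ℓ)) where
  open Series F
  field
    closure             : Field c ℓ
    toClosure           : Laurent → Field.Carrier closure
    isAlgebraicClosure  : IsAlgebraicClosure laurent closure toClosure
    completion          : Field c ℓ
    absoluteValue       : AbsoluteValue completion
    toCompletion        : Field.Carrier closure → Field.Carrier completion
  open Field completion public
  open AbsoluteValue absoluteValue public
  field
    toCompletion-isRingHomomorphism :
      RingMorphisms.IsRingHomomorphism (Field.rawRing closure) rawRing toCompletion
    extends  : ∀ t N → HasOrder t N → ∣ toCompletion (toClosure t) ∣ ≡ 𝐪^ ((ℤ.- N) ℚ./ 1)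
    dense    : ∀ s r → ∃[ a ] ∣ s - toCompletion a ∣ ≤ᵐ 𝐪^ r
    complete : Complete

module Carlitz (F : FiniteField c ℓ) (C : CompletedClosure F) where
  open Series F
  open FiniteField F public using (q; polynomials)
  open CompletedClosure C public

  O : Set c
  O = PowerSeries

  open RawRing powerSeries public using () renaming (_*_ to _*ₒ_)
  open RawSemiringDefs (RawRing.rawSemiring powerSeries) public using ()
    renaming (_^_ to _^ₒ_)

  xₒ : O
  xₒ = indeterminate

  ι : O → Carrier
  ι t = toCompletion (toClosure (fromSeries t))

  x : Carrier
  x = ι xₒ

  [_] : ℕ → Carrier
  [ j ] = x ^ (q ℕ.^ j) - x

  D : ℕ → Carrier
  D i = ∏[ i ] (λ j → [ i ∸ j ] ^ (q ℕ.^ j))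

  e : ℕ → Carrier → Carrier
  e zero    s = s
  e (suc i) s = List.foldr _*_ 1# (List.map (λ ω → s - ι (fromPolynomial ω)) (polynomials (suc i)))

  f : ℕ → O → Carrier
  f i t = D i ⁻¹ * e i (ι t)

  -- g = ∑ᵢ aᵢ fᵢ pointwise on O
  HasExpansion : (O → Carrier) → (ℕ → Carrier) → Set c
  HasExpansion g a = ∀ t → HasSum (λ i → a i * f i t) (g t)

  -- λ′ is the parameter λ of the equation u(xt) - x u(t) = λ u(t).
  uCoefficient : Carrier → ℕ → Carrier
  uCoefficient λ′ n = ∏[ n ] (λ j → λ′ - [ j ])

  Solves : Carrier → (O → Carrier) → Set (c ⊔ ℓ)
  Solves λ′ g = ∀ t → g (xₒ *ₒ t) - x * g t ≈ λ′ * g t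

  Continuous : (O → Carrier) → Set c
  Continuous g = ∀ t₀ r → ∃[ δ ] ∀ t →
    ∣ ι t - ι t₀ ∣ ≤ᵐ 𝐪^ δ → ∣ g t - g t₀ ∣ ≤ᵐ 𝐪^ r

  Ball : O → ℚ → Pred O 0ℓ
  Ball t₀ r t = ∣ ι t - ι t₀ ∣ ≤ᵐ 𝐪^ r

  AnalyticOn : Pred O 0ℓ → (O → Carrier) → Set c
  AnalyticOn B g = Σ[ b ∈ O ] B b × Σ[ a ∈ (ℕ → Carrier) ]
    (∀ t → B t → HasSum (λ n → a n * (ι t - ι b) ^ n) (g t))

  Analytic : (O → Carrier) → Set c
  Analytic = AnalyticOn U

  -- In an ultrametric space each point of a ball is a center of it, so the
  -- balls that contain t₀ are the balls around t₀.
  LocallyAnalytic : (O → Carrier) → Set c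
  LocallyAnalytic g = ∀ t₀ → ∃[ r ] AnalyticOn (Ball t₀ r) g

{-# OPTIONS --safe #-}
module Submission where

-- Put z = x + λ, so that λ - [j] = z - x^(q^j). The normalised Carlitz
-- polynomials satisfy fₙ(x t) = x^(q^n) fₙ(t) + fₙ₋₁(t), and therefore the
-- series u(·,λ) satisfies u(t₀ + x t′) = t₀ + z u(t′): it is the
-- substitution t ↦ t(z) of z for the indeterminate. Continuity, uniqueness
-- and (iv) are immediate from this, as is u(t) = t^(q^j) for z = x^(q^j),
-- that is λ = [j], and u(t) = t₀ for z = 0, that is λ = -x.
--
-- Conversely, if u is given by a power series ∑ aₙ tⁿ near 0, then
-- u(x t) = z u(t) yields aₙ (xⁿ - z) = 0. When z is no power of x, all aₙ
-- vanish, so z^N = u(x^N) = 0 for large N. When z = xⁿ, it follows that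
-- u(t) = tⁿ, and (1 + a x)ⁿ = 1 + a xⁿ for all a in 𝐅_q forces n to be a
-- power of q.

open import Defs
open import Algebra.Bundles using (CommutativeRing; RawRing; CommutativeMonoid)
import Algebra.Definitions.RawMonoid as RawMonoidMult
open import Algebra.Morphism.Structures using (module RingMorphisms)
import Algebra.Properties.CommutativeMonoid.Sum as MonoidSum
import Algebra.Properties.CommutativeSemiring.Binomial as Binomial
import Algebra.Properties.CommutativeSemiring.Exp as SemiringExp
import Algebra.Properties.Ring as RingProperties
import Algebra.Properties.Semiring.Mult as SemiringMult
import Algebra.Properties.Semiring.Mult.TCOptimised as OptimisedMult
import Algebra.Solver.Ring as RingSolver
import Algebra.Solver.Ring.AlmostCommutativeRing as ACR
open import Data.Empty using (⊥; ⊥-elim)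
open import Data.Fin.Base as Fin using (Fin)
import Data.Fin.Properties as Fin
open import Data.Fin.Permutation using (Permutation′; permutation)
open import Data.Integer.Base as ℤ using (ℤ; -[1+_]; -1ℤ)
import Data.Integer.Properties as ℤ
import Data.Integer.Tactic.RingSolver as ℤ
open import Data.List.Base as List using (List; []; _∷_; _++_; length)
import Data.List.Properties as List
open import Data.List.Relation.Unary.All as All using (All; []; _∷_)
import Data.List.Relation.Unary.All.Properties as All
open import Data.List.Relation.Unary.AllPairs as AllPairs using (AllPairs; []; _∷_)
import Data.List.Relation.Unary.AllPairs.Properties as AllPairs
import Data.List.Relation.Unary.Unique.Propositional.Properties as Unique
open import Data.Maybe.Base using (Maybe; just; nothing)
open import Data.Nat.Base as ℕ using (ℕ; zero; suc; _∸_; z≤n; s≤s) renaming (_^_ to _^ℕ_)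
import Data.Nat.Combinatorics as ℕ
open import Data.Nat.Coprimality using (Coprime; coprime-Bézout)
import Data.Nat.Divisibility as ℕ
import Data.Nat.DivMod as ℕ
open import Data.Nat.GCD using (module Bézout)
import Data.Nat.Induction as ℕ
open import Data.Nat.Primality using (Prime; euclidsLemma; prime⇒nonTrivial; prime⇒nonZero; prime⇒irreducible)
import Data.Nat.Properties as ℕ
open import Data.Product.Base using (∃-syntax; Σ-syntax; _×_; _,_; proj₁; proj₂)
open import Data.Rational.Base as ℚ using (ℚ; _/_)
import Data.Rational.Properties as ℚ
open import Data.Rational.Unnormalised.Base as ℚᵘ using (mkℚᵘ; *≡*; *≤*)
import Data.Rational.Unnormalised.Properties as ℚᵘ
open import Data.Sum.Base using (_⊎_; inj₁; inj₂)
open import Data.Unit.Base using (tt)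
open import Data.Vec.Base as Vec using (Vec; []; _∷_)
open import Function.Base using (_∘_; id)
open import Function.Bundles using (_⇔_; mk⇔; Inverse)
open import Level using (Level; 0ℓ)
import Relation.Binary.Reasoning.Setoid as SetoidReasoning
open import Relation.Binary.PropositionalEquality as ≡ using (_≡_; _≢_)
open import Relation.Nullary using (¬_; Dec; yes; no; contradiction)
open import Relation.Nullary.Decidable as Dec using (decidable-stable)
open import Relation.Unary using (Pred; U)

-- The relation u(t₀ + x t′) = t₀ + z u(t′) is usable only for bounded u: after n steps there
-- remains zⁿ times the value of u at the n-th tail of t, and this tends to 0 only under a bound.
-- Hence the weight put on |fₙ| ≤ 1 on O, which together with cₙ → 0 bounds every series ∑ cₙ fₙ.
--
-- The formula for fₙ(x t) is proved for functions `E n` obtained by iterating s ↦ (s^q - s) /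
-- [n + 1]. That these are the fₙ, which are products over all polynomials of degree < n, is a
-- separate result and rests on splitting off the constant term of ω.
--
-- Constructively, the order of a power series over 𝐅_q cannot be computed, so `extends` does not
-- apply to it directly. In the completion, however, being 0 is decidable, because a magnitude is
-- visibly zero or a power of q. Arguments by contradiction about sizes and single coefficients are
-- therefore legitimate.

private
  variable
    c ℓ : Level

-- Ring solver with integer coefficients.

module IntegerSolver (R : CommutativeRing c ℓ) where

  private
    open import Data.Integer.Base using (+_)
    open CommutativeRing R
    open RingProperties ring
    open OptimisedMult semiring
      using (×1-homo-*; ×-homo-+; 1+×) renaming (_×_ to _×′_)
    open SetoidReasoning setoid

    ⟦_⟧ : ℤ → Carrier
    ⟦ + n ⟧      = n ×′ 1#
    ⟦ -[1+ n ] ⟧ = - (suc n ×′ 1#)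

    -‿homo : ∀ i → ⟦ ℤ.- i ⟧ ≈ - ⟦ i ⟧
    -‿homo (+ zero)    = sym -0#≈0#
    -‿homo (+ (suc n)) = refl
    -‿homo -[1+ n ]    = sym (-‿involutive _)

    cancel : ∀ a b → (1# + a) - (1# + b) ≈ a - b
    cancel a b = begin
      (1# + a) + - (1# + b)     ≈⟨ +-cong (+-comm _ _) (-‿anti-homo-+ _ _) ⟩
      (a + 1#) + (- b + - 1#)   ≈⟨ +-assoc _ _ _ ⟩
      a + (1# + (- b + - 1#))   ≈⟨ +-congˡ (trans (+-comm _ _) (+-assoc _ _ _)) ⟩
      a + (- b + (- 1# + 1#))   ≈⟨ +-congˡ (+-congˡ (-‿inverseˡ 1#)) ⟩
      a + (- b + 0#)            ≈⟨ +-congˡ (+-identityʳ _) ⟩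
      a - b                     ∎

    ⊖-homo : ∀ m n → ⟦ m ℤ.⊖ n ⟧ ≈ m ×′ 1# - n ×′ 1#
    ⊖-homo zero    zero    = sym (-‿inverseʳ 0#)
    ⊖-homo zero    (suc n) = sym (+-identityˡ _)
    ⊖-homo (suc m) zero    = trans (sym (+-identityʳ _)) (+-congˡ (sym -0#≈0#))
    ⊖-homo (suc m) (suc n) = begin
      ⟦ suc m ℤ.⊖ suc n ⟧                  ≡⟨ ≡.cong ⟦_⟧ (ℤ.[1+m]⊖[1+n]≡m⊖n m n) ⟩
      ⟦ m ℤ.⊖ n ⟧                          ≈⟨ ⊖-homo m n ⟩
      m ×′ 1# - n ×′ 1#                    ≈⟨ cancel _ _ ⟨
      (1# + m ×′ 1#) - (1# + n ×′ 1#)      ≈⟨ +-cong (1+× m 1#) (-‿cong (1+× n 1#)) ⟨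
      suc m ×′ 1# - suc n ×′ 1#            ∎

    +-homo : ∀ i j → ⟦ i ℤ.+ j ⟧ ≈ ⟦ i ⟧ + ⟦ j ⟧
    +-homo (+ m)    (+ n)    = ×-homo-+ 1# m n
    +-homo (+ m)    -[1+ n ] = ⊖-homo m (suc n)
    +-homo -[1+ m ] (+ n)    = trans (⊖-homo n (suc m)) (+-comm _ _)
    +-homo -[1+ m ] -[1+ n ] = begin
      - (suc (suc (m ℕ.+ n)) ×′ 1#)        ≡⟨ ≡.cong (λ k → - (suc k ×′ 1#)) (ℕ.+-suc m n) ⟨
      - ((suc m ℕ.+ suc n) ×′ 1#)          ≈⟨ -‿cong (×-homo-+ 1# (suc m) (suc n)) ⟩
      - (suc m ×′ 1# + suc n ×′ 1#)        ≈⟨ -‿+-comm _ _ ⟨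
      - (suc m ×′ 1#) - suc n ×′ 1#        ∎

    *-homo⁺ : ∀ m j → ⟦ + m ℤ.* j ⟧ ≈ ⟦ + m ⟧ * ⟦ j ⟧
    *-homo⁺ m (+ n)    = begin
      ⟦ + m ℤ.* + n ⟧      ≡⟨ ≡.cong ⟦_⟧ (ℤ.pos-* m n) ⟨
      (m ℕ.* n) ×′ 1#      ≈⟨ ×1-homo-* m n ⟩
      m ×′ 1# * n ×′ 1#    ∎
    *-homo⁺ m -[1+ n ] = begin
      ⟦ + m ℤ.* -[1+ n ] ⟧           ≡⟨ ≡.cong ⟦_⟧ (ℤ.neg-distribʳ-* (+ m) (+ suc n)) ⟨
      ⟦ ℤ.- (+ m ℤ.* + suc n) ⟧      ≈⟨ -‿homo (+ m ℤ.* + suc n) ⟩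
      - ⟦ + m ℤ.* + suc n ⟧          ≈⟨ -‿cong (*-homo⁺ m (+ suc n)) ⟩
      - (m ×′ 1# * suc n ×′ 1#)      ≈⟨ -‿distribʳ-* _ _ ⟩
      m ×′ 1# * - (suc n ×′ 1#)      ∎

    *-homo : ∀ i j → ⟦ i ℤ.* j ⟧ ≈ ⟦ i ⟧ * ⟦ j ⟧
    *-homo (+ m)    j = *-homo⁺ m j
    *-homo -[1+ m ] j = begin
      ⟦ -[1+ m ] ℤ.* j ⟧           ≡⟨ ≡.cong ⟦_⟧ (ℤ.neg-distribˡ-* (+ suc m) j) ⟨
      ⟦ ℤ.- (+ suc m ℤ.* j) ⟧      ≈⟨ -‿homo (+ suc m ℤ.* j) ⟩
      - ⟦ + suc m ℤ.* j ⟧          ≈⟨ -‿cong (*-homo⁺ (suc m) j) ⟩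
      - (suc m ×′ 1# * ⟦ j ⟧)      ≈⟨ -‿distribˡ-* _ _ ⟩
      - (suc m ×′ 1#) * ⟦ j ⟧      ∎

    morphism : ℤ.+-*-rawRing ACR.-Raw-AlmostCommutative⟶ ACR.fromCommutativeRing R
    morphism = record
      { ⟦_⟧    = ⟦_⟧
      ; +-homo = +-homo
      ; *-homo = *-homo
      ; -‿homo = -‿homo
      ; 0-homo = refl
      ; 1-homo = refl
      }

    -- Distinct integers yield `nothing` even where the characteristic identifies them: the solver
    -- proves identities valid over ℤ, and characteristic p enters through the Frobenius lemmas.
    _≟_ : ∀ i j → Maybe (⟦ i ⟧ ≈ ⟦ j ⟧)
    i ≟ j with i ℤ.≟ j
    ... | yes ≡.refl = just refl
    ... | no  _      = nothing

  open RingSolver ℤ.+-*-rawRing (ACR.fromCommutativeRing R) morphism _≟_ public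
    using (solve; _:=_; _:+_; _:*_; _:-_; :-_; con; _:^_; Polynomial)

  :0 :1 : ∀ {n} → Polynomial n
  :0 = con ℤ.0ℤ
  :1 = con ℤ.1ℤ

-- Magnitudes: order and powers.

module Magnitudes where

  open import Data.Integer.Base using (+_)
  open RawMonoidMult ℚ.+-0-rawMonoid using () renaming (_×_ to _×ℚ_)

  ≤ᵐ-refl : ∀ {a} → a ≤ᵐ a
  ≤ᵐ-refl {0ᵐ}    = 0≤ 0ᵐ
  ≤ᵐ-refl {𝐪^ r} = 𝐪^≤ ℚ.≤-refl

  ≤ᵐ-reflexive : ∀ {a b} → a ≡ b → a ≤ᵐ b
  ≤ᵐ-reflexive ≡.refl = ≤ᵐ-refl

  ≤ᵐ-trans : ∀ {a b d} → a ≤ᵐ b → b ≤ᵐ d → a ≤ᵐ d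
  ≤ᵐ-trans (0≤ _)   _        = 0≤ _
  ≤ᵐ-trans (𝐪^≤ p) (𝐪^≤ q) = 𝐪^≤ (ℚ.≤-trans p q)

  ≤ᵐ-total : ∀ a b → a ≤ᵐ b ⊎ b ≤ᵐ a
  ≤ᵐ-total 0ᵐ      b       = inj₁ (0≤ b)
  ≤ᵐ-total (𝐪^ r) 0ᵐ      = inj₂ (0≤ _)
  ≤ᵐ-total (𝐪^ r) (𝐪^ s) with ℚ.≤-total r s
  ... | inj₁ r≤s = inj₁ (𝐪^≤ r≤s)
  ... | inj₂ s≤r = inj₂ (𝐪^≤ s≤r)

  infix 4 _≤ᵐ?_
  _≤ᵐ?_ : ∀ a b → Dec (a ≤ᵐ b)
  0ᵐ     ≤ᵐ? b      = yes (0≤ b)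
  𝐪^ r ≤ᵐ? 0ᵐ     = no λ ()
  𝐪^ r ≤ᵐ? 𝐪^ s = Dec.map′ 𝐪^≤ (λ { (𝐪^≤ p) → p }) (r ℚ.≤? s)

  *ᵐ-mono-≤ᵐ : ∀ {a b a′ b′} → a ≤ᵐ b → a′ ≤ᵐ b′ → a *ᵐ a′ ≤ᵐ b *ᵐ b′
  *ᵐ-mono-≤ᵐ (0≤ _)   _        = 0≤ _
  *ᵐ-mono-≤ᵐ (𝐪^≤ _) (0≤ _)   = 0≤ _
  *ᵐ-mono-≤ᵐ (𝐪^≤ p) (𝐪^≤ q) = 𝐪^≤ (ℚ.+-mono-≤ p q)

  ≤ᵐ-<ᵐ-trans : ∀ {a b d} → a ≤ᵐ b → b <ᵐ d → a <ᵐ d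
  ≤ᵐ-<ᵐ-trans (0≤ _)   0<𝐪^    = 0<𝐪^
  ≤ᵐ-<ᵐ-trans (0≤ _)   (𝐪^< _) = 0<𝐪^
  ≤ᵐ-<ᵐ-trans (𝐪^≤ p) (𝐪^< q) = 𝐪^< (ℚ.≤-<-trans p q)

  <ᵐ⇒≤ᵐ : ∀ {a b} → a <ᵐ b → a ≤ᵐ b
  <ᵐ⇒≤ᵐ 0<𝐪^    = 0≤ _
  <ᵐ⇒≤ᵐ (𝐪^< p) = 𝐪^≤ (ℚ.<⇒≤ p)

  <ᵐ⇒≱ᵐ : ∀ {a b} → a <ᵐ b → ¬ b ≤ᵐ a
  <ᵐ⇒≱ᵐ (𝐪^< p) (𝐪^≤ q) = ℚ.<-irrefl ≡.refl (ℚ.<-≤-trans p q)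

  *ᵐ-cancelˡ-≤ᵐ : ∀ {r a b} → 𝐪^ r *ᵐ a ≤ᵐ 𝐪^ r *ᵐ b → a ≤ᵐ b
  *ᵐ-cancelˡ-≤ᵐ {r} {0ᵐ}             _       = 0≤ _
  *ᵐ-cancelˡ-≤ᵐ {r} {𝐪^ s} {𝐪^ t} (𝐪^≤ p) = 𝐪^≤ (≡.subst₂ ℚ._≤_ (cancel s) (cancel t) (ℚ.+-monoʳ-≤ (ℚ.- r) p))
    where
    cancel : ∀ s → ℚ.- r ℚ.+ (r ℚ.+ s) ≡ s
    cancel s = ≡.trans (≡.sym (ℚ.+-assoc (ℚ.- r) r s))
               (≡.trans (≡.cong (ℚ._+ s) (ℚ.+-inverseˡ r)) (ℚ.+-identityˡ s))

  infixr 8 _^ᵐ_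
  _^ᵐ_ : Magnitude → ℕ → Magnitude
  a ^ᵐ zero  = 1ᵐ
  a ^ᵐ suc n = a *ᵐ a ^ᵐ n

  𝐪^-^ᵐ : ∀ r n → (𝐪^ r) ^ᵐ n ≡ 𝐪^ (n ×ℚ r)
  𝐪^-^ᵐ r zero    = ≡.refl
  𝐪^-^ᵐ r (suc n) = ≡.cong (𝐪^ r *ᵐ_) (𝐪^-^ᵐ r n)

  -- The fraction is left unreduced: keeping the denominator of `r` turns the comparison in `×ℚ-≤`
  -- into an inequality of integers.
  toℚᵘ-× : ∀ n r → ℚ.toℚᵘ (n ×ℚ r) ℚᵘ.≃ mkℚᵘ (+ n ℤ.* ℚ.numerator r) (ℚ.denominator-1 r)
  toℚᵘ-× zero    r = *≡* (≡.trans (ℤ.*-zeroˡ (+ suc d)) (≡.sym (≡.cong (ℤ._* + 1) (ℤ.*-zeroˡ a))))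
    where a = ℚ.numerator r ; d = ℚ.denominator-1 r
  toℚᵘ-× (suc n) r@(ℚ.mkℚ a d _) = ℚᵘ.≃-trans (ℚ.toℚᵘ-homo-+ r (n ×ℚ r))
                     (ℚᵘ.≃-trans (ℚᵘ.+-congʳ (ℚ.toℚᵘ r) (toℚᵘ-× n r))
                     (*≡* (lemma a (+ n) (+ suc d))))
    where
    lemma : ∀ a n d → (a ℤ.* d ℤ.+ (n ℤ.* a) ℤ.* d) ℤ.* d ≡ ((ℤ.1ℤ ℤ.+ n) ℤ.* a) ℤ.* (d ℤ.* d)
    lemma = ℤ.solve-∀

  ×ℚ-≤ : ∀ n r s → + n ℤ.* ℚ.numerator r ℤ.* + suc (ℚ.denominator-1 s) ℤ.≤
                   ℚ.numerator s ℤ.* + suc (ℚ.denominator-1 r) → n ×ℚ r ℚ.≤ s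
  ×ℚ-≤ n r (ℚ.mkℚ _ _ _) p = ℚ.toℚᵘ-cancel-≤ (ℚᵘ.≤-trans (ℚᵘ.≤-reflexive (toℚᵘ-× n r)) (*≤* p))

  powers-vanish : ∀ r → ∃[ n ] (𝐪^ (-1ℤ / 1)) ^ᵐ n ≤ᵐ 𝐪^ r
  powers-vanish r = n , ≤ᵐ-trans (≤ᵐ-reflexive (𝐪^-^ᵐ (-1ℤ / 1) n)) (𝐪^≤ (×ℚ-≤ n (-1ℤ / 1) r bound))
    where
    a = ℚ.numerator r ; d = ℚ.denominator-1 r
    -- A fraction with numerator a is at least -|a|, since its denominator is at least 1.
    n = ℤ.∣ a ∣
    open ℤ.≤-Reasoning
    -∣a∣≤a : ∀ a → ℤ.- (+ ℤ.∣ a ∣) ℤ.≤ a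
    -∣a∣≤a (+ zero)  = ℤ.≤-refl
    -∣a∣≤a (+ suc n) = ℤ.-≤+
    -∣a∣≤a -[1+ n ]  = ℤ.≤-refl
    bound : + n ℤ.* -1ℤ ℤ.* + suc d ℤ.≤ a ℤ.* + 1
    bound = begin
      + n ℤ.* -1ℤ ℤ.* + suc d       ≡⟨ ≡.cong (ℤ._* + suc d) (≡.trans (ℤ.*-comm (+ n) -1ℤ) (ℤ.-1*i≡-i (+ n))) ⟩
      ℤ.- (+ n) ℤ.* + suc d         ≡⟨ ℤ.neg-distribˡ-* (+ n) (+ suc d) ⟨
      ℤ.- (+ n ℤ.* + suc d)         ≡⟨ ≡.cong ℤ.-_ (ℤ.pos-* n (suc d)) ⟨
      ℤ.- (+ (n ℕ.* suc d))         ≤⟨ ℤ.neg-mono-≤ (ℤ.+≤+ (ℕ.m≤m*n n (suc d))) ⟩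
      ℤ.- (+ n)                     ≤⟨ -∣a∣≤a a ⟩
      a                             ≡⟨ ℤ.*-identityʳ a ⟨
      a ℤ.* + 1                     ∎

  powers-small : ∀ {a} → a <ᵐ 1ᵐ → ∃[ n ] a ^ᵐ n ≤ᵐ 𝐪^ (-1ℤ / 1)
  powers-small 0<𝐪^        = 1 , 0≤ _
  powers-small {𝐪^ r@(ℚ.mkℚ (+ n) d _)} (𝐪^< r<0) = contradiction r<0 (λ p → ℚ.<-irrefl ≡.refl (ℚ.<-≤-trans p (ℚ.nonNegative⁻¹ r)))
  powers-small {𝐪^ r@(ℚ.mkℚ -[1+ n ] d _)} (𝐪^< r<0) =
    -- The denominator of `r` is the exponent: its product with `r` is a negative integer, hence at
    -- most -1.
    suc d , ≤ᵐ-trans (≤ᵐ-reflexive (𝐪^-^ᵐ r (suc d))) (𝐪^≤ (×ℚ-≤ (suc d) r (-1ℤ / 1) bound))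
    where
    open ℤ.≤-Reasoning
    bound : + suc d ℤ.* -[1+ n ] ℤ.* + 1 ℤ.≤ -1ℤ ℤ.* + suc d
    bound = begin
      + suc d ℤ.* -[1+ n ] ℤ.* + 1   ≡⟨ ℤ.*-identityʳ _ ⟩
      + suc d ℤ.* -[1+ n ]           ≤⟨ ℤ.*-monoˡ-≤-nonNeg (+ suc d) (ℤ.-≤- z≤n) ⟩
      + suc d ℤ.* -1ℤ                ≡⟨ ℤ.*-comm (+ suc d) -1ℤ ⟩
      -1ℤ ℤ.* + suc d                ∎

-- Binomial coefficients divisible by a prime.

prime∤! : ∀ {p} → Prime p → ∀ k → k ℕ.< p → ¬ p ℕ.∣ k ℕ.!
prime∤! pr zero    k<p p∣ = ℕ.>⇒∤ (ℕ.nonTrivial⇒n>1 _ {{prime⇒nonTrivial pr}}) p∣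
prime∤! pr (suc k) k<p p∣ with euclidsLemma (suc k) (k ℕ.!) pr p∣
... | inj₁ p∣1+k = ℕ.>⇒∤ k<p p∣1+k
... | inj₂ p∣k!  = prime∤! pr k (ℕ.<-trans (ℕ.n<1+n k) k<p) p∣k!

-- The prime divides p! = C(p, k) k! (p - k)!, while both factorials have only factors below p.
prime∣C : ∀ {p} → Prime p → ∀ k → .{{_ : ℕ.NonZero k}} → k ℕ.< p → p ℕ.∣ p ℕ.C k
prime∣C {p@(suc p-1)} pr k@(suc k-1) k<p with euclidsLemma (p ℕ.C k) (k ℕ.! ℕ.* (p ∸ k) ℕ.!) pr p∣product
  where
  instance _ = k ℕ.!* (p ∸ k) !≢0
  p∣product : p ℕ.∣ (p ℕ.C k) ℕ.* (k ℕ.! ℕ.* (p ∸ k) ℕ.!)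
  p∣product = ≡.subst (p ℕ.∣_)
    (≡.sym (≡.trans (≡.cong (ℕ._* (k ℕ.! ℕ.* (p ∸ k) ℕ.!)) (ℕ.nCk≡n!/k![n-k]! (ℕ.<⇒≤ k<p)))
                    (ℕ.m/n*n≡m (ℕ.k![n∸k]!∣n! (ℕ.<⇒≤ k<p)))))
    (ℕ.m∣m*n (p-1 ℕ.!))
... | inj₁ p∣C = p∣C
... | inj₂ p∣k![p∸k]! with euclidsLemma (k ℕ.!) ((p ∸ k) ℕ.!) pr p∣k![p∸k]!
...   | inj₁ p∣k!     = contradiction p∣k! (prime∤! pr k k<p)
...   | inj₂ p∣[p∸k]! = contradiction p∣[p∸k]! (prime∤! pr (p ∸ k) (ℕ.∸-monoʳ-< ℕ.z<s (ℕ.<⇒≤ k<p)))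

-- Fields: finite sums and products, roots of monic polynomials, Frobenius.

module FieldProperties (L : Field c ℓ) where

  open Field L public
  open RingProperties ring public
  open SemiringExp commutativeSemiring public
    using (^-congˡ; ^-homo-*; ^-assocʳ; ^-distrib-*; ^-congʳ)
  open SemiringMult semiring public
    using (×-congʳ; ×-assoc-*; ×-assocˡ; ×1-homo-*) renaming (_×_ to infixr 8 _·_)
  open IntegerSolver commutativeRing public
  open SetoidReasoning setoid public

  x-y≈0⇒x≈y : ∀ {a b} → a - b ≈ 0# → a ≈ b
  x-y≈0⇒x≈y {a} {b} a-b≈0 = begin
    a            ≈⟨ solve 2 (λ a b → a := (a :- b) :+ b) refl a b ⟩
    (a - b) + b  ≈⟨ +-congʳ a-b≈0 ⟩
    0# + b       ≈⟨ +-identityˡ b ⟩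
    b            ∎

  x≈y⇒x-y≈0 : ∀ {a b} → a ≈ b → a - b ≈ 0#
  x≈y⇒x-y≈0 {a} {b} a≈b = trans (+-congʳ a≈b) (-‿inverseʳ b)

  inverseˡ : ∀ {a} → a ≉ 0# → a ⁻¹ * a ≈ 1#
  inverseˡ a≉0 = trans (*-comm _ _) (inverseʳ a≉0)

  ⁻¹-*-cancelˡ : ∀ {a} b → a ≉ 0# → a ⁻¹ * (a * b) ≈ b
  ⁻¹-*-cancelˡ b a≉0 = trans (sym (*-assoc _ _ _)) (trans (*-congʳ (inverseˡ a≉0)) (*-identityˡ b))

  *-⁻¹-cancelˡ : ∀ {a} b → a ≉ 0# → a * (a ⁻¹ * b) ≈ b
  *-⁻¹-cancelˡ b a≉0 = trans (sym (*-assoc _ _ _)) (trans (*-congʳ (inverseʳ a≉0)) (*-identityˡ b))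

  *-cancelˡ : ∀ {a b d} → a ≉ 0# → a * b ≈ a * d → b ≈ d
  *-cancelˡ {a} {b} {d} a≉0 ab≈ad = begin
    b                ≈⟨ ⁻¹-*-cancelˡ b a≉0 ⟨
    a ⁻¹ * (a * b)   ≈⟨ *-congˡ ab≈ad ⟩
    a ⁻¹ * (a * d)   ≈⟨ ⁻¹-*-cancelˡ d a≉0 ⟩
    d                ∎

  *-zero-cancelˡ : ∀ {a b} → a ≉ 0# → a * b ≈ 0# → b ≈ 0#
  *-zero-cancelˡ a≉0 ab≈0 = *-cancelˡ a≉0 (trans ab≈0 (sym (zeroʳ _)))

  *-nonZero : ∀ {a b} → a ≉ 0# → b ≉ 0# → a * b ≉ 0#
  *-nonZero a≉0 b≉0 ab≈0 = b≉0 (*-zero-cancelˡ a≉0 ab≈0)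

  ^-nonZero : ∀ {a} n → a ≉ 0# → a ^ n ≉ 0#
  ^-nonZero zero    a≉0 = 1≉0
  ^-nonZero (suc n) a≉0 = *-nonZero a≉0 (^-nonZero n a≉0)

  ⁻¹-nonZero : ∀ {a} → a ≉ 0# → a ⁻¹ ≉ 0#
  ⁻¹-nonZero a≉0 a⁻¹≈0 = 1≉0 (trans (sym (inverseʳ a≉0)) (trans (*-congˡ a⁻¹≈0) (zeroʳ _)))

  0^n≈0 : ∀ n .{{_ : ℕ.NonZero n}} → 0# ^ n ≈ 0#
  0^n≈0 (suc n) = zeroˡ _

  1^n≈1 : ∀ n → 1# ^ n ≈ 1#
  1^n≈1 zero    = refl
  1^n≈1 (suc n) = trans (*-identityˡ _) (1^n≈1 n)

  ^-comm : ∀ a m n → (a ^ m) ^ n ≈ (a ^ n) ^ m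
  ^-comm a m n = trans (^-assocʳ a m n) (trans (^-congʳ a (ℕ.*-comm m n)) (sym (^-assocʳ a n m)))

  ∑-cong : ∀ n {a b : ℕ → Carrier} → (∀ k → a k ≈ b k) → ∑[ n ] a ≈ ∑[ n ] b
  ∑-cong zero    a≈b = refl
  ∑-cong (suc n) a≈b = +-cong (a≈b 0) (∑-cong n (a≈b ∘ suc))

  ∑-last : ∀ n (a : ℕ → Carrier) → ∑[ suc n ] a ≈ ∑[ n ] a + a n
  ∑-last zero    a = +-comm _ _
  ∑-last (suc n) a = trans (+-congˡ (∑-last n (a ∘ suc))) (sym (+-assoc _ _ _))

  ∏-last : ∀ n (a : ℕ → Carrier) → ∏[ suc n ] a ≈ ∏[ n ] a * a n
  ∏-last zero    a = *-comm _ _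
  ∏-last (suc n) a = trans (*-congˡ (∏-last n (a ∘ suc))) (sym (*-assoc _ _ _))

  ∏-cong : ∀ n {a b : ℕ → Carrier} → (∀ k → a k ≈ b k) → ∏[ n ] a ≈ ∏[ n ] b
  ∏-cong zero    a≈b = refl
  ∏-cong (suc n) a≈b = *-cong (a≈b 0) (∏-cong n (a≈b ∘ suc))

  ∏-^ : ∀ n (a : ℕ → Carrier) k → (∏[ n ] a) ^ k ≈ ∏[ n ] (λ i → a i ^ k)
  ∏-^ zero    a k = 1^n≈1 k
  ∏-^ (suc n) a k = trans (^-distrib-* _ _ k) (*-congˡ (∏-^ n (a ∘ suc) k))

  ∑-+ : ∀ n (a b : ℕ → Carrier) → ∑[ n ] (λ k → a k + b k) ≈ ∑[ n ] a + ∑[ n ] b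
  ∑-+ zero    a b = sym (+-identityˡ 0#)
  ∑-+ (suc n) a b = trans (+-congˡ (∑-+ n (a ∘ suc) (b ∘ suc)))
    (solve 4 (λ a b A B → a :+ b :+ (A :+ B) := a :+ A :+ (b :+ B)) refl _ _ _ _)

  ∑-*ˡ : ∀ n s (a : ℕ → Carrier) → ∑[ n ] (λ k → s * a k) ≈ s * ∑[ n ] a
  ∑-*ˡ zero    s a = sym (zeroʳ s)
  ∑-*ˡ (suc n) s a = trans (+-congˡ (∑-*ˡ n s (a ∘ suc))) (sym (distribˡ s _ _))

  ∑-zero : ∀ n {a : ℕ → Carrier} → (∀ k → a k ≈ 0#) → ∑[ n ] a ≈ 0#
  ∑-zero zero    a≈0 = refl
  ∑-zero (suc n) a≈0 = trans (+-cong (a≈0 0) (∑-zero n (a≈0 ∘ suc))) (+-identityˡ 0#)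

  -- The vector holds the coefficients below the leading one, which is 1. Its length is thus the
  -- exact degree, and the zero polynomial does not occur.
  monic : ∀ {n} → Vec Carrier n → Carrier → Carrier
  monic []       s = 1#
  monic (a ∷ as) s = a + s * monic as s

  -- Horner's scheme: the coefficients of the quotient are the intermediate values of the evaluation
  -- of `as` at `r`.
  divide : ∀ {n} (as : Vec Carrier (suc n)) r →
           Σ[ bs ∈ Vec Carrier n ] ∀ s → monic as s ≈ monic as r + (s - r) * monic bs s
  divide (a ∷ [])         r = [] , λ s →
    solve 3 (λ a r s → a :+ s :* :1 := a :+ r :* :1 :+ (s :- r) :* :1) refl a r s
  divide (a ∷ as@(_ ∷ _)) r =
    let bs , as≈ = divide as r in
    (monic as r ∷ bs) , λ s → begin
      a + s * monic as s
        ≈⟨ +-congˡ (*-congˡ (as≈ s)) ⟩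
      a + s * (monic as r + (s - r) * monic bs s)
        ≈⟨ solve 5 (λ a r s A B → a :+ s :* (A :+ (s :- r) :* B) :=
                                  a :+ r :* A :+ (s :- r) :* (A :+ s :* B)) refl a r s _ _ ⟩
      a + r * monic as r + (s - r) * (monic as r + s * monic bs s)
        ∎

  Root : ∀ {n} → Vec Carrier n → Carrier → Set _
  Root as r = monic as r ≈ 0#

  divide-roots : ∀ {n r rs} (as : Vec Carrier (suc n)) → All (r ≉_) rs → Root as r → All (Root as) rs →
                 Σ[ bs ∈ Vec Carrier n ] (∀ s → monic as s ≈ (s - r) * monic bs s) × All (Root bs) rs
  divide-roots {r = r} as r≉rs root roots =
    let bs , as≈ = divide as r
        as≈′ = λ s → trans (as≈ s) (trans (+-congʳ root) (+-identityˡ _)) in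
    bs , as≈′ , All.zipWith (λ { {r′} (r≉r′ , root′) →
      *-zero-cancelˡ (λ r′-r≈0 → r≉r′ (sym (x-y≈0⇒x≈y r′-r≈0))) (trans (sym (as≈′ r′)) root′) }) (r≉rs , roots)

  -- With as many distinct roots as the degree, repeated division ends at the monic polynomial of
  -- degree 0, the constant 1, so no cofactor is left.
  factor : ∀ {rs} (as : Vec Carrier (length rs)) → AllPairs _≉_ rs → All (Root as) rs →
           ∀ s → monic as s ≈ List.foldr _*_ 1# (List.map (λ r → s - r) rs)
  factor {[]}    []  _               _             s = refl
  factor {r ∷ _} as (r≉rs ∷ unique) (root ∷ roots) s =
    let bs , as≈ , roots′ = divide-roots as r≉rs root roots in
    trans (as≈ s) (*-congˡ (factor bs unique roots′ s))

  roots-≤-degree : ∀ {n rs} (as : Vec Carrier n) → AllPairs _≉_ rs → All (Root as) rs → length rs ℕ.≤ n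
  roots-≤-degree as [] _ = z≤n
  roots-≤-degree {zero}  []  (_ ∷ _)         (root ∷ _)     = contradiction root 1≉0
  roots-≤-degree {suc n} as (r≉rs ∷ unique) (root ∷ roots) =
    let bs , _ , roots′ = divide-roots as r≉rs root roots in
    s≤s (roots-≤-degree bs unique roots′)

  monic-X^ : ∀ n s → monic (Vec.replicate n 0#) s ≈ s ^ n
  monic-X^ zero    s = refl
  monic-X^ (suc n) s = trans (+-identityˡ _) (*-congˡ (monic-X^ n s))

  X^[2+_]-X : ∀ n → Vec Carrier (suc (suc n))
  X^[2+ n ]-X = 0# ∷ - 1# ∷ Vec.replicate n 0#

  monic-X^-X : ∀ n s → monic X^[2+ n ]-X s ≈ s ^ suc (suc n) - s
  monic-X^-X n s = trans (+-congˡ (*-congˡ (+-congˡ (*-congˡ (monic-X^ n s)))))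
    (solve 2 (λ s t → :0 :+ s :* (:- :1 :+ s :* t) := s :* (s :* t) :- s) refl s (s ^ n))

  module Frobenius {p} (p-prime : Prime p) (p·1≈0 : p · 1# ≈ 0#) where

    p·≈0 : ∀ a → p · a ≈ 0#
    p·≈0 a = begin
      p · a          ≈⟨ ×-congʳ p (*-identityˡ a) ⟨
      p · (1# * a)   ≈⟨ ×-assoc-* p 1# a ⟨
      (p · 1#) * a   ≈⟨ *-congʳ p·1≈0 ⟩
      0# * a         ≈⟨ zeroˡ a ⟩
      0#             ∎

    ∣⇒·≈0 : ∀ {n} → p ℕ.∣ n → ∀ a → n · a ≈ 0#
    ∣⇒·≈0 (ℕ.divides d ≡.refl) a =
      trans (sym (×-assocˡ a d p)) (trans (×-congʳ d (p·≈0 a)) (n·0≈0 d))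
      where
      n·0≈0 : ∀ n → n · 0# ≈ 0#
      n·0≈0 zero    = refl
      n·0≈0 (suc n) = trans (+-identityˡ _) (n·0≈0 n)

    -- By `prime∣C` only the two outer terms of the binomial expansion survive.
    ^p-+ : ∀ a b → (a + b) ^ p ≈ a ^ p + b ^ p
    ^p-+ a b = expand p ≡.refl
      where
      open MonoidSum +-commutativeMonoid using (sum-init-last; sum-cong-≋; sum-replicate-zero)
      open Binomial commutativeSemiring using (binomialTerm; binomialExpansion; theorem)
      expand : ∀ p′ → p ≡ p′ → (a + b) ^ p′ ≈ a ^ p′ + b ^ p′
      expand zero      ≡.refl = contradiction ≡.refl (ℕ.≢-nonZero⁻¹ 0 {{prime⇒nonZero p-prime}})
      expand p′@(suc p-1) ≡.refl = begin
        (a + b) ^ p′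
          ≈⟨ theorem p′ a b ⟩
        t Fin.zero + sum (t ∘ Fin.suc)
          ≈⟨ +-congˡ (sum-init-last (t ∘ Fin.suc)) ⟩
        t Fin.zero + (sum (t ∘ Fin.suc ∘ Fin.inject₁) + t (Fin.fromℕ p′))
          ≈⟨ +-cong first (+-cong (trans (sum-cong-≋ middle) (sum-replicate-zero p-1)) last) ⟩
        b ^ p′ + (0# + a ^ p′)
          ≈⟨ trans (+-congˡ (+-identityˡ _)) (+-comm _ _) ⟩
        a ^ p′ + b ^ p′
          ∎
        where
        t = binomialTerm a b p′
        first : t Fin.zero ≈ b ^ p′
        first = trans (+-identityʳ _) (*-identityˡ _)
        middle : ∀ i → t (Fin.suc (Fin.inject₁ i)) ≈ 0#
        middle i = ∣⇒·≈0 (prime∣C p-prime _ (s≤s (≡.subst (ℕ._< p-1) (≡.sym (Fin.toℕ-inject₁ i)) (Fin.toℕ<n i)))) _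
        last : t (Fin.fromℕ p′) ≈ a ^ p′
        last rewrite Fin.toℕ-fromℕ p-1 | ℕ.nCn≡1 p′ | ℕ.n∸n≡0 p-1 = trans (+-identityʳ _) (*-identityʳ _)

    ^p^-+ : ∀ k a b → (a + b) ^ (p ^ℕ k) ≈ a ^ (p ^ℕ k) + b ^ (p ^ℕ k)
    ^p^-+ zero    a b = solve 2 (λ a b → (a :+ b) :* :1 := a :* :1 :+ b :* :1) refl a b
    ^p^-+ (suc k) a b = begin
      (a + b) ^ (p ℕ.* p ^ℕ k)                    ≈⟨ ^-assocʳ _ p _ ⟨
      ((a + b) ^ p) ^ (p ^ℕ k)                    ≈⟨ ^-congˡ (p ^ℕ k) (^p-+ a b) ⟩
      (a ^ p + b ^ p) ^ (p ^ℕ k)                  ≈⟨ ^p^-+ k _ _ ⟩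
      (a ^ p) ^ (p ^ℕ k) + (b ^ p) ^ (p ^ℕ k)     ≈⟨ +-cong (^-assocʳ a p _) (^-assocʳ b p _) ⟩
      a ^ (p ℕ.* p ^ℕ k) + b ^ (p ℕ.* p ^ℕ k)     ∎

-- Finite fields: characteristic and Fermat's identity.

module FiniteFieldProperties (F : FiniteField c ℓ) where

  open FiniteField F public
    using (p; ν; q; p-prime; ν-nonZero; enumeration; elements)
  open FieldProperties (FiniteField.field′ F) public

  private
    module E = Inverse enumeration
    instance
      p-nonZero : ℕ.NonZero p
      p-nonZero = prime⇒nonZero p-prime

  instance
    q-nonZero : ℕ.NonZero q
    q-nonZero = ℕ.m^n≢0 p ν

  1<p : 1 ℕ.< p
  1<p = ℕ.nonTrivial⇒n>1 p {{prime⇒nonTrivial p-prime}}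

  1<q : 1 ℕ.< q
  1<q = ℕ.≤-trans 1<p (≡.subst (ℕ._≤ q) (ℕ.^-identityʳ p) (ℕ.^-monoʳ-≤ p (ℕ.>-nonZero⁻¹ ν {{ν-nonZero}})))

  to-injective : ∀ {a b} → E.to a ≡ E.to b → a ≈ b
  to-injective {a} {b} eq = trans (sym (E.strictlyInverseʳ a)) (trans (E.from-cong eq) (E.strictlyInverseʳ b))

  infix 4 _≟_
  _≟_ : ∀ a b → Dec (a ≈ b)
  a ≟ b = Dec.map′ to-injective E.to-cong (E.to a Fin.≟ E.to b)

  elements-distinct : AllPairs _≉_ elements
  elements-distinct = AllPairs.map⁺ (AllPairs.map distinct (Unique.allFin⁺ q))
    where
    distinct : ∀ {i j} → i ≢ j → E.from i ≉ E.from j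
    distinct {i} {j} i≢j fi≈fj = i≢j (≡.trans (≡.sym (E.strictlyInverseˡ i)) (≡.trans (E.to-cong fi≈fj) (E.strictlyInverseˡ j)))

  length-elements : length elements ≡ q
  length-elements = ≡.trans (List.length-map E.from (List.allFin q)) (List.length-tabulate id)

  module _ (M : CommutativeMonoid c ℓ) where
    private module M = CommutativeMonoid M
    open MonoidSum M using (sum-permute; sum-cong-≋) renaming (sum to Msum)

    -- Stated for an arbitrary commutative monoid because it serves additively for `q·1≈0` and
    -- multiplicatively for `fermat`. A bijection up to `_≈_` becomes a permutation of indices
    -- through the enumeration.
    sum-bijection : ∀ (f g : Carrier → Carrier) → (∀ {a b} → a ≈ b → f a ≈ f b) → (∀ {a b} → a ≈ b → g a ≈ g b) →
                    (∀ a → f (g a) ≈ a) → (∀ a → g (f a) ≈ a) →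
                    (h : Carrier → M.Carrier) → (∀ {a b} → a ≈ b → h a M.≈ h b) →
                    Msum (h ∘ E.from) M.≈ Msum (h ∘ f ∘ E.from)
    sum-bijection f g f-cong g-cong fg gf h h-cong =
      M.trans (sum-permute (h ∘ E.from) π) (sum-cong-≋ {q} (λ i → h-cong (E.strictlyInverseʳ (f (E.from i)))))
      where
      conjugate : (f g : Carrier → Carrier) → (∀ {a b} → a ≈ b → f a ≈ f b) → (∀ a → f (g a) ≈ a) →
                  ∀ i → E.to (f (E.from (E.to (g (E.from i))))) ≡ i
      conjugate f g f-cong fg i = ≡.trans (E.to-cong (trans (f-cong (E.strictlyInverseʳ _)) (fg _))) (E.strictlyInverseˡ i)
      π : Permutation′ q
      π = permutation (E.to ∘ f ∘ E.from) (E.to ∘ g ∘ E.from) (conjugate f g f-cong fg) (conjugate g f g-cong gf)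

    sum-concentrated : ∀ {n} (i : Fin n) t → (∀ j → j ≢ i → t j M.≈ M.ε) → Msum t M.≈ t i
    sum-concentrated {suc n} i t t≈ε =
      M.trans (MonoidSum.sum-remove M {i = i} t)
      (M.trans (M.∙-congˡ (M.trans (sum-cong-≋ (λ j → t≈ε (Fin.punchIn i j) (Fin.punchInᵢ≢i i j)))
                                   (MonoidSum.sum-replicate-zero M n)))
               (M.identityʳ _))

  -- c ↦ c + 1 permutes F, so that Σ c = Σ c + q · 1.
  q·1≈0 : q · 1# ≈ 0#
  q·1≈0 = begin
    q · 1#             ≈⟨ solve 2 (λ a s → a := (a :+ s) :- s) refl (q · 1#) S ⟩
    (q · 1# + S) - S   ≈⟨ +-congʳ (trans (+-congʳ (sym (sum-replicate q))) (sym (∑-distrib-+ (λ _ → 1#) E.from))) ⟩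
    sum (λ i → 1# + E.from i) - S
                       ≈⟨ +-congʳ (sum-bijection +-commutativeMonoid (1# +_) (- 1# +_) +-congˡ +-congˡ
                            (solve 1 (λ a → :1 :+ (:- :1 :+ a) := a) refl) (solve 1 (λ a → :- :1 :+ (:1 :+ a) := a) refl) id id) ⟨
    S - S              ≈⟨ -‿inverseʳ S ⟩
    0#                 ∎
    where
    open MonoidSum +-commutativeMonoid using (sum-replicate; ∑-distrib-+)
    S = sum E.from

  -- The element q · 1 is the ν-th power of p · 1, and a field has no nilpotents other than 0.
  p·1≈0 : p · 1# ≈ 0#
  p·1≈0 = decidable-stable (p · 1# ≟ 0#) λ p·1≉0 → ^-nonZero ν p·1≉0 (trans (sym (p^n·1 ν)) q·1≈0)
    where
    p^n·1 : ∀ n → (p ^ℕ n) · 1# ≈ (p · 1#) ^ n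
    p^n·1 zero    = +-identityʳ 1#
    p^n·1 (suc n) = trans (×1-homo-* p (p ^ℕ n)) (*-congˡ (p^n·1 n))

  ifZero_then_else_ : Carrier → Carrier → Carrier → Carrier
  ifZero a then b else d with a ≟ 0#
  ... | yes _ = b
  ... | no  _ = d

  ifZero-cong : ∀ {a a′ b b′ d d′} → a ≈ a′ → b ≈ b′ → d ≈ d′ → ifZero a then b else d ≈ ifZero a′ then b′ else d′
  ifZero-cong {a} {a′} a≈a′ b≈b′ d≈d′ with a ≟ 0# | a′ ≟ 0#
  ... | yes _   | yes _    = b≈b′
  ... | no  _   | no  _    = d≈d′
  ... | yes a≈0 | no  a′≉0 = contradiction (trans (sym a≈a′) a≈0) a′≉0
  ... | no  a≉0 | yes a′≈0 = contradiction (trans a≈a′ a′≈0) a≉0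

  product-nonZero : ∀ {n} (t : Fin n → Carrier) → (∀ i → t i ≉ 0#) → product t ≉ 0#
  product-nonZero {zero}  t t≉0 = 1≉0
  product-nonZero {suc n} t t≉0 = *-nonZero (t≉0 Fin.zero) (product-nonZero (t ∘ Fin.suc) (t≉0 ∘ Fin.suc))

  -- c ↦ a c permutes F; comparing the products of all non-zero elements
  -- shows that a, taken once for each non-zero element, has product 1.
  fermat : ∀ a → a ^ q ≈ a
  fermat a with a ≟ 0#
  ... | yes a≈0 = trans (^-congˡ q a≈0) (trans (0^n≈0 q) (sym a≈0))
  ... | no  a≉0 = begin
    a ^ q                                                 ≈⟨ sum-replicate q ⟨
    product {q} (λ _ → a)                                 ≈⟨ sum-cong-≋ (λ i → split (E.from i)) ⟨
    product {q} (λ i → k (E.from i) * k′ (E.from i))      ≈⟨ ∑-distrib-+ (k ∘ E.from) (k′ ∘ E.from) ⟩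
    product {q} (k ∘ E.from) * product {q} (k′ ∘ E.from)  ≈⟨ *-cong Πk≈1 Πk′≈a ⟩
    1# * a                                                ≈⟨ *-identityˡ a ⟩
    a                                                     ∎
    where
    open MonoidSum *-commutativeMonoid using (sum-replicate; ∑-distrib-+; sum-cong-≋)
    -- `h` replaces the factor 0 by 1. The factors `k b` and `k′ b` multiply to a for every b, so
    -- a^q splits into the product of a over the non-zero elements and one further factor a, at b =
    -- 0.
    h k k′ : Carrier → Carrier
    h b  = ifZero b then 1# else b
    k b  = ifZero b then 1# else a
    k′ b = ifZero b then a else 1#

    split : ∀ b → k b * k′ b ≈ a
    split b with b ≟ 0#
    ... | yes _ = *-identityˡ a
    ... | no  _ = *-identityʳ a

    h≉0 : ∀ b → h b ≉ 0#
    h≉0 b with b ≟ 0#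
    ... | yes _   = 1≉0
    ... | no  b≉0 = b≉0

    h-scale : ∀ b → h (a * b) ≈ k b * h b
    h-scale b with a * b ≟ 0# | b ≟ 0#
    ... | yes _    | yes _   = sym (*-identityˡ 1#)
    ... | no  _    | no  _   = refl
    ... | yes ab≈0 | no  b≉0 = contradiction ab≈0 (*-nonZero a≉0 b≉0)
    ... | no  ab≉0 | yes b≈0 = contradiction (trans (*-congˡ b≈0) (zeroʳ a)) ab≉0

    H = product {q} (h ∘ E.from)

    Πk≈1 : product {q} (k ∘ E.from) ≈ 1#
    Πk≈1 = *-cancelˡ (product-nonZero (h ∘ E.from) (h≉0 ∘ E.from)) (begin
      H * product {q} (k ∘ E.from)                  ≈⟨ *-comm _ _ ⟩
      product {q} (k ∘ E.from) * H                  ≈⟨ ∑-distrib-+ (k ∘ E.from) (h ∘ E.from) ⟨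
      product {q} (λ i → k (E.from i) * h (E.from i)) ≈⟨ sum-cong-≋ (λ i → h-scale (E.from i)) ⟨
      product {q} (λ i → h (a * E.from i))          ≈⟨ sum-bijection *-commutativeMonoid (a *_) (a ⁻¹ *_) *-congˡ *-congˡ
                                                       (λ b → *-⁻¹-cancelˡ b a≉0) (λ b → ⁻¹-*-cancelˡ b a≉0) h (λ b≈d → ifZero-cong b≈d refl b≈d) ⟨
      H                                             ≈⟨ *-identityʳ H ⟨
      H * 1#                                        ∎)

    k′-zero : ∀ {b} → b ≈ 0# → k′ b ≈ a
    k′-zero {b} b≈0 with b ≟ 0#
    ... | yes _   = refl
    ... | no  b≉0 = contradiction b≈0 b≉0

    k′-nonZero : ∀ {b} → b ≉ 0# → k′ b ≈ 1#
    k′-nonZero {b} b≉0 with b ≟ 0#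
    ... | yes b≈0 = contradiction b≈0 b≉0
    ... | no  _   = refl

    Πk′≈a : product {q} (k′ ∘ E.from) ≈ a
    Πk′≈a = trans
      (sum-concentrated *-commutativeMonoid (E.to 0#) (k′ ∘ E.from)
        (λ j j≢ → k′-nonZero (λ fj≈0 → j≢ (≡.trans (≡.sym (E.strictlyInverseˡ j)) (E.to-cong fj≈0)))))
      (k′-zero (E.strictlyInverseʳ 0#))

  fermat^ : ∀ j a → a ^ (q ^ℕ j) ≈ a
  fermat^ zero    a = *-identityʳ a
  fermat^ (suc j) a = trans (sym (^-assocʳ a q (q ^ℕ j))) (trans (^-congˡ (q ^ℕ j) (fermat a)) (fermat^ j a))

-- Ultrametric estimates.

module ValuedFieldProperties (L : Field c ℓ) (A : AbsoluteValue L) where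

  open FieldProperties L public
  open AbsoluteValue A public
  open Magnitudes public

  infix 4 _≟0
  -- The absolute value is data with two visible constructors, and definiteness carries the
  -- distinction back to the field.
  _≟0 : ∀ a → Dec (a ≈ 0#)
  a ≟0 with ∣ a ∣ in ∣a∣≡
  ... | 0ᵐ     = yes (∣∣-definite ∣a∣≡)
  ... | 𝐪^ r = no λ a≈0 → 𝐪^≢0 (≡.trans (≡.sym ∣a∣≡) (≡.trans (∣∣-cong a≈0) ∣0∣))
    where
    𝐪^≢0 : 𝐪^ r ≢ 0ᵐ
    𝐪^≢0 ()

  ∣∣-nonZero : ∀ {a} → a ≉ 0# → ∃[ r ] ∣ a ∣ ≡ 𝐪^ r
  ∣∣-nonZero {a} a≉0 with ∣ a ∣ in ∣a∣≡
  ... | 0ᵐ     = contradiction (∣∣-definite ∣a∣≡) a≉0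
  ... | 𝐪^ r = r , ≡.refl

  -- From 1 · 1 = 1 the exponent r of ∣ 1 ∣ satisfies r + r = r.
  ∣1∣ : ∣ 1# ∣ ≡ 1ᵐ
  ∣1∣ with ∣∣-nonZero 1≉0
  ... | r , ∣1∣≡ = ≡.trans ∣1∣≡ (≡.cong 𝐪^_ r≡0)
    where
    𝐪^-injective : ∀ {r s} → 𝐪^ r ≡ 𝐪^ s → r ≡ s
    𝐪^-injective ≡.refl = ≡.refl
    r+r≡r : r ℚ.+ r ≡ r
    r+r≡r = 𝐪^-injective (≡.trans (≡.cong₂ _*ᵐ_ (≡.sym ∣1∣≡) (≡.sym ∣1∣≡))
              (≡.trans (≡.sym (∣∣-* 1# 1#)) (≡.trans (∣∣-cong (*-identityˡ 1#)) ∣1∣≡)))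
    r≡0 : r ≡ ℚ.0ℚ
    r≡0 = ≡.trans (≡.sym (ℚ.+-identityˡ r)) (≡.trans (≡.cong (ℚ._+ r) (≡.sym (ℚ.+-inverseˡ r)))
            (≡.trans (ℚ.+-assoc (ℚ.- r) r r) (≡.trans (≡.cong (ℚ.- r ℚ.+_) r+r≡r) (ℚ.+-inverseˡ r))))

  ∣∣-^ : ∀ a n → ∣ a ^ n ∣ ≡ ∣ a ∣ ^ᵐ n
  ∣∣-^ a zero    = ∣1∣
  ∣∣-^ a (suc n) = ≡.trans (∣∣-* a (a ^ n)) (≡.cong (∣ a ∣ *ᵐ_) (∣∣-^ a n))

  infix 4 _≼_
  -- Sizes are compared between elements, so that a bound is itself an element, mostly a power of x,
  -- and can be multiplied and cancelled by field laws.
  _≼_ : Carrier → Carrier → Set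
  a ≼ b = ∣ a ∣ ≤ᵐ ∣ b ∣

  ≼-refl : ∀ {a} → a ≼ a
  ≼-refl = ≤ᵐ-refl

  ≼-reflexive : ∀ {a b} → a ≈ b → a ≼ b
  ≼-reflexive a≈b = ≤ᵐ-reflexive (∣∣-cong a≈b)

  ≼-trans : ∀ {a b d} → a ≼ b → b ≼ d → a ≼ d
  ≼-trans = ≤ᵐ-trans

  ≼-respˡ : ∀ {a b d} → a ≈ b → a ≼ d → b ≼ d
  ≼-respˡ a≈b = ≼-trans (≼-reflexive (sym a≈b))

  ≼-respʳ : ∀ {a b d} → a ≈ b → d ≼ a → d ≼ b
  ≼-respʳ a≈b d≼a = ≼-trans d≼a (≼-reflexive a≈b)

  ≼-total : ∀ a b → a ≼ b ⊎ b ≼ a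
  ≼-total a b = ≤ᵐ-total ∣ a ∣ ∣ b ∣

  _≼?_ : ∀ a b → Dec (a ≼ b)
  a ≼? b = ∣ a ∣ ≤ᵐ? ∣ b ∣

  0≼ : ∀ b → 0# ≼ b
  0≼ b = ≤ᵐ-trans (≤ᵐ-reflexive ∣0∣) (0≤ _)

  ≼0⇒≈0 : ∀ {a} → a ≼ 0# → a ≈ 0#
  ≼0⇒≈0 {a} a≼0 = ∣∣-definite (≤0 (≤ᵐ-trans a≼0 (≤ᵐ-reflexive ∣0∣)))
    where
    ≤0 : ∀ {m} → m ≤ᵐ 0ᵐ → m ≡ 0ᵐ
    ≤0 (0≤ _) = ≡.refl

  +-≼ : ∀ {a b d} → a ≼ d → b ≼ d → a + b ≼ d
  +-≼ = ultrametric _ _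

  *-mono-≼ : ∀ {a b a′ b′} → a ≼ b → a′ ≼ b′ → a * a′ ≼ b * b′
  *-mono-≼ a≼b a′≼b′ = ≤ᵐ-trans (≤ᵐ-reflexive (∣∣-* _ _))
    (≤ᵐ-trans (*ᵐ-mono-≤ᵐ a≼b a′≼b′) (≤ᵐ-reflexive (≡.sym (∣∣-* _ _))))

  *-monoʳ-≼ : ∀ a {b d} → b ≼ d → a * b ≼ a * d
  *-monoʳ-≼ a b≼d = *-mono-≼ (≼-refl {a}) b≼d

  *-≼1 : ∀ {a b d} → a ≼ 1# → b ≼ d → a * b ≼ d
  *-≼1 a≼1 b≼d = ≼-respʳ (*-identityˡ _) (*-mono-≼ a≼1 b≼d)

  *-cancelˡ-≼ : ∀ {a b d} → a ≉ 0# → a * b ≼ a * d → b ≼ d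
  *-cancelˡ-≼ {a} {b} {d} a≉0 ab≼ad with ∣∣-nonZero a≉0
  ... | r , ∣a∣≡ = *ᵐ-cancelˡ-≤ᵐ (≡.subst (λ m → m *ᵐ ∣ b ∣ ≤ᵐ m *ᵐ ∣ d ∣) ∣a∣≡
    (≤ᵐ-trans (≤ᵐ-reflexive (≡.sym (∣∣-* a b))) (≤ᵐ-trans ab≼ad (≤ᵐ-reflexive (∣∣-* a d)))))

  ^-mono-≼ : ∀ {a b} n → a ≼ b → a ^ n ≼ b ^ n
  ^-mono-≼ zero    a≼b = ≼-refl
  ^-mono-≼ (suc n) a≼b = *-mono-≼ a≼b (^-mono-≼ n a≼b)

  ^-≼1 : ∀ {a} n → a ≼ 1# → a ^ n ≼ 1#
  ^-≼1 n a≼1 = ≼-respʳ (1^n≈1 n) (^-mono-≼ n a≼1)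

  ^-antimono-≼ : ∀ {a m n} → a ≼ 1# → m ℕ.≤ n → a ^ n ≼ a ^ m
  ^-antimono-≼ {n = n} a≼1 z≤n       = ^-≼1 n a≼1
  ^-antimono-≼ {a}     a≼1 (s≤s m≤n) = *-monoʳ-≼ a (^-antimono-≼ a≼1 m≤n)

  -1≼1 : - 1# ≼ 1#
  -1≼1 with ≼-total (- 1#) 1#
  ... | inj₁ p = p
  -- Multiplication by -1 turns the unwanted alternative 1 ≼ -1 into -1 ≼ 1.
  ... | inj₂ p = ≼-respˡ (*-identityʳ _)
    (≼-respʳ (solve 0 (:- :1 :* :- :1 := :1) refl) (*-monoʳ-≼ (- 1#) p))

  -‿≼ : ∀ {a b} → a ≼ b → - a ≼ b
  -‿≼ a≼b = ≼-respˡ (-1*x≈-x _) (*-≼1 -1≼1 a≼b)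

  ∸-≼ : ∀ {a b d} → a ≼ d → b ≼ d → a - b ≼ d
  ∸-≼ a≼d b≼d = +-≼ a≼d (-‿≼ b≼d)

  ∑-≼ : ∀ n {a : ℕ → Carrier} {d} → (∀ k → a k ≼ d) → ∑[ n ] a ≼ d
  ∑-≼ zero    {d = d} a≼d = 0≼ d
  ∑-≼ (suc n) a≼d = +-≼ (a≼d 0) (∑-≼ n (a≼d ∘ suc))

  <1⇒1⋠ : ∀ {a} → ∣ a ∣ <ᵐ 1ᵐ → ¬ 1# ≼ a
  <1⇒1⋠ ∣a∣<1 1≼a = <ᵐ⇒≱ᵐ ∣a∣<1 (≤ᵐ-trans (≤ᵐ-reflexive (≡.sym ∣1∣)) 1≼a)

  <1⇒≼1 : ∀ {a} → ∣ a ∣ <ᵐ 1ᵐ → a ≼ 1#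
  <1⇒≼1 ∣a∣<1 = ≤ᵐ-trans (<ᵐ⇒≤ᵐ ∣a∣<1) (≤ᵐ-reflexive (≡.sym ∣1∣))

  +-<1 : ∀ {a b} → ∣ a ∣ <ᵐ 1ᵐ → ∣ b ∣ <ᵐ 1ᵐ → ∣ a + b ∣ <ᵐ 1ᵐ
  +-<1 {a} {b} ∣a∣<1 ∣b∣<1 with ≼-total a b
  ... | inj₁ a≼b = ≤ᵐ-<ᵐ-trans (+-≼ a≼b ≼-refl) ∣b∣<1
  ... | inj₂ b≼a = ≤ᵐ-<ᵐ-trans (+-≼ ≼-refl b≼a) ∣a∣<1

  -‿<1 : ∀ {a} → ∣ a ∣ <ᵐ 1ᵐ → ∣ - a ∣ <ᵐ 1ᵐ
  -‿<1 = ≤ᵐ-<ᵐ-trans (-‿≼ ≼-refl)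

  ^-<1 : ∀ {a} n .{{_ : ℕ.NonZero n}} → ∣ a ∣ <ᵐ 1ᵐ → ∣ a ^ n ∣ <ᵐ 1ᵐ
  ^-<1 {a} (suc n) ∣a∣<1 = ≤ᵐ-<ᵐ-trans (≼-respˡ (*-comm _ a) (*-≼1 (^-≼1 n (<1⇒≼1 ∣a∣<1)) ≼-refl)) ∣a∣<1

-- Limits and infinite sums, measured by powers of x.

module Convergence (L : Field c ℓ) (A : AbsoluteValue L) (x : Field.Carrier L)
                   (∣x∣ : AbsoluteValue.∣_∣ A x ≡ 𝐪^ (-1ℤ / 1)) where

  open ValuedFieldProperties L A public

  x<1 : ∣ x ∣ <ᵐ 1ᵐ
  x<1 = ≡.subst (_<ᵐ 1ᵐ) (≡.sym ∣x∣) (𝐪^< (ℚ.negative⁻¹ (-1ℤ / 1)))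

  x≼1 : x ≼ 1#
  x≼1 = <1⇒≼1 x<1

  x≉0 : x ≉ 0#
  x≉0 x≈0 with ≡.trans (≡.sym ∣x∣) (≡.trans (∣∣-cong x≈0) ∣0∣)
  ... | ()

  x^n≉0 : ∀ n → x ^ n ≉ 0#
  x^n≉0 n = ^-nonZero n x≉0

  x^-≤ : ∀ r → ∃[ k ] ∣ x ^ k ∣ ≤ᵐ 𝐪^ r
  x^-≤ r with powers-vanish r
  ... | k , p = k , ≤ᵐ-trans (≤ᵐ-reflexive (≡.trans (∣∣-^ x k) (≡.cong (_^ᵐ k) ∣x∣))) p

  x^-≼ : ∀ {a} → a ≉ 0# → ∃[ k ] x ^ k ≼ a
  x^-≼ a≉0 with ∣∣-nonZero a≉0
  ... | r , ∣a∣≡ with x^-≤ r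
  ...   | k , p = k , ≤ᵐ-trans p (≤ᵐ-reflexive (≡.sym ∣a∣≡))

  ^-cancel-≼ : ∀ {m n} → x ^ m ≼ x ^ n → n ℕ.≤ m
  ^-cancel-≼ {m}     {zero}  _ = z≤n
  ^-cancel-≼ {zero}  {suc n} p = contradiction (≼-trans p (^-antimono-≼ {n = suc n} x≼1 (s≤s z≤n)))
    (<1⇒1⋠ (^-<1 1 x<1))
  ^-cancel-≼ {suc m} {suc n} p = s≤s (^-cancel-≼ (*-cancelˡ-≼ x≉0 p))

  ≼x^⇒≈0 : ∀ {a} → (∀ k → a ≼ x ^ k) → a ≈ 0#
  ≼x^⇒≈0 {a} a≼ = decidable-stable (a ≟0) λ a≉0 →
    let k , x^k≼a = x^-≼ a≉0 in ℕ.<-irrefl ≡.refl (^-cancel-≼ {k} {suc k} (≼-trans x^k≼a (a≼ (suc k))))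

  -- If |z|^b ≤ |x|, then b k factors z are worth k factors x; `powers-small` supplies b.
  small-powers : ∀ {z} → ∣ z ∣ <ᵐ 1ᵐ → ∀ k → ∃[ N ] ∀ n → N ℕ.≤ n → z ^ n ≼ x ^ k
  small-powers {z} z<1 k with powers-small z<1
  ... | b , p = b ℕ.* k , λ n N≤n →
    ≼-trans (^-antimono-≼ (<1⇒≼1 z<1) N≤n) (≼-respˡ (^-assocʳ z b k)
      (^-mono-≼ k (≤ᵐ-trans (≤ᵐ-reflexive (∣∣-^ z b)) (≤ᵐ-trans p (≤ᵐ-reflexive (≡.sym ∣x∣))))))

  -- Powers of x replace the rational exponents of `_⟶_` as the scale of smallness. The two scales
  -- are interchangeable because |xᵏ| tends to 0 without ever being 0.
  Null : (ℕ → Carrier) → Set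
  Null a = ∀ k → ∃[ N ] ∀ n → N ℕ.≤ n → a n ≼ x ^ k

  null-intro : ∀ {s l} → Null (λ n → s n - l) → s ⟶ l
  null-intro null r with x^-≤ r
  ... | k , x^k≤ with null k
  ...   | N , s≼ = N , λ n N≤n → ≤ᵐ-trans (s≼ n N≤n) x^k≤

  null-elim : ∀ {s l} → s ⟶ l → Null (λ n → s n - l)
  null-elim s⟶l k with ∣∣-nonZero (x^n≉0 k)
  ... | r , ∣x^k∣≡ with s⟶l r
  ...   | N , s≤ = N , λ n N≤n → ≤ᵐ-trans (s≤ n N≤n) (≤ᵐ-reflexive (≡.sym ∣x^k∣≡))

  null-cong : ∀ {a b : ℕ → Carrier} → (∀ n → a n ≈ b n) → Null a → Null b
  null-cong a≈b null k with null k
  ... | N , a≼ = N , λ n N≤n → ≼-respˡ (a≈b n) (a≼ n N≤n)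

  null-≼ : ∀ {a b : ℕ → Carrier} → (∀ n → a n ≼ b n) → Null b → Null a
  null-≼ a≼b null k with null k
  ... | N , b≼ = N , λ n N≤n → ≼-trans (a≼b n) (b≼ n N≤n)

  null-+ : ∀ {a b : ℕ → Carrier} → Null a → Null b → Null (λ n → a n + b n)
  null-+ null null′ k with null k | null′ k
  ... | N , a≼ | N′ , b≼ = N ℕ.⊔ N′ , λ n N≤n →
    +-≼ (a≼ n (ℕ.≤-trans (ℕ.m≤m⊔n N N′) N≤n)) (b≼ n (ℕ.≤-trans (ℕ.m≤n⊔m N N′) N≤n))

  null-* : ∀ s {a : ℕ → Carrier} → Null a → Null (λ n → s * a n)
  null-* s null k with s ≟0
  ... | yes s≈0 = 0 , λ n _ → ≼-respˡ (sym (trans (*-congʳ s≈0) (zeroˡ _))) (0≼ _)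
  ... | no  s≉0 with x^-≼ (⁻¹-nonZero s≉0)
  ...   | j , x^j≼s⁻¹ with null (j ℕ.+ k)
  ...     | N , a≼ = N , λ n N≤n → ≼-trans (*-monoʳ-≼ s (≼-trans (a≼ n N≤n)
                (≼-respˡ (sym (^-homo-* x j k)) (*-mono-≼ x^j≼s⁻¹ ≼-refl))))
                (≼-reflexive (*-⁻¹-cancelˡ _ s≉0))

  null-suc : ∀ {a : ℕ → Carrier} → Null a → Null (a ∘ suc)
  null-suc null k with null k
  ... | N , a≼ = N , λ n N≤n → a≼ (suc n) (ℕ.m≤n⇒m≤1+n N≤n)

  null-powers : ∀ {z} → ∣ z ∣ <ᵐ 1ᵐ → Null (z ^_)
  null-powers = small-powers

  null-const : ∀ {a} → Null (λ _ → a) → a ≈ 0#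
  null-const null = ≼x^⇒≈0 λ k → let N , a≼ = null k in a≼ N ℕ.≤-refl

  ⟶-unique : ∀ {s l l′} → s ⟶ l → s ⟶ l′ → l ≈ l′
  ⟶-unique {s} {l} {l′} s⟶l s⟶l′ = x-y≈0⇒x≈y (null-const (null-cong
    (λ n → solve 3 (λ s l l′ → (s :- l′) :+ :- :1 :* (s :- l) := l :- l′) refl (s n) l l′)
    (null-+ (null-elim s⟶l′) (null-* (- 1#) (null-elim s⟶l)))))

  ⟶-null : ∀ {s s′ l} → s ⟶ l → Null (λ n → s′ n - s n) → s′ ⟶ l
  ⟶-null s⟶l null = null-intro (null-cong
    (λ n → solve 3 (λ a b l → (a :- b) :+ (b :- l) := a :- l) refl _ _ _) (null-+ null (null-elim s⟶l)))

  ⟶-cong : ∀ {s s′ l l′} → (∀ n → s n ≈ s′ n) → l ≈ l′ → s ⟶ l → s′ ⟶ l′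
  ⟶-cong s≈s′ l≈l′ s⟶l = null-intro (null-cong (λ n → +-cong (s≈s′ n) (-‿cong l≈l′)) (null-elim s⟶l))

  ⟶-const : ∀ l → (λ _ → l) ⟶ l
  ⟶-const l = null-intro (λ k → 0 , λ n _ → ≼-respˡ (sym (-‿inverseʳ l)) (0≼ _))

  ⟶-+ : ∀ {s s′ l l′} → s ⟶ l → s′ ⟶ l′ → (λ n → s n + s′ n) ⟶ l + l′
  ⟶-+ s⟶l s′⟶l′ = null-intro (null-cong
    (λ n → solve 4 (λ a b l m → (a :- l) :+ (b :- m) := (a :+ b) :- (l :+ m)) refl _ _ _ _)
    (null-+ (null-elim s⟶l) (null-elim s′⟶l′)))

  ⟶-* : ∀ a {s l} → s ⟶ l → (λ n → a * s n) ⟶ a * l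
  ⟶-* a s⟶l = null-intro (null-cong
    (λ n → solve 3 (λ a s l → a :* (s :- l) := a :* s :- a :* l) refl _ _ _) (null-* a (null-elim s⟶l)))

  ⟶-≼ : ∀ {s l d} → d ≉ 0# → (∀ n → s n ≼ d) → s ⟶ l → l ≼ d
  ⟶-≼ {s} {l} {d} d≉0 s≼d s⟶l =
    let k , x^k≼d = x^-≼ d≉0
        N , s-l≼  = null-elim s⟶l k in
    ≼-respˡ (solve 2 (λ s l → s :- (s :- l) := l) refl (s N) l)
      (∸-≼ (s≼d N) (≼-trans (s-l≼ N ℕ.≤-refl) x^k≼d))

  HasSum-cong : ∀ (a b : ℕ → Carrier) {l l′} → (∀ n → a n ≈ b n) → l ≈ l′ → HasSum a l → HasSum b l′
  HasSum-cong _ _ a≈b l≈l′ = ⟶-cong (λ n → ∑-cong n a≈b) l≈l′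

  HasSum-+ : ∀ a b {l l′} → HasSum a l → HasSum b l′ → HasSum (λ n → a n + b n) (l + l′)
  HasSum-+ a b p p′ = ⟶-cong (λ n → sym (∑-+ n a b)) refl (⟶-+ p p′)

  HasSum-* : ∀ s a {l} → HasSum a l → HasSum (λ n → s * a n) (s * l)
  HasSum-* s a p = ⟶-cong (λ n → sym (∑-*ˡ n s a)) refl (⟶-* s p)

  HasSum-suc : ∀ a {l} → HasSum a l → HasSum (a ∘ suc) (l - a 0)
  HasSum-suc a {l} p = null-intro (null-cong
    (λ n → solve 3 (λ a s l → (a :+ s) :- l := s :- (l :- a)) refl (a 0) (∑[ n ] (a ∘ suc)) l)
    (null-suc (null-elim p)))

  HasSum-zero : ∀ (a : ℕ → Carrier) → (∀ n → a n ≈ 0#) → HasSum a 0#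
  HasSum-zero _ a≈0 = ⟶-cong (λ n → sym (∑-zero n a≈0)) refl (⟶-const 0#)

  HasSum-cons : ∀ a {l} → HasSum (a ∘ suc) l → HasSum a (a 0 + l)
  HasSum-cons a {l} p = null-intro λ k →
    let N , s≼ = null-elim p k in
    suc N , λ { (suc n) (s≤s N≤n) → ≼-respˡ
      (solve 3 (λ a s l → s :- l := (a :+ s) :- (a :+ l)) refl (a 0) (∑[ n ] (a ∘ suc)) l) (s≼ n N≤n) }

  HasSum-single : ∀ m (a : ℕ → Carrier) → (∀ n → n ≢ m → a n ≈ 0#) → HasSum a (a m)
  HasSum-single zero    a a≈0 = HasSum-cong a a (λ _ → refl) (+-identityʳ _)
    (HasSum-cons a (HasSum-zero (a ∘ suc) (λ n → a≈0 (suc n) (λ ()))))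
  HasSum-single (suc m) a a≈0 = HasSum-cong a a (λ _ → refl) (trans (+-congʳ (a≈0 0 (λ ()))) (+-identityˡ _))
    (HasSum-cons a (HasSum-single m (a ∘ suc) (λ n n≢m → a≈0 (suc n) (n≢m ∘ ℕ.suc-injective))))

  HasSum⇒null : ∀ a {l} → HasSum a l → Null a
  HasSum⇒null a {l} p = null-cong
    (λ n → trans (+-congʳ (+-congʳ (∑-last n a)))
                 (solve 3 (λ a s l → (s :+ a :- l) :+ :- :1 :* (s :- l) := a) refl (a n) (∑[ n ] a) l))
    (null-+ (null-suc (null-elim p)) (null-* (- 1#) (null-elim p)))

  null-bounded : ∀ {a : ℕ → Carrier} → Null a → ∃[ k ] ∀ n → x ^ k * a n ≼ 1#
  null-bounded {a} null with null 0
  ... | N , a≼1 = proj₁ (bound N) , λ n → case n (ℕ.<-≤-connex n N)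
    where
    *x^ : ∀ {a k k′} → k ℕ.≤ k′ → x ^ k * a ≼ 1# → x ^ k′ * a ≼ 1#
    *x^ {a} k≤k′ p = ≼-trans (*-mono-≼ (^-antimono-≼ x≼1 k≤k′) (≼-refl {a})) p
    one : ∀ a → ∃[ k ] x ^ k * a ≼ 1#
    one a with a ≟0
    ... | yes a≈0 = 0 , ≼-respˡ (sym (trans (*-congˡ a≈0) (zeroʳ _))) (0≼ _)
    ... | no  a≉0 with x^-≼ (⁻¹-nonZero a≉0)
    ...   | k , x^k≼ = k , ≼-trans (*-mono-≼ x^k≼ ≼-refl) (≼-reflexive (inverseˡ a≉0))
    bound : ∀ M → ∃[ k ] ∀ n → n ℕ.< M → x ^ k * a n ≼ 1#
    bound zero    = 0 , λ n ()
    bound (suc M) with one (a M) | bound M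
    ... | j , p | k , p′ = j ℕ.⊔ k , λ n n<1+M → case n (ℕ.m≤n⇒m<n∨m≡n (ℕ.≤-pred n<1+M))
      where
      case : ∀ n → n ℕ.< M ⊎ n ≡ M → x ^ (j ℕ.⊔ k) * a n ≼ 1#
      case n (inj₁ n<M)    = *x^ (ℕ.m≤n⊔m j k) (p′ n n<M)
      case n (inj₂ ≡.refl) = *x^ (ℕ.m≤m⊔n j k) p
    case : ∀ n → n ℕ.< N ⊎ N ℕ.≤ n → x ^ proj₁ (bound N) * a n ≼ 1#
    case n (inj₁ n<N) = proj₂ (bound N) n n<N
    case n (inj₂ N≤n) = *x^ {k = 0} {proj₁ (bound N)} z≤n (*-≼1 ≼-refl (a≼1 n N≤n))

  -- By the ultrametric inequality a tail starting at N is no larger than the majorant z^N of its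
  -- first term, so the partial sums are Cauchy.
  geometric-sum : Complete → ∀ {z} → ∣ z ∣ <ᵐ 1ᵐ → (a : ℕ → Carrier) → (∀ k → a k ≼ z ^ k) → ∃[ l ] HasSum a l
  geometric-sum complete {z} z<1 a a≼ = complete (λ n → ∑[ n ] a) cauchy
    where
    S = λ n → ∑[ n ] a
    tail : ∀ N d → S (N ℕ.+ d) - S N ≼ z ^ N
    tail N zero    = ≼-respˡ (sym (x≈y⇒x-y≈0 (reflexive (≡.cong S (ℕ.+-identityʳ N))))) (0≼ _)
    tail N (suc d) = ≼-respˡ
      (trans (solve 3 (λ s a t → (s :- t) :+ a := (s :+ a) :- t) refl _ _ _)
             (+-congʳ (trans (sym (∑-last (N ℕ.+ d) a)) (reflexive (≡.cong S (≡.sym (ℕ.+-suc N d)))))))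
      (+-≼ (tail N d) (≼-trans (a≼ (N ℕ.+ d)) (^-antimono-≼ (<1⇒≼1 z<1) (ℕ.m≤m+n N d))))
    tail′ : ∀ {N m} → N ℕ.≤ m → S m - S N ≼ z ^ N
    tail′ {N} {m} N≤m = ≡.subst (λ m → S m - S N ≼ z ^ N) (ℕ.m+[n∸m]≡n N≤m) (tail N (m ∸ N))
    cauchy : Cauchy S
    cauchy r =
      let k , x^k≤ = x^-≤ r
          N , z^≼  = small-powers z<1 k in
      N , λ m n N≤m N≤n → ≤ᵐ-trans
        (≼-respˡ (solve 3 (λ s t u → (s :- u) :- (t :- u) := s :- t) refl (S m) (S n) (S N)) (∸-≼ (tail′ N≤m) (tail′ N≤n)))
        (≤ᵐ-trans (z^≼ N ℕ.≤-refl) x^k≤)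

-- The embedding of 𝐅_q[[x]] into the completed field.

module SeriesEmbedding (F : FiniteField c ℓ) (C : CompletedClosure F) where

  module 𝔽 = FiniteFieldProperties F

  open Series F public
  open Carlitz F C public using (O; _*ₒ_; _^ₒ_; xₒ; ι; x)
  open CompletedClosure C public
    using (closure; toClosure; isAlgebraicClosure; completion; absoluteValue; toCompletion;
           toCompletion-isRingHomomorphism; extends; complete)

  private
    module L = FieldProperties completion
    module K = FieldProperties closure
    module i = RingMorphisms.IsRingHomomorphism (IsAlgebraicClosure.isRingHomomorphism isAlgebraicClosure)
    module j = RingMorphisms.IsRingHomomorphism toCompletion-isRingHomomorphism

    fromSeries-cong : ∀ {s t : O} → (∀ n → s n 𝔽.≈ t n) → RawRing._≈_ laurent (fromSeries s) (fromSeries t)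
    fromSeries-cong s≈t k with k ℤ.+ ℤ.+ 0
    ... | ℤ.+ n    = s≈t n
    ... | -[1+ n ] = 𝔽.refl

    coefficient-+ : ∀ (s : O) k → coefficient (fromSeries s) (ℤ.+ k ℤ.- ℤ.+ 0) 𝔽.≈ s k
    coefficient-+ s k = 𝔽.reflexive (≡.cong s (≡.trans (ℕ.+-identityʳ (k ℕ.+ 0)) (ℕ.+-identityʳ k)))

  open L using (_≈_; _≉_; _+_; _*_; -_; _-_; 0#; 1#; _^_)

  ι-cong : ∀ {s t : O} → (∀ n → s n 𝔽.≈ t n) → ι s ≈ ι t
  ι-cong s≈t = j.⟦⟧-cong (i.⟦⟧-cong (fromSeries-cong s≈t))

  ι-+ : ∀ s t → ι (λ n → s n 𝔽.+ t n) ≈ ι s + ι t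
  ι-+ s t = L.trans (j.⟦⟧-cong (K.trans (i.⟦⟧-cong (fromSeries-cong
    (λ n → 𝔽.sym (𝔽.+-cong (coefficient-+ s n) (coefficient-+ t n))))) (i.+-homo _ _))) (j.+-homo _ _)

  ι-* : ∀ s t → ι (s *ₒ t) ≈ ι s * ι t
  ι-* s t = L.trans (j.⟦⟧-cong (i.*-homo (fromSeries s) (fromSeries t))) (j.*-homo _ _)

  ι-neg : ∀ t → ι (λ n → 𝔽.- t n) ≈ - ι t
  ι-neg t = L.trans (j.⟦⟧-cong (i.-‿homo (fromSeries t))) (j.-‿homo _)

  ι-0 : ι (λ _ → 𝔽.0#) ≈ 0#
  ι-0 = L.trans (j.⟦⟧-cong i.0#-homo) j.0#-homo

  ι-1 : ι (RawRing.1# powerSeries) ≈ 1#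
  ι-1 = L.trans (j.⟦⟧-cong i.1#-homo) j.1#-homo

  ι-sub : ∀ s t → ι (λ n → s n 𝔽.- t n) ≈ ι s - ι t
  ι-sub s t = L.trans (ι-+ s (λ n → 𝔽.- t n)) (L.+-congˡ (ι-neg t))

  ι-^ : ∀ t n → ι (t ^ₒ n) ≈ ι t ^ n
  ι-^ t zero    = ι-1
  ι-^ t (suc n) = L.trans (ι-* t (t ^ₒ n)) (L.*-congˡ (ι-^ t n))

  const : 𝔽.Carrier → O
  const a = fromPolynomial (a ∷ [])

  shift : O → O
  shift t n = t (suc n)

  xₒ*-zero : ∀ t → (xₒ *ₒ t) 0 𝔽.≈ 𝔽.0#
  xₒ*-zero t = 𝔽.trans (𝔽.+-identityʳ _) (𝔽.zeroˡ _)

  xₒ*-suc : ∀ t n → (xₒ *ₒ t) (suc n) 𝔽.≈ t n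
  xₒ*-suc t n = 𝔽.trans (𝔽.+-cong (𝔽.zeroˡ _) (𝔽.+-cong (𝔽.*-identityˡ _)
    (𝔽.∑-zero n {λ i → xₒ (suc (suc i)) 𝔽.* t (suc n ∸ suc (suc i))} (λ _ → 𝔽.zeroˡ _))))
    (𝔽.trans (𝔽.+-identityˡ _) (𝔽.+-identityʳ _))

  κ : 𝔽.Carrier → L.Carrier
  κ a = ι (const a)

  const-cong : ∀ {a b} → a 𝔽.≈ b → ∀ n → const a n 𝔽.≈ const b n
  const-cong a≈b zero    = a≈b
  const-cong a≈b (suc n) = 𝔽.refl

  κ-cong : ∀ {a b} → a 𝔽.≈ b → κ a ≈ κ b
  κ-cong a≈b = ι-cong (const-cong a≈b)

  κ-0 : κ 𝔽.0# ≈ 0#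
  κ-0 = L.trans (ι-cong λ { zero → 𝔽.refl ; (suc n) → 𝔽.refl }) ι-0

  κ-1 : κ 𝔽.1# ≈ 1#
  κ-1 = L.trans (ι-cong λ { zero → 𝔽.refl ; (suc n) → 𝔽.refl }) ι-1

  κ-+ : ∀ a b → κ (a 𝔽.+ b) ≈ κ a + κ b
  κ-+ a b = L.trans (ι-cong λ { zero → 𝔽.refl ; (suc n) → 𝔽.sym (𝔽.+-identityˡ _) }) (ι-+ (const a) (const b))

  κ-neg : ∀ a → κ (𝔽.- a) ≈ - κ a
  κ-neg a = L.trans (ι-cong λ { zero → 𝔽.refl ; (suc n) → 𝔽.sym 𝔽.-0#≈0# }) (ι-neg (const a))

  κ-* : ∀ a b → κ (a 𝔽.* b) ≈ κ a * κ b
  κ-* a b = L.trans (ι-cong λ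
    { zero    → 𝔽.sym (𝔽.+-identityʳ _)
    ; (suc n) → 𝔽.sym (𝔽.trans (𝔽.+-cong (𝔽.zeroʳ a) (𝔽.∑-zero (suc n) {λ i → 𝔽.0# 𝔽.* const b (n ∸ i)} (λ _ → 𝔽.zeroˡ _))) (𝔽.+-identityʳ _))
    }) (ι-* (const a) (const b))

  κ-^ : ∀ a n → κ (a 𝔽.^ n) ≈ κ a ^ n
  κ-^ a zero    = κ-1
  κ-^ a (suc n) = L.trans (κ-* a (a 𝔽.^ n)) (L.*-congˡ (κ-^ a n))

  κ-· : ∀ n → κ (n 𝔽.· 𝔽.1#) ≈ n L.· 1#
  κ-· zero    = κ-0
  κ-· (suc n) = L.trans (κ-+ 𝔽.1# (n 𝔽.· 𝔽.1#)) (L.+-cong κ-1 (κ-· n))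

  κ-nonZero : ∀ {a} → a 𝔽.≉ 𝔽.0# → κ a ≉ 0#
  κ-nonZero {a} a≉0 κa≈0 = L.1≉0 (L.trans (L.sym κ-1) (L.trans (κ-cong (𝔽.sym (𝔽.inverseʳ a≉0)))
    (L.trans (κ-* a (a 𝔽.⁻¹)) (L.trans (L.*-congʳ κa≈0) (L.zeroˡ _)))))

  κ-injective : ∀ {a b} → κ a ≈ κ b → a 𝔽.≈ b
  κ-injective {a} {b} κa≈κb = decidable-stable (a 𝔽.≟ b) λ a≉b → κ-nonZero {a 𝔽.- b} (a≉b ∘ 𝔽.x-y≈0⇒x≈y)
    (L.trans (κ-+ a (𝔽.- b)) (L.trans (L.+-congˡ (κ-neg b)) (L.x≈y⇒x-y≈0 κa≈κb)))

  -- Stands in for an infinite sum: identities about `ι t` are reached by peeling off coefficients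
  -- from the low end.
  ι-split : ∀ t → ι t ≈ κ (t 0) + x * ι (shift t)
  ι-split t = L.trans (ι-cong λ
    { zero    → 𝔽.sym (𝔽.trans (𝔽.+-congˡ (xₒ*-zero (shift t))) (𝔽.+-identityʳ _))
    ; (suc n) → 𝔽.sym (𝔽.trans (𝔽.+-congˡ (xₒ*-suc (shift t) n)) (𝔽.+-identityˡ _))
    }) (L.trans (ι-+ (const (t 0)) (xₒ *ₒ shift t)) (L.+-congˡ (ι-* xₒ (shift t))))

  ∣x∣ : AbsoluteValue.∣_∣ absoluteValue x ≡ 𝐪^ (-1ℤ / 1)
  ∣x∣ = extends (fromSeries xₒ) (ℤ.+ 1) (below , 𝔽.1≉0)
    where
    below : ∀ j → j ℤ.< ℤ.+ 1 → coefficient (fromSeries xₒ) j 𝔽.≈ 𝔽.0#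
    below (ℤ.+ zero)  _ = 𝔽.refl
    below (ℤ.+ suc n) (ℤ.+<+ (s≤s ()))
    below -[1+ n ]    _ = 𝔽.refl

-- Absolute values and coefficients of power series.

module ValuedEmbedding (F : FiniteField c ℓ) (C : CompletedClosure F) where

  open SeriesEmbedding F C public

  open Convergence completion absoluteValue x ∣x∣ public

  open Frobenius 𝔽.p-prime (trans (sym (κ-· 𝔽.p)) (trans (κ-cong 𝔽.p·1≈0) κ-0)) public

  ∣ι∣≡1 : ∀ t → t 0 𝔽.≉ 𝔽.0# → ∣ ι t ∣ ≡ 1ᵐ
  ∣ι∣≡1 t t0≉0 = extends (fromSeries t) (ℤ.+ 0) (below , t0≉0)
    where
    below : ∀ j → j ℤ.< ℤ.+ 0 → coefficient (fromSeries t) j 𝔽.≈ 𝔽.0#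
    below (ℤ.+ n)  (ℤ.+<+ ())
    below -[1+ n ] _ = 𝔽.refl

  drop : ℕ → O → O
  drop zero    t = t
  drop (suc n) t = drop n (shift t)

  drop-0 : ∀ n t → drop n t 0 ≡ t n
  drop-0 zero    t = ≡.refl
  drop-0 (suc n) t = drop-0 n (shift t)

  ι-shift : ∀ t → t 0 𝔽.≈ 𝔽.0# → ι t ≈ x * ι (shift t)
  ι-shift t t0≈0 = trans (ι-split t) (trans (+-congʳ (trans (κ-cong t0≈0) κ-0)) (+-identityˡ _))

  ι-drop : ∀ n t → (∀ k → k ℕ.< n → t k 𝔽.≈ 𝔽.0#) → ι t ≈ x ^ n * ι (drop n t)
  ι-drop zero    t t≈0 = sym (*-identityˡ _)
  ι-drop (suc n) t t≈0 = begin
    ι t                               ≈⟨ ι-shift t (t≈0 0 (s≤s z≤n)) ⟩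
    x * ι (shift t)                   ≈⟨ *-congˡ (ι-drop n (shift t) (λ k k<n → t≈0 (suc k) (s≤s k<n))) ⟩
    x * (x ^ n * ι (drop (suc n) t))  ≈⟨ *-assoc _ _ _ ⟨
    x ^ suc n * ι (drop (suc n) t)    ∎

  -- A series of absolute value > 1 could have no non-zero coefficient,
  -- since the first such coefficient would determine its order.
  ι-≼1 : ∀ t → ι t ≼ 1#
  ι-≼1 t = decidable-stable (ι t ≼? 1#) λ ιt⋠1 →
    let zero-at : ∀ n → (∀ k → k ℕ.< n → t k 𝔽.≈ 𝔽.0#) → t n 𝔽.≈ 𝔽.0#
        zero-at n t≈0 = decidable-stable (t n 𝔽.≟ 𝔽.0#) λ tn≉0 → ιt⋠1
          (≼-respˡ (sym (ι-drop n t t≈0)) (*-≼1 (^-≼1 n x≼1)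
            (≤ᵐ-reflexive (≡.trans (∣ι∣≡1 (drop n t) (≡.subst (𝔽._≉ 𝔽.0#) (≡.sym (drop-0 n t)) tn≉0)) (≡.sym ∣1∣)))))
    in ιt⋠1 (≼-respˡ (sym (trans (ι-cong (ℕ.<-rec _ (λ n ih → zero-at n (λ k k<n → ih k<n)))) ι-0)) (0≼ 1#))

  κ-≼1 : ∀ a → κ a ≼ 1#
  κ-≼1 a = ι-≼1 (const a)

  -- A non-zero constant term would force absolute value 1. Once it vanishes, a factor x cancels and
  -- the shifted series satisfies the bound with exponent one less.
  ≼x^⇒prefix≈0 : ∀ n t → ι t ≼ x ^ n → ∀ k → k ℕ.< n → t k 𝔽.≈ 𝔽.0#
  ≼x^⇒prefix≈0 (suc n) t ιt≼ = λ { zero _ → t0≈0 ; (suc k) (s≤s k<n) → ≼x^⇒prefix≈0 n (shift t) shift≼ k k<n }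
    where
    t0≈0 : t 0 𝔽.≈ 𝔽.0#
    t0≈0 = decidable-stable (t 0 𝔽.≟ 𝔽.0#) λ t0≉0 →
      ℕ.n≮0 (^-cancel-≼ {0} {suc n} (≼-trans (≤ᵐ-reflexive (≡.trans ∣1∣ (≡.sym (∣ι∣≡1 t t0≉0)))) ιt≼))
    shift≼ : ι (shift t) ≼ x ^ n
    shift≼ = *-cancelˡ-≼ x≉0 (≼-respˡ (ι-shift t t0≈0) ιt≼)

  ι-injective : ∀ {s t} → ι s ≈ ι t → ∀ n → s n 𝔽.≈ t n
  ι-injective {s} {t} ιs≈ιt n = 𝔽.x-y≈0⇒x≈y (≼x^⇒prefix≈0 (suc n) (λ n → s n 𝔽.- t n)
    (≼-respˡ (sym (trans (ι-sub s t) (x≈y⇒x-y≈0 ιs≈ιt))) (0≼ _)) n (ℕ.n<1+n n))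

-- Carlitz polynomials: recursion, integrality and product formula.

module CarlitzPolynomials (F : FiniteField c ℓ) (C : CompletedClosure F) where

  open ValuedEmbedding F C public
  open Carlitz F C public using (q; polynomials; [_]; D; e; f)
  open FiniteFieldProperties F public using (1<q; q-nonZero)

  q^n-nonZero : ∀ n → ℕ.NonZero (q ^ℕ n)
  q^n-nonZero n = ℕ.m^n≢0 q n

  ^q^-+ : ∀ j a b → (a + b) ^ (q ^ℕ j) ≈ a ^ (q ^ℕ j) + b ^ (q ^ℕ j)
  ^q^-+ j a b = ≡.subst (λ n → (a + b) ^ n ≈ a ^ n + b ^ n) (≡.sym (ℕ.^-*-assoc 𝔽.p 𝔽.ν j)) (^p^-+ (𝔽.ν ℕ.* j) a b)

  ^q-+ : ∀ a b → (a + b) ^ q ≈ a ^ q + b ^ q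
  ^q-+ = ^p^-+ 𝔽.ν

  κ^q : ∀ a → κ a ^ q ≈ κ a
  κ^q a = trans (sym (κ-^ a q)) (κ-cong (𝔽.fermat a))

  κ^q^ : ∀ j a → κ a ^ (q ^ℕ j) ≈ κ a
  κ^q^ j a = trans (sym (κ-^ a (q ^ℕ j))) (κ-cong (𝔽.fermat^ j a))

  ^q^-suc : ∀ a n → (a ^ (q ^ℕ n)) ^ q ≈ a ^ (q ^ℕ suc n)
  ^q^-suc a n = trans (^-assocʳ a (q ^ℕ n) q) (^-congʳ a (ℕ.*-comm (q ^ℕ n) q))

  [0]≈0 : [ 0 ] ≈ 0#
  [0]≈0 = x≈y⇒x-y≈0 (*-identityʳ x)

  -- The factor x witnesses that b is strictly smaller than a. If a + b were bounded by x a, so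
  -- would be a itself, which is possible only for a = 0.
  ≼-dominant : ∀ {a b} → b ≼ x * a → a ≼ a + b
  ≼-dominant {a} {b} b≼xa with ≼-total (x * a) (a + b)
  ... | inj₁ xa≼a+b = ≼-respˡ (solve 2 (λ a b → (a :+ b) :- b := a) refl a b) (∸-≼ ≼-refl (≼-trans b≼xa xa≼a+b))
  ... | inj₂ a+b≼xa = ≼-trans (≼-reflexive a≈0) (0≼ _)
    where
    a≼xa : a ≼ x * a
    a≼xa = ≼-respˡ (solve 2 (λ a b → (a :+ b) :- b := a) refl a b) (∸-≼ a+b≼xa b≼xa)
    a≈0 : a ≈ 0#
    a≈0 = decidable-stable (a ≟0) λ a≉0 → <1⇒1⋠ x<1
      (*-cancelˡ-≼ a≉0 (≼-respˡ (sym (*-identityʳ a)) (≼-respʳ (*-comm x a) a≼xa)))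

  -- The term -x dominates x^(q^(j+1)), whose size is at most |x|² because q ≥ 2. Division by
  -- [j + 1] therefore costs at most one factor x.
  x≼[_] : ∀ j → x ≼ [ suc j ]
  x≼[ j ] = ≼-trans x≼-x (≼-respʳ (+-comm _ _) (≼-dominant (≼-trans x^≼x² x²≼x*-x)))
    where
    x≼-x : x ≼ - x
    x≼-x = ≼-respˡ (-‿involutive x) (-‿≼ ≼-refl)
    x^≼x² : x ^ (q ^ℕ suc j) ≼ x ^ 2
    x^≼x² = ^-antimono-≼ x≼1 (ℕ.≤-trans 1<q (ℕ.m≤m*n q (q ^ℕ j) {{q^n-nonZero j}}))
    x²≼x*-x : x ^ 2 ≼ x * (- x)
    x²≼x*-x = *-monoʳ-≼ x (≼-respˡ (sym (*-identityʳ x)) x≼-x)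

  [suc]≉0 : ∀ j → [ suc j ] ≉ 0#
  [suc]≉0 j [j]≈0 = x≉0 (≼0⇒≈0 (≼-respʳ [j]≈0 x≼[ j ]))

  [_]<1 : ∀ j → ∣ [ j ] ∣ <ᵐ 1ᵐ
  [ j ]<1 = +-<1 (^-<1 (q ^ℕ j) {{q^n-nonZero j}} x<1) (-‿<1 x<1)

  D-suc : ∀ i → D (suc i) ≈ [ suc i ] * D i ^ q
  D-suc i = *-cong (*-identityʳ _) (sym (trans (∏-^ i (λ j → [ i ∸ j ] ^ (q ^ℕ j)) q)
    (∏-cong i (λ j → ^q^-suc [ i ∸ j ] j))))

  D≉0 : ∀ i → D i ≉ 0#
  D≉0 zero    = 1≉0
  D≉0 (suc i) D≈0 = *-nonZero ([suc]≉0 i) (^-nonZero q (D≉0 i)) (trans (sym (D-suc i)) D≈0)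

  -- E n = Dₙ⁻¹ eₙ, by eₙ₊₁ = eₙ ^ q - Dₙ ^ (q - 1) eₙ and Dₙ₊₁ = [n + 1] Dₙ ^ q.
  E : ℕ → Carrier → Carrier
  E zero    s = s
  E (suc n) s = [ suc n ] ⁻¹ * (E n s ^ q - E n s)

  E-cong : ∀ n {s t} → s ≈ t → E n s ≈ E n t
  E-cong zero    s≈t = s≈t
  E-cong (suc n) s≈t = *-congˡ (+-cong (^-congˡ q (E-cong n s≈t)) (-‿cong (E-cong n s≈t)))

  E-+ : ∀ n s t → E n (s + t) ≈ E n s + E n t
  E-+ zero    s t = refl
  E-+ (suc n) s t = trans (*-congˡ (+-cong (trans (^-congˡ q (E-+ n s t)) (^q-+ _ _)) (-‿cong (E-+ n s t))))
    (solve 5 (λ i A B a b → i :* ((A :+ B) :- (a :+ b)) := i :* (A :- a) :+ i :* (B :- b)) refl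
      ([ suc n ] ⁻¹) (E n s ^ q) (E n t ^ q) (E n s) (E n t))

  E-κ : ∀ n a s → E n (κ a * s) ≈ κ a * E n s
  E-κ zero    a s = refl
  E-κ (suc n) a s = trans (*-congˡ (+-cong (trans (^-congˡ q (E-κ n a s))
      (trans (^-distrib-* _ _ q) (*-congʳ (κ^q a)))) (-‿cong (E-κ n a s))))
    (solve 4 (λ i k A a → i :* (k :* A :- k :* a) := k :* (i :* (A :- a))) refl
      ([ suc n ] ⁻¹) (κ a) (E n s ^ q) (E n s))

  E-sub : ∀ n s t → E n (s - t) ≈ E n s - E n t
  E-sub n s t = begin
    E n (s - t)                    ≈⟨ solve 2 (λ a b → a := (a :+ b) :- b) refl _ _ ⟩
    (E n (s - t) + E n t) - E n t  ≈⟨ +-congʳ (E-+ n (s - t) t) ⟨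
    E n ((s - t) + t) - E n t      ≈⟨ +-congʳ (E-cong n (solve 2 (λ s t → (s :- t) :+ t := s) refl s t)) ⟩
    E n s - E n t                  ∎

  -- The convention f₋₁ = 0, under which `[]*E` and `E-x` hold at n = 0 as well, where [0] = 0.
  E₋₁ : ℕ → Carrier → Carrier
  E₋₁ zero    s = 0#
  E₋₁ (suc n) s = E n s

  [suc]*E : ∀ n s → [ suc n ] * E (suc n) s ≈ E n s ^ q - E n s
  [suc]*E n s = *-⁻¹-cancelˡ _ ([suc]≉0 n)

  []*E : ∀ n s → [ n ] * E n s ≈ E₋₁ n s ^ q - E₋₁ n s
  []*E zero    s = trans (trans (*-congʳ [0]≈0) (zeroˡ _)) (sym (x≈y⇒x-y≈0 (0^n≈0 q)))
  []*E (suc n) s = [suc]*E n s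

  -- Applying s ↦ s^q - s to the formula for n replaces X by Y = X^q and produces A′^q - A′, which
  -- is [n] A = (X - x) A one step lower. The terms X A cancel, and Y A^q - x A = Y (A^q - A) + (Y -
  -- x) A is divisible by [n + 1] = Y - x.
  E-x : ∀ n s → E n (x * s) ≈ x ^ (q ^ℕ n) * E n s + E₋₁ n s
  E-x zero    s = trans (*-congʳ (sym (*-identityʳ x))) (sym (+-identityʳ _))
  E-x (suc n) s = *-cancelˡ ([suc]≉0 n) (begin
    [ suc n ] * E (suc n) (x * s)
      ≈⟨ [suc]*E n (x * s) ⟩
    E n (x * s) ^ q - E n (x * s)
      ≈⟨ +-cong (trans (^-congˡ q (E-x n s)) (trans (^q-+ _ _)
           (+-congʳ (trans (^-distrib-* _ _ q) (*-congʳ (^q^-suc x n)))))) (-‿cong (E-x n s)) ⟩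
    (Y * A ^ q + A′ ^ q) - (X * A + A′)
      ≈⟨ solve 6 (λ X Y A A^q A′ A′^q → (Y :* A^q :+ A′^q) :- (X :* A :+ A′) :=
                   (A′^q :- A′) :+ (Y :* A^q :- X :* A)) refl X Y A (A ^ q) A′ (A′ ^ q) ⟩
    (A′ ^ q - A′) + (Y * A ^ q - X * A)
      ≈⟨ +-congʳ ([]*E n s) ⟨
    (X - x) * A + (Y * A ^ q - X * A)
      ≈⟨ solve 5 (λ x X Y A A^q → (X :- x) :* A :+ (Y :* A^q :- X :* A) :=
                   Y :* (A^q :- A) :+ (Y :- x) :* A) refl x X Y A (A ^ q) ⟩
    Y * (A ^ q - A) + (Y - x) * A
      ≈⟨ +-congʳ (*-congˡ ([suc]*E n s)) ⟨
    Y * ((Y - x) * E (suc n) s) + (Y - x) * A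
      ≈⟨ solve 4 (λ x Y A B → Y :* ((Y :- x) :* B) :+ (Y :- x) :* A := (Y :- x) :* (Y :* B :+ A)) refl x Y A (E (suc n) s) ⟩
    [ suc n ] * (Y * E (suc n) s + A)
      ∎)
    where
    X = x ^ (q ^ℕ n) ; Y = x ^ (q ^ℕ suc n)
    A = E n s ; A′ = E₋₁ n s

  E-1 : ∀ n → E (suc n) 1# ≈ 0#
  E-1 zero    = trans (*-congˡ (x≈y⇒x-y≈0 (1^n≈1 q))) (zeroʳ _)
  E-1 (suc n) = trans (*-congˡ (x≈y⇒x-y≈0 (trans (^-congˡ q (E-1 n)) (trans (0^n≈0 q) (sym (E-1 n)))))) (zeroʳ _)

  E-const : ∀ n a → E (suc n) (κ a) ≈ 0#
  E-const n a = trans (E-cong (suc n) (sym (*-identityʳ _))) (trans (E-κ (suc n) a 1#) (trans (*-congˡ (E-1 n)) (zeroʳ _)))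

  E-ι : ∀ n t → E n (ι t) ≈ E n (κ (t 0)) + (x ^ (q ^ℕ n) * E n (ι (shift t)) + E₋₁ n (ι (shift t)))
  E-ι n t = trans (E-cong n (ι-split t)) (trans (E-+ n _ _) (+-congˡ (E-x n _)))

  -- Because of the division by [n + 1], only x · `E (suc n)` is bounded by 1 at the outset. For t =
  -- t₀ + x t′ the value at t′ enters with the factor x^(q^(n+1)), which pays for the loss, and t₀
  -- contributes nothing.
  E-≼1 : ∀ n t → E n (ι t) ≼ 1#
  E-≼1 zero    t = ι-≼1 t
  E-≼1 (suc n) t = ≼-respˡ (sym (E-ι (suc n) t))
    (+-≼ (≼-respˡ (sym (E-const n (t 0))) (0≼ 1#))
      (+-≼ (≼-trans (*-mono-≼ (≼-respʳ (*-identityʳ x) (^-antimono-≼ {m = 1} x≼1 (ℕ.>-nonZero⁻¹ (q ^ℕ suc n) {{q^n-nonZero (suc n)}}))) ≼-refl)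
                    (xE≼1 (shift t)))
           (E-≼1 n (shift t))))
    where
    xE≼1 : ∀ t → x * E (suc n) (ι t) ≼ 1#
    xE≼1 t = ≼-respˡ (*-assoc x _ _) (*-≼1
      (≼-respʳ (inverseʳ ([suc]≉0 n)) (*-mono-≼ x≼[ n ] ≼-refl))
      (∸-≼ (^-≼1 q (E-≼1 n t)) (E-≼1 n t)))

  -- The recursion seen from s / x, the point to which the product over ω = a + x ω′ leads: s - ω =
  -- x ((s - a) / x - ω′).
  E-x⁻¹ : ∀ n s → [ suc n ] * E (suc n) s ≈ x ^ (q ^ℕ suc n) * E n (x ⁻¹ * s) ^ q - x * E n (x ⁻¹ * s)
  E-x⁻¹ n s = begin
    [ suc n ] * E (suc n) s                        ≈⟨ *-congˡ (E-cong (suc n) (*-⁻¹-cancelˡ s x≉0)) ⟨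
    [ suc n ] * E (suc n) (x * s′)                 ≈⟨ *-congˡ (E-x (suc n) s′) ⟩
    (Y - x) * (Y * E (suc n) s′ + E n s′)
      ≈⟨ solve 4 (λ x Y A B → (Y :- x) :* (Y :* B :+ A) := Y :* ((Y :- x) :* B) :+ (Y :- x) :* A) refl x Y (E n s′) (E (suc n) s′) ⟩
    Y * ([ suc n ] * E (suc n) s′) + (Y - x) * E n s′  ≈⟨ +-congʳ (*-congˡ ([suc]*E n s′)) ⟩
    Y * (E n s′ ^ q - E n s′) + (Y - x) * E n s′
      ≈⟨ solve 4 (λ x Y A A^q → Y :* (A^q :- A) :+ (Y :- x) :* A := Y :* A^q :- x :* A) refl x Y (E n s′) (E n s′ ^ q) ⟩
    Y * E n s′ ^ q - x * E n s′                    ∎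
    where
    Y  = x ^ (q ^ℕ suc n)
    s′ = x ⁻¹ * s

  -- Since `E (suc n)` vanishes at 1 = x · x⁻¹, a zero at n + 1 would descend to n and finally to
  -- x⁻¹ = 0. The value is a divisor in `Π-polynomials`.
  E[x⁻¹]≉0 : ∀ n → E n (x ⁻¹ * 1#) ≉ 0#
  E[x⁻¹]≉0 zero    x⁻¹≈0 = ⁻¹-nonZero x≉0 (trans (sym (*-identityʳ _)) x⁻¹≈0)
  E[x⁻¹]≉0 (suc n) E≈0   = E[x⁻¹]≉0 n (begin
    E n s′                                           ≈⟨ +-identityˡ _ ⟨
    0# + E n s′                                      ≈⟨ +-congʳ (trans (*-congˡ E≈0) (zeroʳ _)) ⟨
    x ^ (q ^ℕ suc n) * E (suc n) s′ + E n s′         ≈⟨ E-x (suc n) s′ ⟨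
    E (suc n) (x * s′)                               ≈⟨ E-cong (suc n) (*-⁻¹-cancelˡ 1# x≉0) ⟩
    E (suc n) 1#                                     ≈⟨ E-1 n ⟩
    0#                                               ∎)
    where s′ = x ⁻¹ * 1#

  Π : ∀ {a} {A : Set a} → List A → (A → Carrier) → Carrier
  Π as h = List.foldr _*_ 1# (List.map h as)

  Π-cong : ∀ {a} {A : Set a} (as : List A) {g h : A → Carrier} → (∀ a → g a ≈ h a) → Π as g ≈ Π as h
  Π-cong []       g≈h = refl
  Π-cong (a ∷ as) g≈h = *-cong (g≈h a) (Π-cong as g≈h)

  Π-scale : ∀ {a} {A : Set a} (as : List A) s (h : A → Carrier) → Π as (λ a → s * h a) ≈ s ^ length as * Π as h
  Π-scale []       s h = sym (*-identityˡ 1#)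
  Π-scale (a ∷ as) s h = trans (*-congˡ (Π-scale as s h))
    (solve 4 (λ s h t H → s :* h :* (t :* H) := (s :* t) :* (h :* H)) refl s (h a) _ _)

  Π-cartesian : ∀ {a b d} {A : Set a} {B : Set b} {D : Set d} (g : A → B → D) as bs (h : D → Carrier) →
                Π (List.cartesianProductWith g as bs) h ≈ Π as (λ a → Π bs (λ b → h (g a b)))
  Π-cartesian g []       bs h = refl
  Π-cartesian g (a ∷ as) bs h = trans (prefix bs) (*-congˡ (Π-cartesian g as bs h))
    where
    rest = List.cartesianProductWith g as bs
    prefix : ∀ bs → Π (List.map (g a) bs ++ rest) h ≈ Π bs (λ b → h (g a b)) * Π rest h
    prefix []       = sym (*-identityˡ _)
    prefix (b ∷ bs) = trans (*-congˡ (prefix bs)) (sym (*-assoc _ _ _))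

  -- Both sides are monic of degree q with the elements of 𝐅_q as roots.
  Π-elements : ∀ s → Π 𝔽.elements (λ a → s - κ a) ≈ s ^ q - s
  -- Generalising q to a variable allows the match on 2 + n that the vector `X^[2+ n ]-X` requires.
  Π-elements s = go q ≡.refl 1<q
    where
    κs : List Carrier
    κs = List.map κ 𝔽.elements
    length-κs : length κs ≡ q
    length-κs = ≡.trans (List.length-map κ 𝔽.elements) 𝔽.length-elements
    distinct : AllPairs _≉_ κs
    distinct = AllPairs.map⁺ (AllPairs.map (λ a≉b κa≈κb → a≉b (κ-injective κa≈κb)) 𝔽.elements-distinct)
    go : ∀ n → q ≡ n → 1 ℕ.< n → Π 𝔽.elements (λ a → s - κ a) ≈ s ^ n - s
    go (suc zero)    _  (s≤s ())
    go (suc (suc n)) q≡ _ = begin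
      Π 𝔽.elements (λ a → s - κ a)    ≡⟨ ≡.cong (List.foldr _*_ 1#) (List.map-∘ 𝔽.elements) ⟩
      Π κs (λ r → s - r)               ≈⟨ factor as distinct roots s ⟨
      monic as s                       ≈⟨ monic-subst s ⟩
      monic X^[2+ n ]-X s              ≈⟨ monic-X^-X n s ⟩
      s ^ suc (suc n) - s              ∎
      where
      len : suc (suc n) ≡ length κs
      len = ≡.trans (≡.sym q≡) (≡.sym length-κs)
      as : Vec Carrier (length κs)
      as = ≡.subst (Vec Carrier) len X^[2+ n ]-X
      monic-subst : ∀ s → monic as s ≈ monic X^[2+ n ]-X s
      monic-subst s = lemma len
        where
        lemma : ∀ {m} (eq : suc (suc n) ≡ m) → monic (≡.subst (Vec Carrier) eq X^[2+ n ]-X) s ≈ monic X^[2+ n ]-X s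
        lemma ≡.refl = refl
      roots : All (Root as) κs
      roots = All.map⁺ (All.universal (λ a → trans (monic-subst (κ a)) (trans (monic-X^-X n (κ a))
        (x≈y⇒x-y≈0 (≡.subst (λ m → κ a ^ m ≈ κ a) q≡ (κ^q a))))) 𝔽.elements)

  length-cartesian : ∀ {a b d} {A : Set a} {B : Set b} {D : Set d} (g : A → B → D) as bs →
                     length (List.cartesianProductWith g as bs) ≡ length as ℕ.* length bs
  length-cartesian g []       bs = ≡.refl
  length-cartesian g (a ∷ as) bs = ≡.trans (List.length-++ (List.map (g a) bs))
    (≡.cong₂ ℕ._+_ (List.length-map (g a) bs) (length-cartesian g as bs))

  length-polynomials : ∀ i → length (polynomials i) ≡ q ^ℕ i
  length-polynomials zero    = ≡.refl
  length-polynomials (suc i) = ≡.trans (length-cartesian _∷_ 𝔽.elements (polynomials i))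
    (≡.cong₂ ℕ._*_ 𝔽.length-elements (length-polynomials i))

  -- Induction by ω = a + x ω′. For fixed a, additivity makes the product over ω′ equal to X Dᵢ (Y -
  -- a Z) with Y = Eᵢ(s/x) and Z = Eᵢ(1/x). Taking out Z leaves W - a with W = Y / Z, and the
  -- product of these over a in 𝐅_q is W^q - W.
  Π-polynomials : ∀ i s → Π (polynomials i) (λ ω → s - ι (fromPolynomial ω)) ≈ D i * E i s
  Π-polynomials zero    s = trans (*-identityʳ _) (trans (+-congˡ (trans (-‿cong ι-0) -0#≈0#)) (trans (+-identityʳ s) (sym (*-identityˡ s))))
  Π-polynomials (suc i) s = begin
    Π (polynomials (suc i)) (λ ω → s - ι (fromPolynomial ω))
      ≈⟨ Π-cartesian _∷_ 𝔽.elements (polynomials i) _ ⟩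
    Π 𝔽.elements (λ a → Π (polynomials i) (λ ω → s - ι (fromPolynomial (a ∷ ω))))
      ≈⟨ Π-cong 𝔽.elements inner ⟩
    Π 𝔽.elements (λ a → (X * (D i * Z)) * (W - κ a))
      ≈⟨ Π-scale 𝔽.elements _ _ ⟩
    (X * (D i * Z)) ^ length 𝔽.elements * Π 𝔽.elements (λ a → W - κ a)
      ≈⟨ *-cong (^-congʳ _ 𝔽.length-elements) (Π-elements W) ⟩
    (X * (D i * Z)) ^ q * (W ^ q - W)
      ≈⟨ *-congʳ (trans (^-distrib-* _ _ q) (*-cong (^q^-suc x i) (^-distrib-* _ _ q))) ⟩
    X′ * (D i ^ q * Z ^ q) * (W ^ q - W)
      ≈⟨ solve 5 (λ X′ D Z^q W W^q → X′ :* (D :* Z^q) :* (W^q :- W) := D :* (X′ :* (Z^q :* W^q) :- (X′ :* Z^q) :* W)) refl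
           X′ (D i ^ q) (Z ^ q) W (W ^ q) ⟩
    D i ^ q * (X′ * (Z ^ q * W ^ q) - (X′ * Z ^ q) * W)
      ≈⟨ *-congˡ (+-cong (*-congˡ (trans (sym (^-distrib-* Z W q)) (^-congˡ q ZW≈Y)))
           (-‿cong (trans (*-congʳ X′Z^q≈xZ) (trans (*-assoc x Z W) (*-congˡ ZW≈Y))))) ⟩
    D i ^ q * (X′ * Y ^ q - x * Y)
      ≈⟨ *-congˡ (E-x⁻¹ i s) ⟨
    D i ^ q * ([ suc i ] * E (suc i) s)
      ≈⟨ solve 3 (λ d b e → d :* (b :* e) := (b :* d) :* e) refl _ _ _ ⟩
    [ suc i ] * D i ^ q * E (suc i) s
      ≈⟨ *-congʳ (D-suc i) ⟨
    D (suc i) * E (suc i) s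
      ∎
    where
    X = x ^ (q ^ℕ i) ; X′ = x ^ (q ^ℕ suc i)
    Y = E i (x ⁻¹ * s) ; Z = E i (x ⁻¹ * 1#) ; W = Z ⁻¹ * Y
    ZW≈Y : Z * W ≈ Y
    ZW≈Y = *-⁻¹-cancelˡ Y (E[x⁻¹]≉0 i)
    -- At s = 1 the left side of `E-x⁻¹` vanishes; the resulting relation between Z^q and Z
    -- eliminates both Z and W.
    X′Z^q≈xZ : X′ * Z ^ q ≈ x * Z
    X′Z^q≈xZ = x-y≈0⇒x≈y (trans (sym (E-x⁻¹ i 1#)) (trans (*-congˡ (E-1 i)) (zeroʳ _)))
    inner : ∀ a → Π (polynomials i) (λ ω → s - ι (fromPolynomial (a ∷ ω))) ≈ (X * (D i * Z)) * (W - κ a)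
    inner a = begin
      Π (polynomials i) (λ ω → s - ι (fromPolynomial (a ∷ ω)))
        ≈⟨ Π-cong (polynomials i) (λ ω → trans (+-congˡ (-‿cong (ι-split (fromPolynomial (a ∷ ω)))))
             (trans (+-congʳ (sym (*-⁻¹-cancelˡ s x≉0)))
             (trans (+-congˡ (-‿cong (+-congʳ (sym (*-⁻¹-cancelˡ (κ a) x≉0)))))
             (solve 4 (λ x s k w → x :* s :- (x :* k :+ x :* w) := x :* ((s :- k) :- w)) refl x (x ⁻¹ * s) (x ⁻¹ * κ a) _)))) ⟩
      Π (polynomials i) (λ ω → x * ((x ⁻¹ * s - x ⁻¹ * κ a) - ι (fromPolynomial ω)))
        ≈⟨ Π-scale (polynomials i) x _ ⟩
      x ^ length (polynomials i) * Π (polynomials i) (λ ω → (x ⁻¹ * s - x ⁻¹ * κ a) - ι (fromPolynomial ω))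
        ≈⟨ *-cong (^-congʳ x (length-polynomials i)) (Π-polynomials i _) ⟩
      X * (D i * E i (x ⁻¹ * s - x ⁻¹ * κ a))
        ≈⟨ *-congˡ (*-congˡ (trans (E-sub i _ _) (+-cong (sym ZW≈Y)
             (-‿cong (trans (E-cong i (solve 2 (λ y k → y :* k := k :* (y :* :1)) refl (x ⁻¹) (κ a))) (E-κ i a _)))))) ⟩
      X * (D i * (Z * W - κ a * Z))
        ≈⟨ solve 5 (λ X D Z W k → X :* (D :* (Z :* W :- k :* Z)) := (X :* (D :* Z)) :* (W :- k)) refl X (D i) Z W (κ a) ⟩
      (X * (D i * Z)) * (W - κ a)
        ∎

  f≈E : ∀ i t → f i t ≈ E i (ι t)
  f≈E i t = trans (*-congˡ (e≈DE i)) (⁻¹-*-cancelˡ _ (D≉0 i))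
    where
    e≈DE : ∀ i → e i (ι t) ≈ D i * E i (ι t)
    e≈DE zero    = sym (*-identityˡ _)
    e≈DE (suc i) = Π-polynomials (suc i) (ι t)

-- Evaluation of power series at z and the expansion of u.

module Evaluation (F : FiniteField c ℓ) (C : CompletedClosure F) where

  open CarlitzPolynomials F C public
  open Carlitz F C public using (HasExpansion; uCoefficient; Solves; Continuous)

  terms : Carrier → O → ℕ → Carrier
  terms z t k = κ (t k) * z ^ k

  -- g is the substitution t ↦ t (z) of z for x.
  infix 4 _EvaluatesAt_
  _EvaluatesAt_ : (O → Carrier) → Carrier → Set _
  g EvaluatesAt z = ∀ t → HasSum (terms z t) (g t)

  evaluates-resp : ∀ {g z z′} → z ≈ z′ → g EvaluatesAt z → g EvaluatesAt z′
  evaluates-resp {z = z} {z′} z≈z′ ev t = HasSum-cong (terms z t) (terms z′ t) (λ k → *-congˡ (^-congˡ k z≈z′)) refl (ev t)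

  evaluates-unique : ∀ {g g′ z} → g EvaluatesAt z → g′ EvaluatesAt z → ∀ t → g t ≈ g′ t
  evaluates-unique ev ev′ t = ⟶-unique (ev t) (ev′ t)

  -- Unrolling the recursion n times gives the partial sum plus zⁿ times the value at the n-th tail;
  -- boundedness up to a fixed power of x makes this remainder null.
  evaluates-intro : ∀ {g z} → ∣ z ∣ <ᵐ 1ᵐ → (∀ t → g t ≈ κ (t 0) + z * g (shift t)) →
                    (∃[ k ] ∀ t → x ^ k * g t ≼ 1#) → g EvaluatesAt z
  evaluates-intro {g} {z} z<1 recursive (k , bounded) t =
    null-intro (null-cong
      (λ n → trans (solve 2 (λ s r → :- :1 :* r := s :- (s :+ r)) refl _ _) (+-congˡ (-‿cong (sym (expand n t)))))
      (null-* (- 1#) remainder))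
    where
    expand : ∀ n t → g t ≈ ∑[ n ] (terms z t) + z ^ n * g (drop n t)
    expand zero    t = sym (trans (+-identityˡ _) (*-identityˡ _))
    expand (suc n) t = begin
      g t
        ≈⟨ recursive t ⟩
      κ (t 0) + z * g (shift t)
        ≈⟨ +-congˡ (*-congˡ (expand n (shift t))) ⟩
      κ (t 0) + z * (∑[ n ] (terms z (shift t)) + z ^ n * g (drop (suc n) t))
        ≈⟨ solve 5 (λ k z s w g → k :+ z :* (s :+ w :* g) := k :* :1 :+ z :* s :+ (z :* w) :* g) refl _ _ _ _ _ ⟩
      κ (t 0) * 1# + z * ∑[ n ] (terms z (shift t)) + z ^ suc n * g (drop (suc n) t)
        ≈⟨ +-congʳ (+-congˡ (sym (trans (∑-cong n (λ k → solve 3 (λ a z w → a :* (z :* w) := z :* (a :* w)) refl (κ (t (suc k))) z (z ^ k)))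
             (∑-*ˡ n z (terms z (shift t)))))) ⟩
      ∑[ suc n ] (terms z t) + z ^ suc n * g (drop (suc n) t)
        ∎
    remainder : Null (λ n → z ^ n * g (drop n t))
    remainder = null-cong (λ n → ⁻¹-*-cancelˡ _ (x^n≉0 k)) (null-* ((x ^ k) ⁻¹)
      (null-≼ (λ n → ≼-respˡ (solve 3 (λ a b d → (b :* d) :* a := b :* (a :* d)) refl (z ^ n) (x ^ k) (g (drop n t)))
                             (*-≼1 (bounded (drop n t)) ≼-refl))
              (null-powers z<1)))

  module Evaluates {g z} (z<1 : ∣ z ∣ <ᵐ 1ᵐ) (ev : g EvaluatesAt z) where

    ev-rec : ∀ t → g t ≈ κ (t 0) + z * g (shift t)
    ev-rec t = begin
      g t                                  ≈⟨ solve 2 (λ a k → a := k :+ (a :- k :* :1)) refl _ _ ⟩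
      κ (t 0) + (g t - κ (t 0) * 1#)       ≈⟨ +-congˡ (⟶-unique
        (HasSum-cong (terms z t ∘ suc) (λ k → z * terms z (shift t) k)
          (λ k → solve 3 (λ a z w → a :* (z :* w) := z :* (a :* w)) refl (κ (t (suc k))) z (z ^ k)) refl (HasSum-suc (terms z t) (ev t)))
        (HasSum-* z (terms z (shift t)) (ev (shift t)))) ⟩
      κ (t 0) + z * g (shift t)            ∎

    ev-≼1 : ∀ t → g t ≼ 1#
    ev-≼1 t = ⟶-≼ 1≉0 (λ n → ∑-≼ n {terms z t} (λ k → *-≼1 (κ-≼1 (t k)) (^-≼1 k (<1⇒≼1 z<1)))) (ev t)

    -- `g` is a bare function on coefficient sequences; that it respects their equality is read off
    -- from its sum.
    ev-cong : ∀ {s t} → (∀ n → s n 𝔽.≈ t n) → g s ≈ g t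
    ev-cong {s} {t} s≈t = ⟶-unique
      (HasSum-cong (terms z s) (terms z t) (λ k → *-congʳ (κ-cong (s≈t k))) refl (ev s)) (ev t)

    -- Lets equations between series be verified in the completed field, where the ring laws are
    -- available, since `O` carries only raw operations.
    ev-ι-cong : ∀ {s t} → ι s ≈ ι t → g s ≈ g t
    ev-ι-cong {s} {t} ιs≈ιt = ev-cong (ι-injective {s} {t} ιs≈ιt)

    ev-+ : ∀ s t → g (λ n → s n 𝔽.+ t n) ≈ g s + g t
    ev-+ s t = ⟶-unique (ev s+t)
      (HasSum-cong (λ k → terms z s k + terms z t k) (terms z s+t) (λ k → trans (sym (distribʳ _ _ _)) (*-congʳ (sym (κ-+ (s k) (t k))))) refl
        (HasSum-+ (terms z s) (terms z t) (ev s) (ev t)))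
      where s+t = λ n → s n 𝔽.+ t n

    ev-0 : g (λ _ → 𝔽.0#) ≈ 0#
    ev-0 = ⟶-unique (ev (λ _ → 𝔽.0#)) (HasSum-zero (terms z (λ _ → 𝔽.0#)) (λ k → trans (*-congʳ κ-0) (zeroˡ _)))

    ev-const : ∀ a → g (const a) ≈ κ a
    ev-const a = trans (ev-rec (const a)) (trans (+-congˡ (trans (*-congˡ ev-0) (zeroʳ z))) (+-identityʳ _))

    ev-xₒ* : ∀ t → g (xₒ *ₒ t) ≈ z * g t
    ev-xₒ* t = begin
      g (xₒ *ₒ t)                                      ≈⟨ ev-rec (xₒ *ₒ t) ⟩
      κ ((xₒ *ₒ t) 0) + z * g (shift (xₒ *ₒ t))       ≈⟨ +-cong (trans (κ-cong (xₒ*-zero t)) κ-0) (*-congˡ (ev-cong (xₒ*-suc t))) ⟩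
      0# + z * g t                                     ≈⟨ +-identityˡ _ ⟩
      z * g t                                          ∎

    ev-xₒ^* : ∀ n t → g ((xₒ ^ₒ n) *ₒ t) ≈ z ^ n * g t
    ev-xₒ^* zero    t = trans (ev-ι-cong (trans (ι-* (xₒ ^ₒ 0) t) (trans (*-congʳ ι-1) (*-identityˡ _)))) (sym (*-identityˡ _))
    ev-xₒ^* (suc n) t = begin
      g ((xₒ ^ₒ suc n) *ₒ t)           ≈⟨ ev-ι-cong (trans (ι-* (xₒ ^ₒ suc n) t) (trans (*-congʳ (ι-* xₒ (xₒ ^ₒ n))) (trans (*-assoc _ _ _)
                                            (sym (trans (ι-* xₒ ((xₒ ^ₒ n) *ₒ t)) (*-congˡ (ι-* (xₒ ^ₒ n) t))))))) ⟩
      g (xₒ *ₒ ((xₒ ^ₒ n) *ₒ t))       ≈⟨ ev-xₒ* ((xₒ ^ₒ n) *ₒ t) ⟩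
      z * g ((xₒ ^ₒ n) *ₒ t)           ≈⟨ *-congˡ (ev-xₒ^* n t) ⟩
      z * (z ^ n * g t)                ≈⟨ *-assoc _ _ _ ⟨
      z ^ suc n * g t                  ∎

    ev-1 : g (RawRing.1# powerSeries) ≈ 1#
    ev-1 = trans (ev-ι-cong (trans ι-1 (sym κ-1))) (trans (ev-const 𝔽.1#) κ-1)

    ev-xₒ^ : ∀ n → g (xₒ ^ₒ n) ≈ z ^ n
    ev-xₒ^ zero    = ev-1
    ev-xₒ^ (suc n) = trans (ev-xₒ* (xₒ ^ₒ n)) (*-congˡ (ev-xₒ^ n))

    ev-drop : ∀ n t → (∀ k → k ℕ.< n → t k 𝔽.≈ 𝔽.0#) → g t ≈ z ^ n * g (drop n t)
    ev-drop zero    t t≈0 = sym (*-identityˡ _)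
    ev-drop (suc n) t t≈0 = begin
      g t                                 ≈⟨ ev-rec t ⟩
      κ (t 0) + z * g (shift t)           ≈⟨ +-congʳ (trans (κ-cong (t≈0 0 (s≤s z≤n))) κ-0) ⟩
      0# + z * g (shift t)                ≈⟨ +-identityˡ _ ⟩
      z * g (shift t)                     ≈⟨ *-congˡ (ev-drop n (shift t) (λ k k<n → t≈0 (suc k) (s≤s k<n))) ⟩
      z * (z ^ n * g (drop (suc n) t))    ≈⟨ *-assoc _ _ _ ⟨
      z ^ suc n * g (drop (suc n) t)      ∎

    ev-sub : ∀ s t → g (λ n → s n 𝔽.- t n) ≈ g s - g t
    ev-sub s t = begin
      g (λ n → s n 𝔽.- t n)                  ≈⟨ solve 2 (λ a b → a := (a :+ b) :- b) refl _ _ ⟩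
      (g (λ n → s n 𝔽.- t n) + g t) - g t    ≈⟨ +-congʳ (ev-+ (λ n → s n 𝔽.- t n) t) ⟨
      g (λ n → (s n 𝔽.- t n) 𝔽.+ t n) - g t  ≈⟨ +-congʳ (ev-cong (λ n →
        𝔽.solve 2 (λ s t → (s 𝔽.:- t) 𝔽.:+ t 𝔽.:= s) 𝔽.refl (s n) (t n))) ⟩
      g s - g t                               ∎

    -- Closeness to t₀ within |x^N| means agreement of the first N coefficients, which leaves a
    -- factor z^N in g(t - t₀) = g(t) - g(t₀).
    ev-continuous : Continuous g
    ev-continuous t₀ r =
      let k , x^k≤  = x^-≤ r
          N , z^≼   = small-powers z<1 k
          δ , ∣x^N∣ = ∣∣-nonZero (x^n≉0 N) in
      δ , λ t close →
        let s = λ n → t n 𝔽.- t₀ n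
            s≈0 = ≼x^⇒prefix≈0 N s (≼-respˡ (sym (ι-sub t t₀)) (≤ᵐ-trans close (≤ᵐ-reflexive (≡.sym ∣x^N∣)))) in
        ≤ᵐ-trans (≼-respˡ (trans (sym (ev-drop N s s≈0)) (ev-sub t t₀))
          (≼-respˡ (*-comm _ _) (*-≼1 (ev-≼1 (drop N s)) (z^≼ N ℕ.≤-refl)))) x^k≤

    z≈0⇒ev≈κ : z ≈ 0# → ∀ t → g t ≈ κ (t 0)
    z≈0⇒ev≈κ z≈0 t = trans (ev-rec t) (trans (+-congˡ (trans (*-congʳ z≈0) (zeroˡ _))) (+-identityʳ _))

    -- The Q-th power is additive and fixes 𝐅_q, so (t₀ + x t′)^Q = t₀ + x^Q t′^Q, and g turns the
    -- factor x^Q into z^Q.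
    ev-^q^ : ∀ m → (λ t → g (t ^ₒ (q ^ℕ m))) EvaluatesAt (z ^ (q ^ℕ m))
    ev-^q^ m = evaluates-intro (^-<1 Q {{q^n-nonZero m}} z<1)
      (λ t → begin
        g (t ^ₒ Q)
          ≈⟨ ev-ι-cong (split t) ⟩
        g (λ n → const (t 0) n 𝔽.+ ((xₒ ^ₒ Q) *ₒ (shift t ^ₒ Q)) n)
          ≈⟨ ev-+ (const (t 0)) ((xₒ ^ₒ Q) *ₒ (shift t ^ₒ Q)) ⟩
        g (const (t 0)) + g ((xₒ ^ₒ Q) *ₒ (shift t ^ₒ Q))
          ≈⟨ +-cong (ev-const (t 0)) (ev-xₒ^* Q (shift t ^ₒ Q)) ⟩
        κ (t 0) + z ^ Q * g (shift t ^ₒ Q)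
          ∎)
      (0 , λ t → *-≼1 ≼-refl (ev-≼1 _))
      where
      Q = q ^ℕ m
      split : ∀ t → ι (t ^ₒ Q) ≈ ι (λ n → const (t 0) n 𝔽.+ ((xₒ ^ₒ Q) *ₒ (shift t ^ₒ Q)) n)
      split t = begin
        ι (t ^ₒ Q)                                        ≈⟨ ι-^ t Q ⟩
        ι t ^ Q                                           ≈⟨ ^-congˡ Q (ι-split t) ⟩
        (κ (t 0) + x * ι (shift t)) ^ Q                   ≈⟨ ^q^-+ m _ _ ⟩
        κ (t 0) ^ Q + (x * ι (shift t)) ^ Q               ≈⟨ +-cong (κ^q^ m (t 0)) (^-distrib-* _ _ Q) ⟩
        κ (t 0) + x ^ Q * ι (shift t) ^ Q                 ≈⟨ +-congˡ (*-cong (ι-^ xₒ Q) (ι-^ (shift t) Q)) ⟨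
        κ (t 0) + ι (xₒ ^ₒ Q) * ι (shift t ^ₒ Q)          ≈⟨ +-congˡ (ι-* (xₒ ^ₒ Q) (shift t ^ₒ Q)) ⟨
        κ (t 0) + ι ((xₒ ^ₒ Q) *ₒ (shift t ^ₒ Q))         ≈⟨ ι-+ (const (t 0)) ((xₒ ^ₒ Q) *ₒ (shift t ^ₒ Q)) ⟨
        ι (λ n → const (t 0) n 𝔽.+ ((xₒ ^ₒ Q) *ₒ (shift t ^ₒ Q)) n) ∎

  ι^q^-evaluates : ∀ j → (λ t → ι t ^ (q ^ℕ j)) EvaluatesAt (x ^ (q ^ℕ j))
  ι^q^-evaluates j = evaluates-intro (^-<1 Q {{q^n-nonZero j}} x<1)
    (λ t → trans (^-congˡ Q (ι-split t)) (trans (^q^-+ j _ _) (+-cong (κ^q^ j (t 0)) (^-distrib-* _ _ Q))))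
    (0 , λ t → *-≼1 ≼-refl (^-≼1 Q (ι-≼1 t)))
    where Q = q ^ℕ j

  module Expansion {λ′} (λ<1 : ∣ λ′ ∣ <ᵐ 1ᵐ) where

    private
      z = x + λ′
      a = uCoefficient λ′
      X = λ n → x ^ (q ^ℕ n)

    z<1 : ∣ z ∣ <ᵐ 1ᵐ
    z<1 = +-<1 x<1 λ<1

    a-suc : ∀ n → a (suc n) ≈ a n * (z - X n)
    a-suc n = trans (∏-last n (λ j → λ′ - [ j ])) (*-congˡ (solve 3 (λ l X x → l :- (X :- x) := (x :+ l) :- X) refl λ′ (X n) x))

    -- The larger of x and λ bounds all factors λ - [j] at once, so the coefficients decay
    -- geometrically.
    rate : Σ[ y ∈ Carrier ] ∣ y ∣ <ᵐ 1ᵐ × (∀ j → λ′ - [ j ] ≼ y)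
    rate = case (≼-total λ′ x)
      where
      [j]≼x : ∀ j → [ j ] ≼ x
      [j]≼x j = ∸-≼ (≼-respʳ (*-identityʳ x) (^-antimono-≼ {m = 1} x≼1 (ℕ.>-nonZero⁻¹ (q ^ℕ j) {{q^n-nonZero j}}))) ≼-refl
      case : λ′ ≼ x ⊎ x ≼ λ′ → Σ[ y ∈ Carrier ] ∣ y ∣ <ᵐ 1ᵐ × (∀ j → λ′ - [ j ] ≼ y)
      case (inj₁ λ≼x) = x , x<1 , λ j → ∸-≼ λ≼x ([j]≼x j)
      case (inj₂ x≼λ) = λ′ , λ<1 , λ j → ∸-≼ ≼-refl (≼-trans ([j]≼x j) x≼λ)

    y = proj₁ rate
    y<1 : ∣ y ∣ <ᵐ 1ᵐ
    y<1 = proj₁ (proj₂ rate)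

    a≼y^ : ∀ n → a n ≼ y ^ n
    a≼y^ n = go n (λ j → λ′ - [ j ]) (proj₂ (proj₂ rate))
      where
      go : ∀ n (b : ℕ → Carrier) → (∀ j → b j ≼ y) → ∏[ n ] b ≼ y ^ n
      go zero    b b≼y = ≼-refl
      go (suc n) b b≼y = *-mono-≼ (b≼y 0) (go n (b ∘ suc) (b≼y ∘ suc))

    a-null : Null a
    a-null = null-≼ a≼y^ (null-powers y<1)

    a⟶0 : a ⟶ 0#
    a⟶0 = null-intro (null-cong (λ n → sym (trans (+-congˡ -0#≈0#) (+-identityʳ _))) a-null)

    converges : ∀ t → ∃[ s ] HasSum (λ n → a n * f n t) s
    converges t = geometric-sum complete y<1 _ λ n →
      ≼-respˡ (trans (*-comm _ _) (*-congˡ (sym (f≈E n t)))) (*-≼1 (E-≼1 n t) (a≼y^ n))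

    S : ℕ → O → Carrier
    S n t = ∑[ n ] (λ i → a i * E i (ι t))

    -- The value Eᵢ(t′) arises from the terms i and i + 1, with total coefficient aᵢ X i + aᵢ₊₁ = z
    -- aᵢ. In a partial sum the last index lacks its second contribution; this is the correction
    -- term, which tends to 0 with the coefficients.
    S-rec : ∀ n t → S (suc n) t ≈ (κ (t 0) + z * S (suc n) (shift t)) - a (suc n) * E n (ι (shift t))
    S-rec zero    t = begin
      1# * ι t + 0#
        ≈⟨ +-congʳ (*-congˡ (ι-split t)) ⟩
      1# * (κ (t 0) + x * s) + 0#
        ≈⟨ solve 4 (λ x l k s → :1 :* (k :+ x :* s) :+ :0 :=
             (k :+ (x :+ l) :* (:1 :* s :+ :0)) :- :1 :* ((x :+ l) :- x) :* s) refl x λ′ (κ (t 0)) s ⟩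
      (κ (t 0) + z * (1# * s + 0#)) - 1# * (z - x) * s
        ≈⟨ +-congˡ (-‿cong (*-congʳ (trans (a-suc 0) (*-congˡ (+-congˡ (-‿cong (*-identityʳ x))))))) ⟨
      (κ (t 0) + z * (1# * s + 0#)) - a 1 * s
        ∎
      where s = ι (shift t)
    S-rec (suc n) t = begin
      S (suc (suc n)) t
        ≈⟨ ∑-last (suc n) (λ i → a i * E i (ι t)) ⟩
      S (suc n) t + a (suc n) * E (suc n) (ι t)
        ≈⟨ +-cong (S-rec n t) (*-congˡ (trans (E-ι (suc n) t) (+-congʳ (E-const n (t 0))))) ⟩
      ((κ (t 0) + z * S (suc n) t′) - a (suc n) * E n s) + a (suc n) * (0# + (X (suc n) * E (suc n) s + E n s))
        ≈⟨ solve 7 (λ k z S a X e e′ → ((k :+ z :* S) :- a :* e) :+ a :* (:0 :+ (X :* e′ :+ e)) :=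
                     (k :+ z :* (S :+ a :* e′)) :- (a :* (z :- X)) :* e′)
             refl (κ (t 0)) z (S (suc n) t′) (a (suc n)) (X (suc n)) (E n s) (E (suc n) s) ⟩
      (κ (t 0) + z * (S (suc n) t′ + a (suc n) * E (suc n) s)) - (a (suc n) * (z - X (suc n))) * E (suc n) s
        ≈⟨ +-cong (+-congˡ (*-congˡ (∑-last (suc n) (λ i → a i * E i s)))) (-‿cong (*-congʳ (a-suc (suc n)))) ⟨
      (κ (t 0) + z * S (suc (suc n)) t′) - a (suc (suc n)) * E (suc n) s
        ∎
      where t′ = shift t ; s = ι t′

    -- A null sequence of coefficients is bounded, and |fᵢ| ≤ 1 on O passes the bound on to the sum,
    -- uniformly in t.
    expansion-bounded : ∀ {v b} → Null b → HasExpansion v b → ∃[ k ] ∀ t → x ^ k * v t ≼ 1#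
    expansion-bounded {v} {b} b-null expansion =
      let k , bounded = null-bounded b-null in
      k , λ t → ⟶-≼ 1≉0
        (λ n → ∑-≼ n {λ i → x ^ k * (b i * f i t)} (λ i →
          ≼-respˡ (trans (*-comm _ _) (trans (*-assoc _ _ _) (*-congˡ (*-congˡ (sym (f≈E i t))))))
          (*-≼1 (E-≼1 i t) (bounded i))))
        (HasSum-* (x ^ k) (λ i → b i * f i t) (expansion t))

    expansion⇒evaluates : ∀ {g} → HasExpansion g a → g EvaluatesAt z
    expansion⇒evaluates {g} expansion = evaluates-intro z<1 recursive (expansion-bounded a-null expansion)
      where
      S⟶g : ∀ t → (λ n → S (suc n) t) ⟶ g t
      S⟶g t = null-intro (null-suc (null-elim (HasSum-cong (λ i → a i * f i t) (λ i → a i * E i (ι t)) (λ i → *-congˡ (f≈E i t)) refl (expansion t))))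
      recursive : ∀ t → g t ≈ κ (t 0) + z * g (shift t)
      recursive t = ⟶-unique (S⟶g t) (⟶-null
        (⟶-+ (⟶-const (κ (t 0))) (⟶-* z (S⟶g (shift t))))
        (null-cong (λ n → trans (solve 2 (λ b c → :- :1 :* b := (c :- b) :- c) refl _ _) (+-congʳ (sym (S-rec n t))))
          (null-* (- 1#) (null-≼ (λ n → ≼-respˡ (*-comm _ _) (*-≼1 (E-≼1 n (shift t)) ≼-refl)) (null-suc a-null)))))

    evaluates⇒solves : ∀ {g} → g EvaluatesAt z → Solves λ′ g
    evaluates⇒solves {g} ev t = trans (+-congʳ (Evaluates.ev-xₒ* z<1 ev t))
      (solve 3 (λ x l g → (x :+ l) :* g :- x :* g := l :* g) refl x λ′ (g t))

    -- The equation gives only v(x t) = z v(t). The constant term is separated by the expansion: the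
    -- fᵢ are additive and for i ≥ 1 annihilate constants, so t₀ enters through b₀ f₀ alone, and b₀
    -- = 1.
    solution⇒evaluates : ∀ {v b} → b ⟶ 0# → b 0 ≈ 1# → HasExpansion v b → Solves λ′ v → v EvaluatesAt z
    solution⇒evaluates {v} {b} b⟶0 b0≈1 expansion solves = evaluates-intro z<1 recursive (expansion-bounded b-null expansion)
      where
      b-null : Null b
      b-null = null-cong (λ n → trans (+-congˡ -0#≈0#) (+-identityʳ _)) (null-elim b⟶0)
      v-x : ∀ t → v (xₒ *ₒ t) ≈ z * v t
      v-x t = trans (solve 3 (λ w x v → w := (w :- x :* v) :+ x :* v) refl (v (xₒ *ₒ t)) x (v t))
        (trans (+-congʳ (solves t)) (solve 3 (λ l x v → l :* v :+ x :* v := (x :+ l) :* v) refl λ′ x (v t)))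
      v-split : ∀ t → v t ≈ κ (t 0) + v (xₒ *ₒ shift t)
      v-split t = ⟶-unique (expansion t) (HasSum-cong
        (λ i → b i * E i (κ (t 0)) + b i * f i (xₒ *ₒ shift t)) (λ i → b i * f i t)
        (λ i → trans (sym (distribˡ _ _ _)) (*-congˡ (trans (+-congˡ (trans (f≈E i _) (E-cong i (ι-* xₒ (shift t)))))
          (sym (trans (f≈E i t) (trans (E-cong i (ι-split t)) (E-+ i _ _)))))))
        (+-congʳ (trans (*-congʳ b0≈1) (*-identityˡ _)))
        (HasSum-+ (λ i → b i * E i (κ (t 0))) (λ i → b i * f i (xₒ *ₒ shift t))
          (HasSum-single 0 (λ i → b i * E i (κ (t 0))) const-terms) (expansion (xₒ *ₒ shift t))))
        where
        const-terms : ∀ n → n ≢ 0 → b n * E n (κ (t 0)) ≈ 0#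
        const-terms zero    n≢0 = contradiction ≡.refl n≢0
        const-terms (suc n) _   = trans (*-congˡ (E-const n (t 0))) (zeroʳ _)
      recursive : ∀ t → v t ≈ κ (t 0) + z * v (shift t)
      recursive t = trans (v-split t) (+-congˡ (v-x (shift t)))

-- Which evaluations are analytic or locally analytic.

module Analyticity (F : FiniteField c ℓ) (C : CompletedClosure F) where

  open Evaluation F C public
  open Carlitz F C public using (Ball; AnalyticOn; Analytic; LocallyAnalytic)

  p-part : ∀ n → .{{_ : ℕ.NonZero n}} → ∃[ K ] ∃[ m ] n ≡ 𝔽.p ^ℕ K ℕ.* m × ¬ 𝔽.p ℕ.∣ m
  p-part = ℕ.<-rec _ step
    where
    p = 𝔽.p
    step : ∀ n → (∀ {d} → d ℕ.< n → .{{_ : ℕ.NonZero d}} → ∃[ K ] ∃[ m ] d ≡ p ^ℕ K ℕ.* m × ¬ p ℕ.∣ m) →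
           .{{_ : ℕ.NonZero n}} → ∃[ K ] ∃[ m ] n ≡ p ^ℕ K ℕ.* m × ¬ p ℕ.∣ m
    step n rec with p ℕ.∣? n
    ... | no  p∤n = 0 , n , ≡.sym (ℕ.+-identityʳ n) , p∤n
    ... | yes (ℕ.divides d@(suc _) ≡.refl) =
      let K , m , d≡ , p∤m = rec (ℕ.m<m*n d p 𝔽.1<p) in
      suc K , m , ≡.trans (≡.trans (ℕ.*-comm d p) (≡.cong (p ℕ.*_) d≡)) (≡.sym (ℕ.*-assoc p (p ^ℕ K) m)) , p∤m

  -- By Bézout, m · 1 = 0 and p · 1 = 0 together would give 1 = 0.
  ∤⇒·1≉0 : ∀ {m} → ¬ 𝔽.p ℕ.∣ m → m 𝔽.· 𝔽.1# 𝔽.≉ 𝔽.0#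
  ∤⇒·1≉0 {m} p∤m m·1≈0 = case (coprime-Bézout coprime)
    where
    open 𝔽.Frobenius 𝔽.p-prime 𝔽.p·1≈0 using () renaming (∣⇒·≈0 to p∣⇒·≈0)
    coprime : Coprime m 𝔽.p
    coprime (d∣m , d∣p) with prime⇒irreducible 𝔽.p-prime d∣p
    ... | inj₁ d≡1 = d≡1
    ... | inj₂ ≡.refl = contradiction d∣m p∤m
    u·m·1≈0 : ∀ u → (u ℕ.* m) 𝔽.· 𝔽.1# 𝔽.≈ 𝔽.0#
    u·m·1≈0 u = 𝔽.trans (𝔽.×1-homo-* u m) (𝔽.trans (𝔽.*-congˡ m·1≈0) (𝔽.zeroʳ _))
    v·p·1≈0 : ∀ v → (v ℕ.* 𝔽.p) 𝔽.· 𝔽.1# 𝔽.≈ 𝔽.0#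
    v·p·1≈0 v = p∣⇒·≈0 (ℕ.n∣m*n v) 𝔽.1#
    absurd : ∀ {a b} → a 𝔽.· 𝔽.1# 𝔽.≈ 𝔽.0# → b 𝔽.· 𝔽.1# 𝔽.≈ 𝔽.0# → 1 ℕ.+ a ≡ b → ⊥
    absurd a≈0 b≈0 1+a≡b = 𝔽.1≉0 (𝔽.trans (𝔽.sym (𝔽.trans (𝔽.+-congˡ a≈0) (𝔽.+-identityʳ _)))
      (≡.subst (λ n → n 𝔽.· 𝔽.1# 𝔽.≈ 𝔽.0#) (≡.sym 1+a≡b) b≈0))
    case : Bézout.Identity 1 m 𝔽.p → ⊥
    case (Bézout.+- u v eq) = absurd (v·p·1≈0 v) (u·m·1≈0 u) eq
    case (Bézout.-+ u v eq) = absurd (u·m·1≈0 u) (v·p·1≈0 v) eq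

  ·1-≼1 : ∀ m → m · 1# ≼ 1#
  ·1-≼1 m = ≼-respˡ (κ-· m) (κ-≼1 _)

  -- First-order binomial expansion with an integral remainder, enough to isolate the derivative m
  -- of the m-th power at 1.
  second-order : ∀ {w} → w ≼ 1# → ∀ m → Σ[ r ∈ Carrier ] r ≼ 1# × (1# + w) ^ m ≈ 1# + m · 1# * w + w * w * r
  second-order {w} w≼1 zero    = 0# , 0≼ 1# , solve 1 (λ w → :1 := :1 :+ :0 :* w :+ w :* w :* :0) refl w
  second-order {w} w≼1 (suc m) =
    let r , r≼1 , eq = second-order w≼1 m in
    m · 1# + r + w * r , +-≼ (+-≼ (·1-≼1 m) r≼1) (*-≼1 w≼1 r≼1) ,
    trans (*-congˡ eq) (solve 3 (λ w M r → (:1 :+ w) :* (:1 :+ M :* w :+ w :* w :* r) :=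
      :1 :+ (:1 :+ M) :* w :+ w :* w :* (M :+ r :+ w :* r)) refl w (m · 1#) r)

  -- The coefficient of w in (1 + w) ^ m is the unit m, unless p divides m.
  ^-additive⇒≡1 : ∀ {w m} → ∣ w ∣ <ᵐ 1ᵐ → w ≉ 0# → ¬ 𝔽.p ℕ.∣ m → (1# + w) ^ m ≈ 1# + w ^ m → m ≡ 1
  ^-additive⇒≡1 {w} {zero}        w<1 w≉0 p∤m eq = contradiction (𝔽.p ℕ.∣0) p∤m
  ^-additive⇒≡1 {w} {suc zero}    w<1 w≉0 p∤m eq = ≡.refl
  ^-additive⇒≡1 {w} {m@(suc (suc n))} w<1 w≉0 p∤m eq = ⊥-elim (<1⇒1⋠ w<1 (≼-trans 1≼m m≼w))
    where
    1≼m : 1# ≼ m · 1#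
    1≼m = ≼-respʳ (κ-· m) (≤ᵐ-reflexive (≡.trans ∣1∣ (≡.sym (∣ι∣≡1 _ (∤⇒·1≉0 p∤m)))))
    m≼w : m · 1# ≼ w
    m≼w =
      let r , r≼1 , expand = second-order (<1⇒≼1 w<1) m in
      ≼-respˡ
        (sym (*-cancelˡ {w} {m · 1#} {(w ^ n - r) * w} w≉0 (begin
          w * m · 1#                                              ≈⟨ solve 3 (λ w M R → w :* M := (:1 :+ M :* w :+ R) :- (:1 :+ R)) refl w (m · 1#) (w * w * r) ⟩
          (1# + m · 1# * w + w * w * r) - (1# + w * w * r)        ≈⟨ +-congʳ (trans (sym expand) eq) ⟩
          (1# + w * (w * w ^ n)) - (1# + w * w * r)               ≈⟨ solve 3 (λ w t r → (:1 :+ w :* (w :* t)) :- (:1 :+ w :* w :* r) := w :* ((t :- r) :* w)) refl w (w ^ n) r ⟩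
          w * ((w ^ n - r) * w)                                   ∎)))
        (*-≼1 (∸-≼ (^-≼1 n (<1⇒≼1 w<1)) r≼1) ≼-refl)

  -- Let K = j ν + k with k < ν. The q^j-th power is the identity on 𝐅_q, so all q elements satisfy
  -- a^(p^k) = a. For k > 0 they would be roots of X^(p^k) - X, whose degree is below q.
  fixed⇒q-power : ∀ K → (∀ a → a 𝔽.^ (𝔽.p ^ℕ K) 𝔽.≈ a) → ∃[ j ] 𝔽.p ^ℕ K ≡ q ^ℕ j
  fixed⇒q-power K fixed = j , (case (K ℕ.% ν) (≡.refl {x = K ℕ.% ν}))
    where
    p = 𝔽.p ; ν = 𝔽.ν
    instance _ = 𝔽.ν-nonZero
    j = K ℕ./ ν
    p^K : ∀ k → K ℕ.% ν ≡ k → p ^ℕ K ≡ q ^ℕ j ℕ.* p ^ℕ k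
    p^K k ≡.refl = ≡.trans (≡.cong (p ^ℕ_) (ℕ.m≡m%n+[m/n]*n K ν))
      (≡.trans (ℕ.^-distribˡ-+-* p k (j ℕ.* ν)) (≡.trans (ℕ.*-comm (p ^ℕ k) _)
      (≡.cong (ℕ._* p ^ℕ k) (≡.trans (≡.cong (p ^ℕ_) (ℕ.*-comm j ν)) (≡.sym (ℕ.^-*-assoc p ν j))))))
    fixed′ : ∀ k → K ℕ.% ν ≡ k → ∀ a → a 𝔽.^ (p ^ℕ k) 𝔽.≈ a
    fixed′ k K≡ a = 𝔽.trans (𝔽.^-congˡ (p ^ℕ k) (𝔽.sym (𝔽.fermat^ j a)))
      (𝔽.trans (𝔽.^-assocʳ a (q ^ℕ j) (p ^ℕ k)) (𝔽.trans (𝔽.^-congʳ a (≡.sym (p^K k K≡))) (fixed a)))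
    case : ∀ k → K ℕ.% ν ≡ k → p ^ℕ K ≡ q ^ℕ j
    case zero    K≡ = ≡.trans (p^K 0 K≡) (ℕ.*-identityʳ _)
    case (suc k) K≡ = ⊥-elim (bound (p ^ℕ suc k) ≡.refl 1<p^k)
      where
      1<p^k : 1 ℕ.< p ^ℕ suc k
      1<p^k = ℕ.≤-trans 𝔽.1<p (ℕ.m≤m*n p (p ^ℕ k) {{ℕ.m^n≢0 p k {{prime⇒nonZero 𝔽.p-prime}}}})
      p^k<q : p ^ℕ suc k ℕ.< q
      p^k<q = ℕ.^-monoʳ-< p 𝔽.1<p (≡.subst (ℕ._< ν) K≡ (ℕ.m%n<n K ν))
      bound : ∀ d → p ^ℕ suc k ≡ d → 1 ℕ.< d → ⊥
      bound (suc zero)    _  (s≤s ())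
      bound (suc (suc d)) p^k≡ _ = ℕ.<⇒≱ p^k<q (≡.subst₂ ℕ._≤_ 𝔽.length-elements (≡.sym p^k≡)
        (𝔽.roots-≤-degree 𝔽.X^[2+ d ]-X 𝔽.elements-distinct (All.universal (λ a →
          𝔽.trans (𝔽.monic-X^-X d a) (𝔽.x≈y⇒x-y≈0 (≡.subst (λ n → a 𝔽.^ n 𝔽.≈ a) p^k≡ (fixed′ (suc k) K≡ a)))) 𝔽.elements)))

  -- Write n = p^K m with m prime to p. For a = 1, Frobenius moves p^K inside, and additivity of the
  -- m-th power at 1 + x^(p^K) gives m = 1. For general a there remains a^(p^K) = a.
  linear-exponent : ∀ n → .{{_ : ℕ.NonZero n}} → (∀ a → (1# + κ a * x) ^ n ≈ 1# + κ a * x ^ n) → ∃[ j ] n ≡ q ^ℕ j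
  linear-exponent n linear =
    let K , m , n≡ , p∤m = p-part n in
    case K m n≡ p∤m
    where
    p = 𝔽.p
    case : ∀ K m → n ≡ p ^ℕ K ℕ.* m → ¬ p ℕ.∣ m → ∃[ j ] n ≡ q ^ℕ j
    case K m n≡ p∤m = proj₁ power , ≡.trans n≡P (proj₂ power)
      where
      P = p ^ℕ K
      instance
        _ = prime⇒nonZero 𝔽.p-prime
      P-nonZero : ℕ.NonZero P
      P-nonZero = ℕ.m^n≢0 p K
      ^P : ∀ a → (1# + κ a * x) ^ P ≈ 1# + κ (a 𝔽.^ P) * x ^ P
      ^P a = trans (^p^-+ K 1# (κ a * x)) (+-cong (1^n≈1 P) (trans (^-distrib-* (κ a) x P) (*-congʳ (sym (κ-^ a P)))))
      κ1^P : κ (𝔽.1# 𝔽.^ P) * x ^ P ≈ x ^ P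
      κ1^P = trans (*-congʳ (trans (κ-cong (𝔽.1^n≈1 P)) κ-1)) (*-identityˡ _)
      m≡1 : m ≡ 1
      m≡1 = ^-additive⇒≡1 (^-<1 P {{P-nonZero}} x<1) (x^n≉0 P) p∤m (begin
        (1# + x ^ P) ^ m                     ≈⟨ ^-congˡ m (+-congˡ κ1^P) ⟨
        (1# + κ (𝔽.1# 𝔽.^ P) * x ^ P) ^ m   ≈⟨ ^-congˡ m (^P 𝔽.1#) ⟨
        ((1# + κ 𝔽.1# * x) ^ P) ^ m          ≈⟨ ^-assocʳ _ P m ⟩
        (1# + κ 𝔽.1# * x) ^ (P ℕ.* m)        ≈⟨ ^-congʳ _ n≡ ⟨
        (1# + κ 𝔽.1# * x) ^ n                ≈⟨ linear 𝔽.1# ⟩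
        1# + κ 𝔽.1# * x ^ n                  ≈⟨ +-congˡ (trans (*-congʳ κ-1) (*-identityˡ _)) ⟩
        1# + x ^ n                            ≈⟨ +-congˡ (trans (^-assocʳ x P m) (^-congʳ x (≡.sym n≡))) ⟨
        1# + (x ^ P) ^ m                      ∎)
      n≡P : n ≡ P
      n≡P = ≡.trans n≡ (≡.trans (≡.cong (P ℕ.*_) m≡1) (ℕ.*-identityʳ P))
      fixed : ∀ a → a 𝔽.^ P 𝔽.≈ a
      fixed a = κ-injective (*-cancelˡ (x^n≉0 P) (begin
        x ^ P * κ (a 𝔽.^ P)                      ≈⟨ solve 2 (λ u v → u :* v := (:1 :+ v :* u) :- :1) refl (x ^ P) (κ (a 𝔽.^ P)) ⟩
        (1# + κ (a 𝔽.^ P) * x ^ P) - 1#          ≈⟨ +-congʳ (trans (sym (^P a)) (≡.subst (λ d → (1# + κ a * x) ^ d ≈ 1# + κ a * x ^ d) n≡P (linear a))) ⟩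
        (1# + κ a * x ^ P) - 1#                   ≈⟨ solve 2 (λ u v → (:1 :+ v :* u) :- :1 := u :* v) refl (x ^ P) (κ a) ⟩
        x ^ P * κ a                               ∎))
      power = fixed⇒q-power K fixed

  -- In a sum equal to 0 the leading term is minus the tail, and a tail is no larger than a common
  -- bound of its terms.
  HasSum-leading : ∀ m (b : ℕ → Carrier) {d} → d ≉ 0# → HasSum b 0# → (∀ n → n ℕ.< m → b n ≈ 0#) →
                   (∀ n → m ℕ.< n → b n ≼ d) → b m ≼ d
  HasSum-leading zero    b {d} d≉0 sum _   b≼d =
    ≼-respˡ (solve 1 (λ b → :- (:0 :- b) := b) refl (b 0))
      (-‿≼ (⟶-≼ d≉0 (λ n → ∑-≼ n {b ∘ suc} (λ k → b≼d (suc k) (s≤s z≤n))) (HasSum-suc b sum)))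
  HasSum-leading (suc m) b d≉0 sum b≈0 b≼d = HasSum-leading m (b ∘ suc) d≉0
    (HasSum-cong (b ∘ suc) (b ∘ suc) (λ _ → refl) (x≈y⇒x-y≈0 (sym (b≈0 0 (s≤s z≤n)))) (HasSum-suc b sum))
    (λ n n<m → b≈0 (suc n) (s≤s n<m)) (λ n m<n → b≼d (suc n) (s≤s m<n))

  -- The identity theorem on points accumulating at 0. When the coefficients below m vanish,
  -- cancellation at x^(N+i) makes the m-th term no larger than the later ones, which carry a
  -- further factor x^i; letting i grow forces `b m` to be 0.
  coefficients-vanish : ∀ (b : ℕ → Carrier) N → (∀ i → HasSum (λ n → b n * (x ^ (N ℕ.+ i)) ^ n) 0#) → ∀ n → b n ≈ 0#
  coefficients-vanish b N sums = ℕ.<-rec _ step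
    where
    -- Convergence at the outermost point x^N bounds the normalised coefficients uniformly in n.
    bounded : ∃[ j ] ∀ n → x ^ j * (b n * (x ^ N) ^ n) ≼ 1#
    bounded = null-bounded (null-cong (λ n → *-congˡ (^-congˡ n (^-congʳ x (ℕ.+-identityʳ N))))
                (HasSum⇒null (λ n → b n * (x ^ (N ℕ.+ 0)) ^ n) (sums 0)))
    j = proj₁ bounded
    rescale : ∀ i n → x ^ j * (b n * (x ^ (N ℕ.+ i)) ^ n) ≈ (x ^ j * (b n * (x ^ N) ^ n)) * (x ^ i) ^ n
    rescale i n = trans (*-congˡ (*-congˡ (trans (^-congˡ n (^-homo-* x N i)) (^-distrib-* _ _ n))))
      (solve 4 (λ a b d e → a :* (b :* (d :* e)) := (a :* (b :* d)) :* e) refl _ _ _ _)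
    step : ∀ m → (∀ {n} → n ℕ.< m → b n ≈ 0#) → b m ≈ 0#
    step m b≈0 = *-zero-cancelˡ (^-nonZero m (x^n≉0 N)) (trans (*-comm _ _) (*-zero-cancelˡ (x^n≉0 j) (≼x^⇒≈0 small)))
      where
      small : ∀ i → x ^ j * (b m * (x ^ N) ^ m) ≼ x ^ i
      small i = *-cancelˡ-≼ (^-nonZero m (x^n≉0 i)) (≼-respˡ (trans (rescale i m) (*-comm _ _)) (≼-respʳ (*-comm _ _)
        (HasSum-leading m (λ n → x ^ j * (b n * (x ^ (N ℕ.+ i)) ^ n)) (^-nonZero (suc m) (x^n≉0 i))
          (HasSum-cong (λ n → x ^ j * (b n * (x ^ (N ℕ.+ i)) ^ n)) _ (λ _ → refl) (zeroʳ _)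
            (HasSum-* (x ^ j) (λ n → b n * (x ^ (N ℕ.+ i)) ^ n) (sums i)))
          (λ n n<m → trans (*-congˡ (trans (*-congʳ (b≈0 n<m)) (zeroˡ _))) (zeroʳ _))
          (λ n m<n → ≼-respˡ (sym (rescale i n)) (*-≼1 (proj₂ bounded n) (^-antimono-≼ (^-≼1 i x≼1) m<n))))))

  -- A finite search: for z ≠ 0 some x^k is no larger than z, which excludes exponents above k.
  power-of-x? : ∀ z → Dec (∃[ n ] z ≈ x ^ n)
  power-of-x? z with z ≟0
  ... | yes z≈0 = no λ (n , z≈x^n) → x^n≉0 n (trans (sym z≈x^n) z≈0)
  ... | no  z≉0 with x^-≼ z≉0
  ...   | k , x^k≼z = Dec.map′ (λ (n , _ , z≈x^n) → n , z≈x^n)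
    (λ (n , z≈x^n) → n , s≤s (^-cancel-≼ {k} {n} (≼-respʳ z≈x^n x^k≼z)) , z≈x^n)
    (ℕ.anyUpTo? (λ n → Dec.map′ x-y≈0⇒x≈y x≈y⇒x-y≈0 (z - x ^ n ≟0)) (suc k))

  module AnalyticEvaluation {g z} (z<1 : ∣ z ∣ <ᵐ 1ᵐ) (ev : g EvaluatesAt z) where

    open Evaluates z<1 ev

    monomial⇒q-power : ∀ n → z ≈ x ^ n → (∀ t → g t ≈ ι t ^ n) → ∃[ j ] z ≈ x ^ (q ^ℕ j)
    monomial⇒q-power zero    z≈1   _     = ⊥-elim (<1⇒1⋠ z<1 (≼-reflexive (sym z≈1)))
    monomial⇒q-power (suc n) z≈x^n g≈^n =
      let j , n≡ = linear-exponent (suc n) linear in j , trans z≈x^n (^-congʳ x n≡)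
      where
      linear : ∀ a → (1# + κ a * x) ^ suc n ≈ 1# + κ a * x ^ suc n
      linear a = begin
        (1# + κ a * x) ^ suc n              ≈⟨ ^-congˡ (suc n) ι-t ⟨
        ι t ^ suc n                         ≈⟨ g≈^n t ⟨
        g t                                 ≈⟨ ev-+ (const 𝔽.1#) (xₒ *ₒ const a) ⟩
        g (const 𝔽.1#) + g (xₒ *ₒ const a)  ≈⟨ +-cong (trans (ev-const 𝔽.1#) κ-1) (trans (ev-xₒ* (const a)) (*-cong z≈x^n (ev-const a))) ⟩
        1# + x ^ suc n * κ a                ≈⟨ +-congˡ (*-comm _ _) ⟩
        1# + κ a * x ^ suc n                ∎
        where
        t : O
        t k = const 𝔽.1# k 𝔽.+ (xₒ *ₒ const a) k
        ι-t : ι t ≈ 1# + κ a * x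
        ι-t = trans (ι-+ (const 𝔽.1#) (xₒ *ₒ const a)) (+-cong κ-1 (trans (ι-* xₒ (const a)) (*-comm _ _)))

    -- Comparing coefficients in g (x t) = z g (t) leaves only the
    -- exponents n with xⁿ = z.
    analytic-at-0 : ∀ N (a : ℕ → Carrier) → z ^ N ≉ 0# →
                    (∀ t → ι t ≼ x ^ N → HasSum (λ n → a n * ι t ^ n) (g t)) → ∃[ j ] z ≈ x ^ (q ^ℕ j)
    analytic-at-0 N a z^N≉0 sums = case (power-of-x? z)
      where
      sums-x^ : ∀ k → N ℕ.≤ k → HasSum (λ n → a n * (x ^ k) ^ n) (z ^ k)
      sums-x^ k N≤k = HasSum-cong (λ n → a n * ι (xₒ ^ₒ k) ^ n) _ (λ n → *-congˡ (^-congˡ n (ι-^ xₒ k))) (ev-xₒ^ k)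
        (sums (xₒ ^ₒ k) (≼-respˡ (sym (ι-^ xₒ k)) (^-antimono-≼ x≼1 N≤k)))
      a*[x^-z]≈0 : ∀ n → a n * (x ^ n - z) ≈ 0#
      a*[x^-z]≈0 = coefficients-vanish (λ n → a n * (x ^ n - z)) N λ i →
        let k = N ℕ.+ i in
        HasSum-cong (λ n → a n * (x ^ suc k) ^ n + - z * (a n * (x ^ k) ^ n)) (λ n → a n * (x ^ n - z) * (x ^ k) ^ n)
          (λ n → trans (+-congʳ (*-congˡ (^-distrib-* x (x ^ k) n)))
            (solve 4 (λ a z X w → a :* (X :* w) :+ :- z :* (a :* w) := a :* (X :- z) :* w) refl (a n) z (x ^ n) ((x ^ k) ^ n)))
          (solve 2 (λ z w → z :* w :+ :- z :* w := :0) refl z (z ^ k))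
          (HasSum-+ (λ n → a n * (x ^ suc k) ^ n) (λ n → - z * (a n * (x ^ k) ^ n))
            (sums-x^ (suc k) (ℕ.m≤n⇒m≤1+n (ℕ.m≤m+n N i)))
            (HasSum-* (- z) (λ n → a n * (x ^ k) ^ n) (sums-x^ k (ℕ.m≤m+n N i))))
      a≈0 : ∀ n → z ≉ x ^ n → a n ≈ 0#
      a≈0 n z≉x^n = *-zero-cancelˡ (λ x^n-z≈0 → z≉x^n (sym (x-y≈0⇒x≈y x^n-z≈0))) (trans (*-comm _ _) (a*[x^-z]≈0 n))
      case : Dec (∃[ n ] z ≈ x ^ n) → ∃[ j ] z ≈ x ^ (q ^ℕ j)
      case (no  z≉x^) = ⊥-elim (z^N≉0 (⟶-unique (sums-x^ N ℕ.≤-refl)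
        (HasSum-zero (λ n → a n * (x ^ N) ^ n) (λ n → trans (*-congʳ (a≈0 n (λ z≈x^n → z≉x^ (n , z≈x^n)))) (zeroˡ _)))))
      case (yes (n , z≈x^n)) = monomial⇒q-power n z≈x^n global
        where
        distinct : ∀ {m} → m ≢ n → z ≉ x ^ m
        distinct {m} m≢n z≈x^m = m≢n (ℕ.≤-antisym (^-cancel-≼ {n} {m} (≼-reflexive (trans (sym z≈x^n) z≈x^m)))
                                                   (^-cancel-≼ {m} {n} (≼-reflexive (trans (sym z≈x^m) z≈x^n))))
        local : ∀ t → ι t ≼ x ^ N → g t ≈ a n * ι t ^ n
        local t ιt≼ = ⟶-unique (sums t ιt≼)
          (HasSum-single n (λ m → a m * ι t ^ m) (λ m m≢n → trans (*-congʳ (a≈0 m (distinct m≢n))) (zeroˡ _)))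
        z^N≈ : z ^ N ≈ (x ^ N) ^ n
        z^N≈ = trans (^-congˡ N z≈x^n) (^-comm x n N)
        a≈1 : a n ≈ 1#
        a≈1 = *-cancelˡ (^-nonZero n (x^n≉0 N)) (begin
          (x ^ N) ^ n * a n        ≈⟨ *-comm _ _ ⟩
          a n * (x ^ N) ^ n        ≈⟨ *-congˡ (^-congˡ n (ι-^ xₒ N)) ⟨
          a n * ι (xₒ ^ₒ N) ^ n    ≈⟨ local (xₒ ^ₒ N) (≼-reflexive (ι-^ xₒ N)) ⟨
          g (xₒ ^ₒ N)              ≈⟨ ev-xₒ^ N ⟩
          z ^ N                    ≈⟨ z^N≈ ⟩
          (x ^ N) ^ n              ≈⟨ *-identityʳ _ ⟨
          (x ^ N) ^ n * 1#         ∎)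
        global : ∀ t → g t ≈ ι t ^ n
        -- The relation g(x^N t) = z^N g(t) carries the identity g(t) = tⁿ from the ball around 0 to
        -- all of O.
        global t = *-cancelˡ (^-nonZero n (x^n≉0 N)) (begin
          (x ^ N) ^ n * g t              ≈⟨ *-congʳ z^N≈ ⟨
          z ^ N * g t                    ≈⟨ ev-xₒ^* N t ⟨
          g ((xₒ ^ₒ N) *ₒ t)             ≈⟨ local _ (≼-respˡ (sym ι-scaled) (≼-respˡ (*-comm _ _) (*-≼1 (ι-≼1 t) ≼-refl))) ⟩
          a n * ι ((xₒ ^ₒ N) *ₒ t) ^ n   ≈⟨ trans (*-congʳ a≈1) (*-identityˡ _) ⟩
          ι ((xₒ ^ₒ N) *ₒ t) ^ n         ≈⟨ ^-congˡ n ι-scaled ⟩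
          (x ^ N * ι t) ^ n              ≈⟨ ^-distrib-* _ _ n ⟩
          (x ^ N) ^ n * ι t ^ n          ∎)
          where
          ι-scaled : ι ((xₒ ^ₒ N) *ₒ t) ≈ x ^ N * ι t
          ι-scaled = trans (ι-* (xₒ ^ₒ N) t) (*-congʳ (ι-^ xₒ N))

    -- By additivity g (t) = g (b + t) - g (b), so the power series can be
    -- moved from the center b to 0.
    analyticOn⇒q-power : ∀ (B : Pred O 0ℓ) N → (∀ b t → B b → ι t ≼ x ^ N → B (λ n → b n 𝔽.+ t n)) →
                         z ^ N ≉ 0# → AnalyticOn B g → ∃[ j ] z ≈ x ^ (q ^ℕ j)
    analyticOn⇒q-power B N B-+ z^N≉0 (b , Bb , a , sums) = analytic-at-0 N a′ z^N≉0 sums′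
      where
      -- The constant coefficient of the given series is g(b). Adding `-a₀` removes it, and `a′` is
      -- what remains: the series of g(b + t) - g(b).
      a′ -a₀ : ℕ → Carrier
      a′ zero    = 0#
      a′ (suc n) = a (suc n)
      -a₀ zero    = - a 0
      -a₀ (suc n) = 0#
      a₀≈gb : a 0 ≈ g b
      a₀≈gb = trans (sym (*-identityʳ _)) (⟶-unique
        (HasSum-single 0 (λ n → a n * (ι b - ι b) ^ n) λ
          { zero 0≢0 → contradiction ≡.refl 0≢0
          ; (suc n) _ → trans (*-congˡ (trans (^-congˡ (suc n) (-‿inverseʳ (ι b))) (zeroˡ _))) (zeroʳ _) })
        (sums b Bb))
      sums′ : ∀ t → ι t ≼ x ^ N → HasSum (λ n → a′ n * ι t ^ n) (g t)
      sums′ t ιt≼ = HasSum-cong (λ n → a n * (ι b+t - ι b) ^ n + -a₀ n) (λ n → a′ n * ι t ^ n)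
        (λ { zero → solve 1 (λ a → a :* :1 :+ :- a := :0 :* :1) refl (a 0)
           ; (suc n) → trans (+-identityʳ _) (*-congˡ (^-congˡ (suc n) b+t-b)) })
        (trans (+-cong (ev-+ b t) (-‿cong a₀≈gb)) (solve 2 (λ b t → (b :+ t) :+ :- b := t) refl (g b) (g t)))
        (HasSum-+ (λ n → a n * (ι b+t - ι b) ^ n) -a₀ (sums b+t (B-+ b t Bb ιt≼))
          (HasSum-single 0 -a₀ (λ { zero 0≢0 → contradiction ≡.refl 0≢0 ; (suc n) _ → refl })))
        where
        b+t : O
        b+t n = b n 𝔽.+ t n
        b+t-b : ι b+t - ι b ≈ ι t
        b+t-b = trans (+-congʳ (ι-+ b t)) (solve 2 (λ b t → (b :+ t) :- b := t) refl (ι b) (ι t))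

    -- On the whole of O the radius exponent is 0, and z⁰ = 1 is non-zero for every z. Hence z = 0
    -- is covered too, where g is locally but not globally analytic.
    analytic⇒q-power : Analytic g → ∃[ j ] z ≈ x ^ (q ^ℕ j)
    analytic⇒q-power = analyticOn⇒q-power U 0 (λ _ _ _ _ → tt) 1≉0

    -- The ball around 0 suffices, because multiplication by x maps it into itself; z ≠ 0 provides
    -- the non-zero value g(x^N) = z^N inside it.
    locallyAnalytic⇒q-power : z ≉ 0# → LocallyAnalytic g → ∃[ j ] z ≈ x ^ (q ^ℕ j)
    locallyAnalytic⇒q-power z≉0 analytic =
      let r , analyticOn = analytic 0ₒ
          N , x^N≤ = x^-≤ r in
      analyticOn⇒q-power (Ball 0ₒ r) N (ball-+ {r} {N} x^N≤) (^-nonZero N z≉0) analyticOn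
      where
      0ₒ : O
      0ₒ _ = 𝔽.0#
      ball-+ : ∀ {r N} → ∣ x ^ N ∣ ≤ᵐ 𝐪^ r → ∀ b t → Ball 0ₒ r b → ι t ≼ x ^ N → Ball 0ₒ r (λ n → b n 𝔽.+ t n)
      ball-+ x^N≤ b t b∈B ιt≼ = ≤ᵐ-trans
        (≼-reflexive (trans (+-congʳ (ι-+ b t)) (solve 3 (λ b t o → (b :+ t) :- o := (b :- o) :+ t) refl (ι b) (ι t) (ι 0ₒ))))
        (ultrametric (ι b - ι 0ₒ) (ι t) b∈B (≤ᵐ-trans ιt≼ x^N≤))

  q-power-analytic : ∀ {g} j → (∀ t → g t ≈ ι t ^ (q ^ℕ j)) → Analytic g
  q-power-analytic {g} j g≈ = (λ _ → 𝔽.0#) , tt , δ , λ t _ →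
    HasSum-cong (λ n → δ n * (ι t - ι (λ _ → 𝔽.0#)) ^ n) _ (λ _ → refl)
      (trans (trans (*-cong δ-Q (^-congˡ Q (trans (+-congˡ (trans (-‿cong ι-0) -0#≈0#)) (+-identityʳ _)))) (*-identityˡ _)) (sym (g≈ t)))
      (HasSum-single Q (λ n → δ n * (ι t - ι (λ _ → 𝔽.0#)) ^ n) (λ n n≢Q → trans (*-congʳ (δ-≢ n≢Q)) (zeroˡ _)))
    where
    Q = q ^ℕ j
    δ : ℕ → Carrier
    δ n with n ℕ.≟ Q
    ... | yes _ = 1#
    ... | no  _ = 0#
    δ-Q : δ Q ≈ 1#
    δ-Q with Q ℕ.≟ Q
    ... | yes _   = refl
    ... | no  Q≢Q = contradiction ≡.refl Q≢Q
    δ-≢ : ∀ {n} → n ≢ Q → δ n ≈ 0#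
    δ-≢ {n} n≢Q with n ℕ.≟ Q
    ... | yes n≡Q = contradiction n≡Q n≢Q
    ... | no  _   = refl

  ≤q⁻¹⇒0th≈0 : ∀ t → ∣ ι t ∣ ≤ᵐ 𝐪^ (-1ℤ / 1) → t 0 𝔽.≈ 𝔽.0#
  ≤q⁻¹⇒0th≈0 t small = ≼x^⇒prefix≈0 1 t
    (≼-respʳ (sym (*-identityʳ x)) (≤ᵐ-trans small (≤ᵐ-reflexive (≡.sym ∣x∣)))) 0 (s≤s z≤n)

  -- All series in a ball of radius 1/q share their constant term, so g is constant there.
  constant-term-locallyAnalytic : ∀ {g} → (∀ t → g t ≈ κ (t 0)) → LocallyAnalytic g
  constant-term-locallyAnalytic {g} g≈ t₀ = -1ℤ / 1 , t₀ , t₀∈B , a , λ t t∈B →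
    HasSum-cong (λ n → a n * (ι t - ι t₀) ^ n) _ (λ _ → refl)
      (trans (*-identityʳ _) (trans (g≈ t₀) (trans (κ-cong (𝔽.sym (𝔽.x-y≈0⇒x≈y
        (≤q⁻¹⇒0th≈0 (λ n → t n 𝔽.- t₀ n) (≤ᵐ-trans (≼-reflexive (ι-sub t t₀)) t∈B))))) (sym (g≈ t)))))
      (HasSum-single 0 (λ n → a n * (ι t - ι t₀) ^ n) λ
        { zero 0≢0 → contradiction ≡.refl 0≢0 ; (suc n) _ → zeroˡ _ })
    where
    a : ℕ → Carrier
    a zero    = g t₀
    a (suc n) = 0#
    t₀∈B : Ball t₀ (-1ℤ / 1) t₀
    t₀∈B = ≤ᵐ-trans (≼-reflexive (-‿inverseʳ (ι t₀))) (≤ᵐ-trans (≤ᵐ-reflexive ∣0∣) (0≤ _))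

theorem1 : ∀ {c ℓ} (F : FiniteField c ℓ) (C : CompletedClosure F) →
  let open Carlitz F C in
  -- the series converges
  (∀ λ′ → ∣ λ′ ∣ <ᵐ 1ᵐ → ∀ t → ∃[ s ] HasSum (λ n → uCoefficient λ′ n * f n t) s) ×
  (∀ (u : Carrier → O → Carrier) →
   (∀ λ′ → ∣ λ′ ∣ <ᵐ 1ᵐ → HasExpansion (u λ′) (uCoefficient λ′)) →
     -- u(·,λ) is the solution with c₀ = 1
     (∀ λ′ → ∣ λ′ ∣ <ᵐ 1ᵐ →
        uCoefficient λ′ 0 ≈ 1# × uCoefficient λ′ ⟶ 0# × Solves λ′ (u λ′) ×
        (∀ v a → a ⟶ 0# → a 0 ≈ 1# → HasExpansion v a → Solves λ′ v →
           ∀ t → v t ≈ u λ′ t)) ×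
     -- (i)
     (∀ λ′ → ∣ λ′ ∣ <ᵐ 1ᵐ → Continuous (u λ′)) ×
     -- (ii)
     (∀ λ′ → ∣ λ′ ∣ <ᵐ 1ᵐ →
        (Analytic (u λ′) ⇔ (∃[ j ] λ′ ≈ [ j ])) ×
        (∀ j → λ′ ≈ [ j ] → ∀ t → u λ′ t ≈ u [ j ] t × u [ j ] t ≈ ι t ^ (q ^ℕ j))) ×
     -- (iii)
     (∀ λ′ → ∣ λ′ ∣ <ᵐ 1ᵐ → (∀ j → λ′ ≉ [ j ]) →
        (LocallyAnalytic (u λ′) ⇔ λ′ ≈ - x) ×
        (λ′ ≈ - x → ∀ t → ∣ ι t ∣ ≤ᵐ 𝐪^ (-1ℤ / 1) → u (- x) t ≈ 0#)) ×
     -- (iv)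
     (∀ λ′ → ∣ λ′ ∣ <ᵐ 1ᵐ → ∀ (m : ℕ) →
        ∣ λ′ ^ (q ^ℕ m) + [ m ] ∣ <ᵐ 1ᵐ ×
        (∀ t → u λ′ (t ^ₒ (q ^ℕ m)) ≈ u (λ′ ^ (q ^ℕ m) + [ m ]) t)))
theorem1 F C = (λ λ′ λ<1 → Expansion.converges λ<1) , λ u expansion →
  let
    ev : ∀ {λ′} → ∣ λ′ ∣ <ᵐ 1ᵐ → u λ′ EvaluatesAt (x + λ′)
    ev {λ′} λ<1 = Expansion.expansion⇒evaluates λ<1 (expansion λ′ λ<1)

    x+λ≈x^ : ∀ {λ′} j → λ′ ≈ [ j ] → x + λ′ ≈ x ^ (q ^ℕ j)
    x+λ≈x^ j λ≈[j] = trans (+-congˡ λ≈[j]) (solve 2 (λ x X → x :+ (X :- x) := X) refl x (x ^ (q ^ℕ j)))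

    λ≈[] : ∀ {λ′} → ∃[ j ] x + λ′ ≈ x ^ (q ^ℕ j) → ∃[ j ] λ′ ≈ [ j ]
    λ≈[] {λ′} (j , z≈x^) = j , trans (solve 2 (λ x l → l := (x :+ l) :- x) refl x λ′) (+-congʳ z≈x^)

    x+λ≈0 : ∀ {λ′} → λ′ ≈ - x → x + λ′ ≈ 0#
    x+λ≈0 λ≈-x = trans (+-congˡ λ≈-x) (-‿inverseʳ x)

    u≈^ : ∀ {λ′} → ∣ λ′ ∣ <ᵐ 1ᵐ → ∀ j → λ′ ≈ [ j ] → ∀ t → u λ′ t ≈ ι t ^ (q ^ℕ j)
    u≈^ λ<1 j λ≈[j] = evaluates-unique (evaluates-resp (x+λ≈x^ j λ≈[j]) (ev λ<1)) (ι^q^-evaluates j)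

    u≈κ : ∀ {λ′} → ∣ λ′ ∣ <ᵐ 1ᵐ → λ′ ≈ - x → ∀ t → u λ′ t ≈ κ (t 0)
    u≈κ λ<1 λ≈-x = Evaluates.z≈0⇒ev≈κ (Expansion.z<1 λ<1) (ev λ<1) (x+λ≈0 λ≈-x)
  in
  (λ λ′ λ<1 → refl , Expansion.a⟶0 λ<1 , Expansion.evaluates⇒solves λ<1 (ev λ<1) ,
    λ v a a⟶0 a0≈1 v-expansion solves →
      evaluates-unique (Expansion.solution⇒evaluates λ<1 a⟶0 a0≈1 v-expansion solves) (ev λ<1)) ,
  (λ λ′ λ<1 → Evaluates.ev-continuous (Expansion.z<1 λ<1) (ev λ<1)) ,
  (λ λ′ λ<1 →
    mk⇔ (λ analytic → λ≈[] (AnalyticEvaluation.analytic⇒q-power (Expansion.z<1 λ<1) (ev λ<1) analytic))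
        (λ (j , λ≈[j]) → q-power-analytic j (u≈^ λ<1 j λ≈[j])) ,
    λ j λ≈[j] t → trans (u≈^ λ<1 j λ≈[j] t) (sym (u≈^ [ j ]<1 j refl t)) , u≈^ [ j ]<1 j refl t) ,
  (λ λ′ λ<1 λ≉[] →
    mk⇔ (λ analytic → trans (solve 2 (λ x l → l := (x :+ l) :- x) refl x λ′) (trans (+-congʳ
          -- Since being 0 is decidable, z = 0 may be shown by contradiction: otherwise z is some
          -- x^(q^j), that is λ = [j], which is excluded.
          (decidable-stable (x + λ′ ≟0) λ z≉0 →
            let j , λ≈[j] = λ≈[] (AnalyticEvaluation.locallyAnalytic⇒q-power (Expansion.z<1 λ<1) (ev λ<1) z≉0 analytic)
            in λ≉[] j λ≈[j]))
          (+-identityˡ _)))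
        (λ λ≈-x → constant-term-locallyAnalytic (u≈κ λ<1 λ≈-x)) ,
    λ _ t small → trans (u≈κ (-‿<1 x<1) refl t) (trans (κ-cong (≤q⁻¹⇒0th≈0 t small)) κ-0)) ,
  λ λ′ λ<1 m →
    let z′<1 = +-<1 (^-<1 (q ^ℕ m) {{q^n-nonZero m}} λ<1) [ m ]<1 in
    z′<1 , evaluates-unique
      -- With Q = q^m, (x + λ)^Q = x^Q + λ^Q = x + (λ^Q + [m]), so both sides of (iv) evaluate at
      -- the same point.
      (evaluates-resp (trans (^q^-+ m x λ′)
          (solve 3 (λ x X l → X :+ l := x :+ (l :+ (X :- x))) refl x (x ^ (q ^ℕ m)) (λ′ ^ (q ^ℕ m))))
        (Evaluates.ev-^q^ (Expansion.z<1 λ<1) (ev λ<1) m))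
      (ev z′<1)
  where open Analyticity F C
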